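{- Let $q$ be a prime power and $n\ge 1$. For $f\in\mathrm{Per}(\mathbb{F}_q^n)$ and $0\le k\le n$, let $k\text{ -affinity}(f)$ be the number of $k$-flats $X$ of $\mathbb{F}_q^n$ such that $f(X)$ is also a $k$-flat. Then: (i) If $q=2$ and $n\ge 3$ is odd, there exists $f\in\mathrm{Per}(\mathbb{F}_2^n)$ with $2\text{ -affinity}(f)=0$. (ii) If $q=2$ and $n\ge 4$, there exists $f\in\mathrm{Per}(\mathbb{F}_2^n)$ with $k\text{ -affinity}(f)=0$ for all $3\le k\le n-1$. (iii) If $q\ge 4$ and $n\ge 2$, there exists $f\in\mathrm{Per}(\mathbb{F}_q^n)$ with $k\text{ -affinity}(f)=0$ for all $1\le k\le n-1$. (iv) If $q=3$ and $n\ge 3$, there exists $f\in\mathrm{Per}(\mathbb{F}_3^n)$ with $k\text{ -affinity}(f)=0$ for all $2\le k\le n-1$. (v) If $q=3$ and $n\ge 2$, there exists $f\in\mathrm{Per}(\mathbb{F}_3^n)$ with $1\text{ -affinity}(f)=0$.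
   Context: $\mathbb{F}_q$ is the finite field with $q$ elements, $\mathbb{F}_q^n$ the $n$-dimensional vector space over it, and $\mathrm{Per}(\mathbb{F}_q^n)$ the group of all permutations (bijections) of $\mathbb{F}_q^n$. A $k$-flat of $\mathbb{F}_q^n$ is a coset $U+x$ of a $k$-dimensional linear subspace $U$. -}

module Defs where

open import Data.Nat using (ℕ; zero; suc; _^_)
open import Data.Nat.Primality using (Prime)
open import Data.Fin using (Fin)
open import Data.Vec using (Vec; []; _∷_; zipWith; map; replicate)
open import Data.Product using (Σ; ∃; _×_; _,_)
open import Algebra.Core using (Op₁; Op₂)
open import Algebra.Structures using (IsCommutativeRing)
open import Relation.Binary.PropositionalEquality using (_≡_; _≢_)
open import Function.Definitions using (Bijective)
open import Function.Bundles using (_⇔_)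

IsPrimePower : ℕ → Set
IsPrimePower q = Σ ℕ λ p → Σ ℕ λ e → Prime p × (q ≡ p ^ suc e)

record FieldOn (q : ℕ) : Set where
  infixl 6 _+_
  infixl 7 _*_
  field
    _+_ _*_ : Op₂ (Fin q)
    -_      : Op₁ (Fin q)
    0# 1#   : Fin q
    isCommutativeRing : IsCommutativeRing _≡_ _+_ _*_ -_ 0# 1#
    0≢1     : 0# ≢ 1#
    inverse : ∀ x → x ≢ 0# → Σ (Fin q) λ y → x * y ≡ 1#

module _ {q : ℕ} (F : FieldOn q) where
  open FieldOn F

  Pt : ℕ → Set
  Pt n = Vec (Fin q) n

  _⊕_ : ∀ {n} → Pt n → Pt n → Pt n
  u ⊕ v = zipWith _+_ u v

  _⊙_ : ∀ {n} → Fin q → Pt n → Pt n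
  a ⊙ v = map (a *_) v

  𝟎 : ∀ n → Pt n
  𝟎 n = replicate n 0#

  lincomb : ∀ {n k} → Vec (Fin q) k → Vec (Pt n) k → Pt n
  lincomb {n} [] [] = 𝟎 n
  lincomb (a ∷ as) (v ∷ vs) = (a ⊙ v) ⊕ lincomb as vs

  LinIndep : ∀ {n k} → Vec (Pt n) k → Set
  LinIndep {n} {k} vs = ∀ (as : Vec (Fin q) k) → lincomb as vs ≡ 𝟎 n → as ≡ replicate k 0#

  IsFlat : ∀ {n} → ℕ → (Pt n → Set) → Set
  IsFlat {n} k X =
    Σ (Pt n) λ x → Σ (Vec (Pt n) k) λ vs →
      LinIndep vs × (∀ y → X y ⇔ (Σ (Vec (Fin q) k) λ as → y ≡ x ⊕ lincomb as vs))

  Image : ∀ {n} → (Pt n → Pt n) → (Pt n → Set) → (Pt n → Set)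
  Image f X y = Σ _ λ x → X x × (f x ≡ y)

  IsPerm : ∀ {n} → (Pt n → Pt n) → Set
  IsPerm f = Bijective _≡_ _≡_ f

  AffinityZero : ∀ {n} → ℕ → (Pt n → Pt n) → Set₁
  AffinityZero {n} k f = ∀ (X : Pt n → Set) → IsFlat k X → IsFlat k (Image f X) → Data.Empty.⊥
    where import Data.Empty

{-# OPTIONS --safe #-}

-- For q ≥ 3 the permutation is built by induction on n.  Given a good g on F^n, let
-- f(t, x) = (t, g(x) + [t = 0] w) and compose f with the twist (t, y) ↦ (t + [y = 0], y).
-- A flat that is not contained in a slice t = c meets all slices in parallel flats, so g breaks it,
-- except for lines, which are broken by the choice of w.  The twist breaks the slices themselves,
-- and by counting points in slices it never turns a broken flat into an unbroken one.
--
-- For q = 2 the building block is inversion x ↦ 1/x in the field with 2^m elements.  If U is a subspace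
-- and a ∉ U, then the sum of 1/x over a + U is the logarithmic derivative at a of the additive polynomial
-- with root set U, hence nonzero, whereas the points of a flat of dimension at least 2 sum to zero.
-- So inversion breaks all such flats that avoid 0; in odd degree it also breaks the planes through 0,
-- because there is no primitive cube root of unity.  For (ii), use 1/x on the slice t = 0 and c/x on the
-- slice t = 1, where c generates the field: after the twist a surviving flat would be a product F_2 × U such
-- that the subspace of inverses of U is invariant under multiplication by c.
--
-- The field is constructed as the ring of polynomials in the shift operator acting on a nonzero
-- sequence b of period 2^m - 1 that generates a simple module.  Every such polynomial p satisfies
-- p^(2^m) = p, so p is invertible on the range of an idempotent, and b is obtained by cutting the
-- impulse sequence down by these idempotents one after the other.
module Submission where

open import Defs
open import Algebra.Bundles using (CommutativeRing; RawRing)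
import Algebra.Properties.AbelianGroup
import Algebra.Properties.CommutativeSemigroup
import Algebra.Properties.Ring
import Algebra.Properties.Semiring.Mult
import Algebra.Solver.Ring
open import Algebra.Solver.Ring.AlmostCommutativeRing using (fromCommutativeRing; _-Raw-AlmostCommutative⟶_)
open import Algebra.Structures using (IsCommutativeRing)
open import Data.Bool using (Bool; true; false; _xor_; _∧_)
open import Data.Empty using (⊥-elim)
open import Data.Fin using (Fin; zero; suc; toℕ; combine; remQuot; _≟_)
open import Data.Fin.Properties using (any?; combine-injective; combine-remQuot; injective⇒≤; pigeonhole; suc-injective; toℕ<n; toℕ-injective)
open import Data.List using (List; []; _∷_; _++_; foldr)
import Data.List as List
open import Data.List.Membership.Propositional using (_∈_)
open import Data.List.Membership.Propositional.Properties using (∈-map⁺; ∈-map⁻; ∈-++⁺ˡ; ∈-++⁺ʳ)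
open import Data.List.Membership.Propositional.Properties.WithK using (unique∧set⇒bag)
open import Data.List.Properties using (map-++; map-∘)
open import Data.List.Relation.Binary.BagAndSetEquality using (∼bag⇒↭)
open import Data.List.Relation.Binary.Permutation.Propositional using (_↭_; prep; swap)
import Data.List.Relation.Binary.Permutation.Propositional as ↭
open import Data.List.Relation.Unary.All using ([])
open import Data.List.Relation.Unary.AllPairs using ([]; _∷_)
open import Data.List.Relation.Unary.Any using (here)
open import Data.List.Relation.Unary.Unique.Propositional using (Unique)
import Data.List.Relation.Unary.Unique.Propositional.Properties as Unique
open import Data.Maybe using (Maybe; just; nothing)
open import Data.Maybe.Properties using (just-injective)
open import Data.Nat using (ℕ; zero; suc; _≤_; _<_; z≤n; s≤s; _^_)
import Data.Nat as ℕ
open import Data.Nat.DivMod using (_%_; [m+n]%n≡m%n; n%n≡0; m<n⇒m%n≡m)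
open import Data.Nat.GeneralisedArithmetic using (fold)
open import Data.Nat.Induction using (<-rec)
import Data.Nat.Properties as ℕ
open import Data.Product using (Σ; ∃; _×_; _,_; proj₁; proj₂)
open import Data.Sum using (_⊎_; inj₁; inj₂)
open import Data.Vec using (Vec; []; _∷_; head; tail; replicate; toList; zipWith)
import Data.Vec as Vec
open import Data.Vec.Properties using (∷-injective; ∷-injectiveˡ; ∷-injectiveʳ; toList∘fromList)
import Data.Vec.Properties as Vec
open import Function using (_∘_; id; _⇔_; mk⇔; Equivalence)
import Function.Construct.Composition as Composition
open import Function.Definitions using (Injective)
open import Level using (0ℓ)
open import Relation.Binary using (tri<; tri≈; tri>)
open import Relation.Binary.PropositionalEquality using (_≡_; _≢_; refl; sym; trans; cong; cong₂; subst; isEquivalence; module ≡-Reasoning)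
import Relation.Binary.Reasoning.Setoid
open import Relation.Nullary using (¬_; Dec; yes; no)
open import Relation.Nullary.Decidable using (_×-dec_; ¬?; decidable-stable; map′)

-- Two obstacles shape the case q ≥ 3. A line that crosses the slices meets each of them in a single
-- point, so no hypothesis on flats of F^n can break it; the induction therefore carries the
-- separate condition `Bent`. The offset w points along the coordinate that the twist changes, where
-- `Bent` reduces to a question about scalar functions of one parameter. Over F_2 any two points
-- form a line, so no permutation breaks lines. A k-flat that crosses the slices meets them in
-- dimension k - 1, and this has to be at least 2; hence the start k ≥ 3 in (ii). The field needs
-- exactly 2^m elements. Cutting by idempotents alone could end in a field with 2^d elements for a
-- proper divisor d of m. Therefore the product of all X^(2^d) - X with 1 ≤ d < m is made invertible
-- first; its degree 2^m - 2 is just small enough for it not to kill the impulse of period 2^m - 1.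
-- No irreducible polynomial is ever exhibited.

-- Integer coefficients are represented by formal differences of naturals.
module IntegerSolver (R : CommutativeRing 0ℓ 0ℓ) where
  open CommutativeRing R hiding (refl; sym; trans)
  private module CR = CommutativeRing R
  open Algebra.Properties.Semiring.Mult semiring using (×-homo-+; ×1-homo-*; ×-congˡ) renaming (_×_ to _⋆_)
  open Algebra.Properties.AbelianGroup +-abelianGroup using (⁻¹-∙-comm; ⁻¹-involutive)
  open Algebra.Properties.Ring ring using (-‿distribˡ-*; -‿distribʳ-*; -0#≈0#)
  open Algebra.Properties.CommutativeSemigroup +-commutativeSemigroup using (interchange)
  open Relation.Binary.Reasoning.Setoid setoid

  -- Common parts are cancelled, which keeps the representatives of an integer small.
  reduce : ℕ × ℕ → ℕ × ℕ
  reduce (suc a , suc b) = reduce (a , b)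
  reduce x = x

  Difference : RawRing 0ℓ 0ℓ
  Difference = record
    { Carrier = ℕ × ℕ
    ; _≈_ = _≡_
    ; _+_ = λ (a , b) (c , d) → reduce (a ℕ.+ c , b ℕ.+ d)
    ; _*_ = λ (a , b) (c , d) → reduce (a ℕ.* c ℕ.+ b ℕ.* d , a ℕ.* d ℕ.+ b ℕ.* c)
    ; -_ = λ (a , b) → b , a
    ; 0# = 0 , 0
    ; 1# = 1 , 0
    }

  ⟦_⟧ᶜ : ℕ × ℕ → Carrier
  ⟦ a , b ⟧ᶜ = a ⋆ 1# + - (b ⋆ 1#)

  private
    +-neg : ∀ a b c d → (a + c) + - (b + d) ≈ (a + - b) + (c + - d)
    +-neg a b c d = begin
      (a + c) + - (b + d)     ≈⟨ +-congˡ (⁻¹-∙-comm b d) ⟨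
      (a + c) + (- b + - d)   ≈⟨ interchange a c (- b) (- d) ⟩
      (a + - b) + (c + - d)   ∎

    neg*neg : ∀ b d → (- b) * (- d) ≈ b * d
    neg*neg b d = begin
      (- b) * (- d)  ≈⟨ -‿distribˡ-* b (- d) ⟨
      - (b * - d)    ≈⟨ -‿cong (-‿distribʳ-* b d) ⟨
      - - (b * d)    ≈⟨ ⁻¹-involutive (b * d) ⟩
      b * d          ∎

    *-neg : ∀ a b c d → (a * c + b * d) + - (a * d + b * c) ≈ (a + - b) * (c + - d)
    *-neg a b c d = begin
      (a * c + b * d) + - (a * d + b * c)
        ≈⟨ +-congˡ (⁻¹-∙-comm (a * d) (b * c)) ⟨
      (a * c + b * d) + (- (a * d) + - (b * c))
        ≈⟨ interchange (a * c) (b * d) (- (a * d)) (- (b * c)) ⟩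
      (a * c + - (a * d)) + (b * d + - (b * c))
        ≈⟨ +-cong (+-congˡ (-‿distribʳ-* a d)) (CR.trans (+-comm _ _) (+-cong (-‿distribˡ-* b c) (CR.sym (neg*neg b d)))) ⟩
      (a * c + a * - d) + (- b * c + - b * - d)
        ≈⟨ +-cong (distribˡ a c (- d)) (distribˡ (- b) c (- d)) ⟨
      a * (c + - d) + - b * (c + - d)
        ≈⟨ distribʳ (c + - d) a (- b) ⟨
      (a + - b) * (c + - d) ∎

    reduce-correct : ∀ a b → ⟦ reduce (a , b) ⟧ᶜ ≈ ⟦ a , b ⟧ᶜ
    reduce-correct zero b = CR.refl
    reduce-correct (suc a) zero = CR.refl
    reduce-correct (suc a) (suc b) = begin
      ⟦ reduce (a , b) ⟧ᶜ                    ≈⟨ reduce-correct a b ⟩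
      a ⋆ 1# + - (b ⋆ 1#)                    ≈⟨ +-identityˡ _ ⟨
      0# + (a ⋆ 1# + - (b ⋆ 1#))             ≈⟨ +-congʳ (-‿inverseʳ 1#) ⟨
      (1# + - 1#) + (a ⋆ 1# + - (b ⋆ 1#))    ≈⟨ +-neg 1# 1# (a ⋆ 1#) (b ⋆ 1#) ⟨
      (1# + a ⋆ 1#) + - (1# + b ⋆ 1#)        ∎

  morphism : Difference -Raw-AlmostCommutative⟶ fromCommutativeRing R
  morphism = record
    { ⟦_⟧ = ⟦_⟧ᶜ
    ; +-homo = λ (a , b) (c , d) →
        CR.trans (reduce-correct (a ℕ.+ c) (b ℕ.+ d)) (CR.trans (+-cong (×-homo-+ 1# a c) (-‿cong (×-homo-+ 1# b d)))
                 (+-neg (a ⋆ 1#) (b ⋆ 1#) (c ⋆ 1#) (d ⋆ 1#)))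
    ; *-homo = λ (a , b) (c , d) →
        CR.trans (reduce-correct (a ℕ.* c ℕ.+ b ℕ.* d) _) (CR.trans (+-cong (*-sum a c b d) (-‿cong (*-sum a d b c)))
                 (*-neg (a ⋆ 1#) (b ⋆ 1#) (c ⋆ 1#) (d ⋆ 1#)))
    ; -‿homo = λ (a , b) → CR.sym (CR.trans (CR.sym (⁻¹-∙-comm (a ⋆ 1#) (- (b ⋆ 1#))))
        (CR.trans (+-congˡ (⁻¹-involutive (b ⋆ 1#))) (+-comm _ _)))
    ; 0-homo = -‿inverseʳ 0#
    ; 1-homo = CR.trans (+-congˡ -0#≈0#) (CR.trans (+-identityʳ _) (+-identityʳ 1#))
    }
    where
    *-sum : ∀ a c b d → (a ℕ.* c ℕ.+ b ℕ.* d) ⋆ 1# ≈ (a ⋆ 1#) * (c ⋆ 1#) + (b ⋆ 1#) * (d ⋆ 1#)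
    *-sum a c b d = CR.trans (×-homo-+ 1# (a ℕ.* c) (b ℕ.* d)) (+-cong (×1-homo-* a c) (×1-homo-* b d))

  difference≟ : (x y : ℕ × ℕ) → Maybe (⟦ x ⟧ᶜ ≈ ⟦ y ⟧ᶜ)
  difference≟ (a , b) (c , d) with a ℕ.+ d ℕ.≟ c ℕ.+ b
  ... | no _ = nothing
  ... | yes a+d≡c+b = just (begin
    A + - B              ≈⟨ CR.trans (+-congˡ (-‿inverseʳ D)) (+-identityʳ _) ⟨
    (A + - B) + (D + - D) ≈⟨ +-neg A B D D ⟨
    (A + D) + - (B + D)   ≈⟨ +-cong eq (-‿cong (+-comm B D)) ⟩
    (C + B) + - (D + B)   ≈⟨ +-neg C D B B ⟩
    (C + - D) + (B + - B) ≈⟨ CR.trans (+-congˡ (-‿inverseʳ B)) (+-identityʳ _) ⟩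
    C + - D               ∎)
    where
    A = a ⋆ 1#
    B = b ⋆ 1#
    C = c ⋆ 1#
    D = d ⋆ 1#
    eq : A + D ≈ C + B
    eq = CR.trans (CR.sym (×-homo-+ 1# a d))
        (CR.trans (×-congˡ a+d≡c+b) (×-homo-+ 1# c b))

  open Algebra.Solver.Ring Difference (fromCommutativeRing R) morphism difference≟ public
    using (solve; _:=_; _:+_; _:*_; :-_)

-- Counting coefficient vectors.

module VecCardinality where

  encode : ∀ {q k} → Vec (Fin q) k → Fin (q ^ k)
  encode [] = zero
  encode (a ∷ as) = combine a (encode as)

  encode-injective : ∀ {q k} → Injective _≡_ _≡_ (encode {q} {k})
  encode-injective {k = zero} {[]} {[]} _ = refl
  encode-injective {k = suc k} {a ∷ as} {b ∷ bs} eq with combine-injective a (encode as) b (encode bs) eq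
  ... | refl , eq′ = cong (a ∷_) (encode-injective eq′)

  decode : ∀ {q} k → Fin (q ^ k) → Vec (Fin q) k
  decode zero _ = []
  decode {q} (suc k) i = proj₁ (remQuot {q} (q ^ k) i) ∷ decode k (proj₂ (remQuot {q} (q ^ k) i))

  decode-injective : ∀ {q} k → Injective _≡_ _≡_ (decode {q} k)
  decode-injective zero {zero} {zero} _ = refl
  decode-injective {q} (suc k) {i} {j} eq with ∷-injective eq
  ... | eq₁ , eq₂ = trans (sym (combine-remQuot {q} (q ^ k) i))
    (trans (cong₂ combine eq₁ (decode-injective k eq₂)) (combine-remQuot {q} (q ^ k) j))

  -- `Maybe` adds one element to the q ^ k vectors. The twist argument produces such a surplus point
  -- in a slice.
  Maybe-Vec-not-injective : ∀ {q k} (f : Maybe (Vec (Fin q) k) → Vec (Fin q) k) → ¬ Injective _≡_ _≡_ f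
  Maybe-Vec-not-injective {q} {k} f inj = ℕ.<-irrefl refl (injective⇒≤ {f = g} g-injective)
    where
    index : Fin (suc (q ^ k)) → Maybe (Vec (Fin q) k)
    index zero = nothing
    index (suc i) = just (decode k i)
    index-injective : Injective _≡_ _≡_ index
    index-injective {zero} {zero} _ = refl
    index-injective {suc i} {suc j} eq = cong suc (decode-injective k (just-injective eq))
    g : Fin (suc (q ^ k)) → Fin (q ^ k)
    g = encode ∘ f ∘ index
    g-injective : Injective _≡_ _≡_ g
    g-injective = index-injective ∘ inj ∘ encode-injective

  -- Compares q ^ m with q ^ n. This count takes the place of a theory of dimension whenever there
  -- would be too many independent vectors.
  Vec-injective⇒≤ : ∀ {q m n} → 2 ≤ q → (f : Vec (Fin q) m → Vec (Fin q) n) → Injective _≡_ _≡_ f → m ≤ n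
  Vec-injective⇒≤ {q} {m} {n} 2≤q f inj = ℕ.≮⇒≥ λ n<m →
    ℕ.<-irrefl refl (ℕ.<-≤-trans (ℕ.^-monoʳ-< q 2≤q n<m)
      (injective⇒≤ {f = encode ∘ f ∘ decode m} (decode-injective m ∘ inj ∘ encode-injective)))

  anyVec? : ∀ {q} k {P : Vec (Fin q) k → Set} → (∀ as → Dec (P as)) → Dec (∃ P)
  anyVec? zero P? = map′ ([] ,_) (λ { ([] , p) → p }) (P? [])
  anyVec? (suc k) P? = map′ (λ (a , as , p) → a ∷ as , p) (λ { (a ∷ as , p) → a , as , p })
    (any? λ a → anyVec? k (λ as → P? (a ∷ as)))

  distinct⇒2≤ : ∀ {q} {i j : Fin q} → i ≢ j → 2 ≤ q
  distinct⇒2≤ {suc zero} {zero} {zero} i≢j = ⊥-elim (i≢j refl)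
  distinct⇒2≤ {suc (suc q)} i≢j = s≤s (s≤s z≤n)

open VecCardinality

-- Linear algebra and flats over a finite field.

module LinearAlgebra {q : ℕ} (F : FieldOn q) where
  open FieldOn F public

  ring : CommutativeRing 0ℓ 0ℓ
  ring = record { isCommutativeRing = isCommutativeRing }

  open CommutativeRing ring public
    using (+-assoc; +-comm; +-identityˡ; +-identityʳ; -‿inverseʳ; *-assoc; *-comm;
           *-identityˡ; *-identityʳ; distribˡ; distribʳ; zeroˡ; zeroʳ)
  open IntegerSolver ring public using (solve; _:=_; _:+_; _:*_; :-_)
  open Algebra.Properties.AbelianGroup (CommutativeRing.+-abelianGroup ring) public
    using () renaming (∙-cancelˡ to +-cancelˡ; ∙-cancelʳ to +-cancelʳ)

  infixl 6 _+ᵥ_ _-ᵥ_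
  infixl 7 _·ᵥ_

  V : ℕ → Set
  V = Pt F

  _+ᵥ_ : ∀ {n} → V n → V n → V n
  _+ᵥ_ = _⊕_ F

  _·ᵥ_ : ∀ {n} → Fin q → V n → V n
  _·ᵥ_ = _⊙_ F

  0ᵥ : ∀ {n} → V n
  0ᵥ {n} = 𝟎 F n

  _-ᵥ_ : ∀ {n} → V n → V n → V n
  _-ᵥ_ = zipWith λ a b → a + - b

  lc : ∀ {n k} → Vec (Fin q) k → Vec (V n) k → V n
  lc = lincomb F

  2≤q : 2 ≤ q
  2≤q = distinct⇒2≤ 0≢1

  *-cancel-0 : ∀ {a b} → a ≢ 0# → a * b ≡ 0# → b ≡ 0#
  *-cancel-0 {a} {b} a≢0 ab≡0 with inverse a a≢0
  ... | a⁻¹ , aa⁻¹≡1 = begin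
    b              ≡⟨ *-identityˡ b ⟨
    1# * b         ≡⟨ cong (_* b) aa⁻¹≡1 ⟨
    a * a⁻¹ * b    ≡⟨ solve 3 (λ a c b → a :* c :* b := c :* (a :* b)) refl a a⁻¹ b ⟩
    a⁻¹ * (a * b)  ≡⟨ cong (a⁻¹ *_) ab≡0 ⟩
    a⁻¹ * 0#       ≡⟨ zeroʳ a⁻¹ ⟩
    0#             ∎
    where open ≡-Reasoning

  +ᵥ-assoc : ∀ {n} (u v w : V n) → (u +ᵥ v) +ᵥ w ≡ u +ᵥ (v +ᵥ w)
  +ᵥ-assoc = Vec.zipWith-assoc +-assoc

  +ᵥ-comm : ∀ {n} (u v : V n) → u +ᵥ v ≡ v +ᵥ u
  +ᵥ-comm = Vec.zipWith-comm +-comm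

  +ᵥ-identityˡ : ∀ {n} (v : V n) → 0ᵥ +ᵥ v ≡ v
  +ᵥ-identityˡ = Vec.zipWith-identityˡ +-identityˡ

  +ᵥ-identityʳ : ∀ {n} (v : V n) → v +ᵥ 0ᵥ ≡ v
  +ᵥ-identityʳ = Vec.zipWith-identityʳ +-identityʳ

  ·ᵥ-zero : ∀ {n} (v : V n) → 0# ·ᵥ v ≡ 0ᵥ
  ·ᵥ-zero [] = refl
  ·ᵥ-zero (a ∷ v) = cong₂ _∷_ (zeroˡ a) (·ᵥ-zero v)

  ·ᵥ-0ᵥ : ∀ {n} s → s ·ᵥ 0ᵥ {n} ≡ 0ᵥ
  ·ᵥ-0ᵥ {zero} s = refl
  ·ᵥ-0ᵥ {suc n} s = cong₂ _∷_ (zeroʳ s) (·ᵥ-0ᵥ s)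

  ·ᵥ-one : ∀ {n} (v : V n) → 1# ·ᵥ v ≡ v
  ·ᵥ-one [] = refl
  ·ᵥ-one (a ∷ v) = cong₂ _∷_ (*-identityˡ a) (·ᵥ-one v)

  ·ᵥ-assoc : ∀ {n} s t (v : V n) → s ·ᵥ (t ·ᵥ v) ≡ (s * t) ·ᵥ v
  ·ᵥ-assoc s t [] = refl
  ·ᵥ-assoc s t (a ∷ v) = cong₂ _∷_ (sym (*-assoc s t a)) (·ᵥ-assoc s t v)

  -ᵥ-inverse : ∀ {n} (v : V n) → v -ᵥ v ≡ 0ᵥ
  -ᵥ-inverse [] = refl
  -ᵥ-inverse (a ∷ v) = cong₂ _∷_ (-‿inverseʳ a) (-ᵥ-inverse v)

  +-ᵥ-cancel : ∀ {n} (u v : V n) → u +ᵥ (v -ᵥ u) ≡ v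
  +-ᵥ-cancel [] [] = refl
  +-ᵥ-cancel (a ∷ u) (b ∷ v) = cong₂ _∷_
    (solve 2 (λ a b → a :+ (b :+ :- a) := b) refl a b) (+-ᵥ-cancel u v)

  +ᵥ-cancelʳ-ᵥ : ∀ {n} (u v : V n) → (u +ᵥ v) -ᵥ v ≡ u
  +ᵥ-cancelʳ-ᵥ [] [] = refl
  +ᵥ-cancelʳ-ᵥ (a ∷ u) (b ∷ v) = cong₂ _∷_
    (solve 2 (λ a b → (a :+ b) :+ :- b := a) refl a b) (+ᵥ-cancelʳ-ᵥ u v)

  -ᵥ+ᵥ-cancel : ∀ {n} (u v : V n) → (u -ᵥ v) +ᵥ v ≡ u
  -ᵥ+ᵥ-cancel u v = trans (+ᵥ-comm _ v) (+-ᵥ-cancel v u)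

  +ᵥ-cancelʳ : ∀ {n} (w : V n) {u v} → u +ᵥ w ≡ v +ᵥ w → u ≡ v
  +ᵥ-cancelʳ w {u} {v} eq = trans (sym (+ᵥ-cancelʳ-ᵥ u w)) (trans (cong (_-ᵥ w) eq) (+ᵥ-cancelʳ-ᵥ v w))

  +ᵥ-cancelˡ : ∀ {n} (w : V n) {u v} → w +ᵥ u ≡ w +ᵥ v → u ≡ v
  +ᵥ-cancelˡ w {u} {v} eq = +ᵥ-cancelʳ w (trans (+ᵥ-comm u w) (trans eq (+ᵥ-comm w v)))

  -ᵥ≡0⇒≡ : ∀ {n} (u v : V n) → u -ᵥ v ≡ 0ᵥ → u ≡ v
  -ᵥ≡0⇒≡ u v eq = trans (sym (-ᵥ+ᵥ-cancel u v)) (trans (cong (_+ᵥ v) eq) (+ᵥ-identityˡ v))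

  infix 4 _≟ᵥ_
  _≟ᵥ_ : ∀ {n} (u v : V n) → Dec (u ≡ v)
  _≟ᵥ_ = Vec.≡-dec _≟_

  lc-+ : ∀ {n k} (as bs : V k) (vs : Vec (V n) k) → lc (as +ᵥ bs) vs ≡ lc as vs +ᵥ lc bs vs
  lc-+ [] [] [] = sym (+ᵥ-identityˡ 0ᵥ)
  lc-+ (a ∷ as) (b ∷ bs) (v ∷ vs) = trans (cong ((a + b) ·ᵥ v +ᵥ_) (lc-+ as bs vs)) (rearrange a b v (lc as vs) (lc bs vs))
    where
    rearrange : ∀ {n} a b (v s t : V n) → (a + b) ·ᵥ v +ᵥ (s +ᵥ t) ≡ (a ·ᵥ v +ᵥ s) +ᵥ (b ·ᵥ v +ᵥ t)
    rearrange a b [] [] [] = refl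
    rearrange a b (v ∷ vs) (s ∷ ss) (t ∷ ts) = cong₂ _∷_
      (solve 5 (λ a b v s t → (a :+ b) :* v :+ (s :+ t) := (a :* v :+ s) :+ (b :* v :+ t)) refl a b v s t)
      (rearrange a b vs ss ts)

  lc-· : ∀ {n k} s (as : V k) (vs : Vec (V n) k) → lc (s ·ᵥ as) vs ≡ s ·ᵥ lc as vs
  lc-· s [] [] = sym (·ᵥ-0ᵥ s)
  lc-· s (a ∷ as) (v ∷ vs) = trans (cong ((s * a) ·ᵥ v +ᵥ_) (lc-· s as vs)) (rearrange s a v (lc as vs))
    where
    rearrange : ∀ {n} s a (v t : V n) → (s * a) ·ᵥ v +ᵥ s ·ᵥ t ≡ s ·ᵥ (a ·ᵥ v +ᵥ t)
    rearrange s a [] [] = refl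
    rearrange s a (v ∷ vs) (t ∷ ts) = cong₂ _∷_
      (solve 4 (λ s a v t → (s :* a) :* v :+ s :* t := s :* (a :* v :+ t)) refl s a v t) (rearrange s a vs ts)

  lc-- : ∀ {n k} (as bs : V k) (vs : Vec (V n) k) → lc (as -ᵥ bs) vs ≡ lc as vs -ᵥ lc bs vs
  lc-- [] [] [] = sym (-ᵥ-inverse 0ᵥ)
  lc-- (a ∷ as) (b ∷ bs) (v ∷ vs) = trans (cong ((a + - b) ·ᵥ v +ᵥ_) (lc-- as bs vs)) (rearrange a b v (lc as vs) (lc bs vs))
    where
    rearrange : ∀ {n} a b (v s t : V n) → (a + - b) ·ᵥ v +ᵥ (s -ᵥ t) ≡ (a ·ᵥ v +ᵥ s) -ᵥ (b ·ᵥ v +ᵥ t)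
    rearrange a b [] [] [] = refl
    rearrange a b (v ∷ vs) (s ∷ ss) (t ∷ ts) = cong₂ _∷_
      (solve 5 (λ a b v s t → (a :+ :- b) :* v :+ (s :+ :- t) := (a :* v :+ s) :+ :- (b :* v :+ t)) refl a b v s t)
      (rearrange a b vs ss ts)

  lc-0 : ∀ {n k} (vs : Vec (V n) k) → lc 0ᵥ vs ≡ 0ᵥ
  lc-0 [] = refl
  lc-0 (v ∷ vs) = trans (cong₂ _+ᵥ_ (·ᵥ-zero v) (lc-0 vs)) (+ᵥ-identityˡ 0ᵥ)

  Span : ∀ {n k} → Vec (V n) k → V n → Set
  Span {k = k} vs y = Σ (V k) λ as → y ≡ lc as vs

  Independent : ∀ {n k} → Vec (V n) k → Set
  Independent = LinIndep F

  lc-injective : ∀ {n k} {vs : Vec (V n) k} → Independent vs → Injective _≡_ _≡_ (λ as → lc as vs)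
  lc-injective {vs = vs} ind {as} {bs} eq = -ᵥ≡0⇒≡ as bs (ind (as -ᵥ bs)
    (trans (lc-- as bs vs) (trans (cong (_-ᵥ lc bs vs) eq) (-ᵥ-inverse (lc bs vs)))))

  Independent-tail : ∀ {n k} {v : V n} {vs : Vec (V n) k} → Independent (v ∷ vs) → Independent vs
  Independent-tail {v = v} {vs} ind as eq = proj₂ (∷-injective (ind (0# ∷ as)
    (trans (cong (_+ᵥ lc as vs) (·ᵥ-zero v)) (trans (+ᵥ-identityˡ _) eq))))

  Independent⇒∉Span : ∀ {n k} {v : V n} {vs : Vec (V n) k} → Independent (v ∷ vs) → ¬ Span vs v
  Independent⇒∉Span {v = v} {vs} ind (as , v≡) = 0≢1 (sym (proj₁ (∷-injective (ind′ eq))))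
    where
    ind′ : lc (1# ∷ 0ᵥ) (v ∷ vs) ≡ lc (0# ∷ as) (v ∷ vs) → 1# ∷ 0ᵥ ≡ 0# ∷ as
    ind′ = lc-injective {vs = v ∷ vs} ind
    eq : 1# ·ᵥ v +ᵥ lc 0ᵥ vs ≡ 0# ·ᵥ v +ᵥ lc as vs
    eq = begin
      1# ·ᵥ v +ᵥ lc 0ᵥ vs  ≡⟨ cong₂ _+ᵥ_ (·ᵥ-one v) (lc-0 vs) ⟩
      v +ᵥ 0ᵥ              ≡⟨ +ᵥ-comm v 0ᵥ ⟩
      0ᵥ +ᵥ v              ≡⟨ cong₂ _+ᵥ_ (sym (·ᵥ-zero v)) v≡ ⟩
      0# ·ᵥ v +ᵥ lc as vs  ∎
      where open ≡-Reasoning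

  -- A nonzero coefficient of `v` in a relation could be inverted, which would place `v` in the
  -- span.
  ∉Span⇒Independent : ∀ {n k} {v : V n} {vs : Vec (V n) k} → Independent vs → ¬ Span vs v → Independent (v ∷ vs)
  ∉Span⇒Independent {v = v} {vs} ind v∉ (a ∷ as) eq with a ≟ 0#
  ... | yes refl = cong (0# ∷_) (ind as (trans (sym (+ᵥ-identityˡ _)) (trans (cong (_+ᵥ lc as vs) (sym (·ᵥ-zero v))) eq)))
  ... | no a≢0 with inverse a a≢0
  ... | a⁻¹ , aa⁻¹≡1 = ⊥-elim (v∉ ((- a⁻¹) ·ᵥ as , sym (begin
    lc ((- a⁻¹) ·ᵥ as) vs                      ≡⟨ lc-· (- a⁻¹) as vs ⟩
    (- a⁻¹) ·ᵥ lc as vs                        ≡⟨ rearrange a a⁻¹ v (lc as vs) ⟩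
    (a * a⁻¹) ·ᵥ v +ᵥ (- a⁻¹) ·ᵥ (a ·ᵥ v +ᵥ lc as vs)
      ≡⟨ cong₂ _+ᵥ_ (cong (_·ᵥ v) aa⁻¹≡1) (cong ((- a⁻¹) ·ᵥ_) eq) ⟩
    1# ·ᵥ v +ᵥ (- a⁻¹) ·ᵥ 0ᵥ                   ≡⟨ cong₂ _+ᵥ_ (·ᵥ-one v) (·ᵥ-0ᵥ _) ⟩
    v +ᵥ 0ᵥ                                    ≡⟨ +ᵥ-identityʳ v ⟩
    v ∎)))
    where
    open ≡-Reasoning
    rearrange : ∀ {n} a b (v s : V n) → (- b) ·ᵥ s ≡ (a * b) ·ᵥ v +ᵥ (- b) ·ᵥ (a ·ᵥ v +ᵥ s)
    rearrange a b [] [] = refl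
    rearrange a b (v ∷ vs) (s ∷ ss) = cong₂ _∷_
      (solve 4 (λ a b v s → (:- b) :* s := (a :* b) :* v :+ (:- b) :* (a :* v :+ s)) refl a b v s) (rearrange a b vs ss)

  -- Gaussian elimination on the first coordinate.
  data HeadForm {n : ℕ} : {k : ℕ} → Vec (V (suc n)) k → Set where
    allZero : ∀ {k} {vs : Vec (V (suc n)) k} (us : Vec (V n) k) → Independent us →
      (∀ c y → Span vs (c ∷ y) ⇔ (c ≡ 0# × Span us y)) → HeadForm vs
    pivot : ∀ {k} {vs : Vec (V (suc n)) (suc k)} (w : V n) (us : Vec (V n) k) → Independent us →
      (∀ c y → Span vs (c ∷ y) ⇔ (Σ (V k) λ as → y ≡ c ·ᵥ w +ᵥ lc as us)) → HeadForm vs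

  -- A pivot of the later vectors is kept and the new vector is cleared against it; only if they
  -- have none can the new head become the pivot. In `pivot` the span contains 1 ∷ `w`, and `us`
  -- spans the tails of its members with head 0.
  headForm : ∀ {n k} (vs : Vec (V (suc n)) k) → Independent vs → HeadForm vs
  headForm [] ind = allZero [] (λ { [] _ → refl }) λ c y → mk⇔
    (λ { ([] , eq) → proj₁ (∷-injective eq) , [] , proj₂ (∷-injective eq) })
    (λ { (refl , [] , refl) → [] , refl })
  headForm ((h ∷ v) ∷ vs) ind with headForm vs (Independent-tail {v = h ∷ v} ind)
  ... | pivot {k} w us ind′ span = pivot w ((v -ᵥ h ·ᵥ w) ∷ us)
      (∉Span⇒Independent ind′ λ (as , eq) → Independent⇒∉Span ind
        (Equivalence.from (span h v) (as , trans (sym (+-ᵥ-cancel (h ·ᵥ w) v)) (cong (h ·ᵥ w +ᵥ_) eq))))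
      λ c y → mk⇔ (to c y) (from c y)
    where
    rearrange : ∀ {n} a h s (v w t : V n) → a ·ᵥ v +ᵥ (s ·ᵥ w +ᵥ t) ≡ (a * h + s) ·ᵥ w +ᵥ (a ·ᵥ (v -ᵥ h ·ᵥ w) +ᵥ t)
    rearrange a h s [] [] [] = refl
    rearrange a h s (v ∷ vs) (w ∷ ws) (t ∷ ts) = cong₂ _∷_
      (solve 6 (λ a h s v w t → a :* v :+ (s :* w :+ t) := (a :* h :+ s) :* w :+ (a :* (v :+ :- (h :* w)) :+ t))
        refl a h s v w t) (rearrange a h s vs ws ts)
    to : ∀ c y → Span ((h ∷ v) ∷ vs) (c ∷ y) → Σ (V (suc k)) λ as → y ≡ c ·ᵥ w +ᵥ lc as ((v -ᵥ h ·ᵥ w) ∷ us)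
    to c y (a ∷ as , eq) = go (lc as vs) refl eq
      where
      -- The combination is abstracted as `z`, so that it can be split into head and tail and
      -- compared coordinate by coordinate.
      go : ∀ z → z ≡ lc as vs → c ∷ y ≡ a ·ᵥ (h ∷ v) +ᵥ z → Σ (V (suc k)) λ as → y ≡ c ·ᵥ w +ᵥ lc as ((v -ᵥ h ·ᵥ w) ∷ us)
      go (s ∷ t) z≡ refl with Equivalence.to (span s t) (as , z≡)
      ... | bs , refl = a ∷ bs , rearrange a h s v w (lc bs us)
    from : ∀ c y → (Σ (V (suc k)) λ as → y ≡ c ·ᵥ w +ᵥ lc as ((v -ᵥ h ·ᵥ w) ∷ us)) → Span ((h ∷ v) ∷ vs) (c ∷ y)
    -- The new vector contributes a h to the head, so the others must supply c - a h.
    from c y (a ∷ bs , refl) with Equivalence.from (span (c + - (a * h)) _) (bs , refl)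
    ... | as , eq = a ∷ as , trans (cong₂ _∷_ c≡ (trans (cong (λ d → d ·ᵥ w +ᵥ (a ·ᵥ (v -ᵥ h ·ᵥ w) +ᵥ lc bs us)) c≡)
                                     (sym (rearrange a h (c + - (a * h)) v w (lc bs us)))))
                              (cong ((a ·ᵥ (h ∷ v)) +ᵥ_) eq)
      where
      c≡ : c ≡ a * h + (c + - (a * h))
      c≡ = solve 3 (λ c a h → c := a :* h :+ (c :+ :- (a :* h))) refl c a h
  ... | allZero us ind′ span with h ≟ 0#
  ... | yes refl = allZero (v ∷ us)
      (∉Span⇒Independent ind′ λ v∈ → Independent⇒∉Span ind (Equivalence.from (span 0# v) (refl , v∈)))
      λ c y → mk⇔ (to c y) (from c y)
    where
    to : ∀ c y → Span ((0# ∷ v) ∷ vs) (c ∷ y) → c ≡ 0# × Span (v ∷ us) y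
    to c y (a ∷ as , eq) = go (lc as vs) refl eq
      where
      go : ∀ z → z ≡ lc as vs → c ∷ y ≡ a ·ᵥ (0# ∷ v) +ᵥ z → c ≡ 0# × Span (v ∷ us) y
      go (s ∷ t) z≡ refl with Equivalence.to (span s t) (as , z≡)
      ... | refl , bs , refl = trans (+-identityʳ _) (zeroʳ a) , a ∷ bs , refl
    from : ∀ c y → c ≡ 0# × Span (v ∷ us) y → Span ((0# ∷ v) ∷ vs) (c ∷ y)
    from c y (refl , a ∷ bs , refl) with Equivalence.from (span 0# _) (refl , bs , refl)
    ... | as , eq = a ∷ as , trans (cong₂ _∷_ (sym (trans (+-identityʳ _) (zeroʳ a))) refl) (cong ((a ·ᵥ (0# ∷ v)) +ᵥ_) eq)
  ... | no h≢0 with inverse h h≢0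
  ... | h⁻¹ , hh⁻¹≡1 = pivot (h⁻¹ ·ᵥ v) us ind′ λ c y → mk⇔ (to c y) (from c y)
    where
    open ≡-Reasoning
    cancel : ∀ a → (a * h) * h⁻¹ ≡ a
    cancel a = trans (*-assoc a h h⁻¹) (trans (cong (a *_) hh⁻¹≡1) (*-identityʳ a))
    to : ∀ c y → Span ((h ∷ v) ∷ vs) (c ∷ y) → Σ _ λ bs → y ≡ c ·ᵥ (h⁻¹ ·ᵥ v) +ᵥ lc bs us
    to c y (a ∷ as , eq) = go (lc as vs) refl eq
      where
      go : ∀ z → z ≡ lc as vs → c ∷ y ≡ a ·ᵥ (h ∷ v) +ᵥ z → Σ _ λ bs → y ≡ c ·ᵥ (h⁻¹ ·ᵥ v) +ᵥ lc bs us
      go (s ∷ t) z≡ refl with Equivalence.to (span s t) (as , z≡)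
      ... | refl , bs , refl = bs , cong (_+ᵥ lc bs us) (sym (trans (·ᵥ-assoc _ h⁻¹ v)
        (cong (_·ᵥ v) (trans (cong (_* h⁻¹) (+-identityʳ (a * h))) (cancel a)))))
    from : ∀ c y → (Σ _ λ bs → y ≡ c ·ᵥ (h⁻¹ ·ᵥ v) +ᵥ lc bs us) → Span ((h ∷ v) ∷ vs) (c ∷ y)
    from c y (bs , refl) with Equivalence.from (span 0# _) (refl , bs , refl)
    ... | as , eq = c * h⁻¹ ∷ as , trans
      (cong₂ _∷_ (sym (trans (+-identityʳ _) (trans (solve 3 (λ c i h → c :* i :* h := c :* h :* i) refl c h⁻¹ h) (cancel c))))
                 (cong (_+ᵥ lc bs us) (·ᵥ-assoc c h⁻¹ v)))
      (cong ((c * h⁻¹) ·ᵥ (h ∷ v) +ᵥ_) eq)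

  -- If all heads were zero, n + 1 vectors would be independent in dimension n, which the count of
  -- coefficient vectors forbids.
  spans-all : ∀ {n} (vs : Vec (V n) n) → Independent vs → ∀ y → Span vs y
  spans-all [] ind [] = [] , refl
  spans-all {suc n} vs ind (c ∷ y) with headForm vs ind
  ... | allZero us ind′ _ = ⊥-elim (ℕ.<-irrefl refl
    (Vec-injective⇒≤ 2≤q (λ as → lc as us) (lc-injective {vs = us} ind′)))
  ... | pivot w us ind′ span with spans-all us ind′ (y -ᵥ c ·ᵥ w)
  ... | as , eq = Equivalence.from (span c y) (as , trans (sym (+-ᵥ-cancel (c ·ᵥ w) y)) (cong (c ·ᵥ w +ᵥ_) eq))

  Flat : ∀ {n} → ℕ → (V n → Set) → Set
  Flat = IsFlat F

  Flat-cong : ∀ {n k} {X Y : V n → Set} → (∀ y → X y ⇔ Y y) → Flat k X → Flat k Y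
  Flat-cong X⇔Y (x , vs , ind , iff) = x , vs , ind , λ y → mk⇔
    (λ Yy → Equivalence.to (iff y) (Equivalence.from (X⇔Y y) Yy))
    (λ p → Equivalence.to (X⇔Y y) (Equivalence.from (iff y) p))

  affineSpan-Flat : ∀ {n k} (x : V n) (vs : Vec (V n) k) → Independent vs → Flat k (λ y → Σ (V k) λ as → y ≡ x +ᵥ lc as vs)
  affineSpan-Flat x vs ind = x , vs , ind , λ y → mk⇔ (λ p → p) (λ p → p)

  -- `X` is an arbitrary predicate; being a flat makes it decidable, by a search through finitely
  -- many coefficient vectors. This is what allows case distinctions on membership.
  Flat-dec : ∀ {n k} {X : V n → Set} → Flat k X → ∀ y → Dec (X y)
  Flat-dec {k = k} (x , vs , ind , iff) y =
    map′ (Equivalence.from (iff y)) (Equivalence.to (iff y)) (anyVec? k λ as → y ≟ᵥ x +ᵥ lc as vs)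

  Flat-translate : ∀ {n k} {X : V n → Set} → Flat k X → ∀ {u v w} → X u → X v → X w → X (u +ᵥ (v -ᵥ w))
  Flat-translate (x , vs , ind , iff) {u} {v} {w} Xu Xv Xw
    with Equivalence.to (iff u) Xu | Equivalence.to (iff v) Xv | Equivalence.to (iff w) Xw
  ... | as , refl | bs , refl | cs , refl = Equivalence.from (iff _) (as +ᵥ (bs -ᵥ cs) , (begin
    (x +ᵥ lc as vs) +ᵥ ((x +ᵥ lc bs vs) -ᵥ (x +ᵥ lc cs vs)) ≡⟨ rearrange x (lc as vs) (lc bs vs) (lc cs vs) ⟩
    x +ᵥ (lc as vs +ᵥ (lc bs vs -ᵥ lc cs vs))  ≡⟨ cong (λ s → x +ᵥ (lc as vs +ᵥ s)) (lc-- bs cs vs) ⟨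
    x +ᵥ (lc as vs +ᵥ lc (bs -ᵥ cs) vs)        ≡⟨ cong (x +ᵥ_) (lc-+ as (bs -ᵥ cs) vs) ⟨
    x +ᵥ lc (as +ᵥ (bs -ᵥ cs)) vs              ∎))
    where
    open ≡-Reasoning
    rearrange : ∀ {n} (x a b c : V n) → (x +ᵥ a) +ᵥ ((x +ᵥ b) -ᵥ (x +ᵥ c)) ≡ x +ᵥ (a +ᵥ (b -ᵥ c))
    rearrange [] [] [] [] = refl
    rearrange (x ∷ xs) (a ∷ as) (b ∷ bs) (c ∷ cs) = cong₂ _∷_
      (solve 4 (λ x a b c → (x :+ a) :+ ((x :+ b) :+ :- (x :+ c)) := x :+ (a :+ (b :+ :- c)))
        refl x a b c) (rearrange xs as bs cs)

  -- The dichotomy behind both inductions. In `crossing` the curve t ↦ x + t w picks one point of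
  -- each slice, and all slices have the same direction `us`, of dimension one less.
  data Slices {n : ℕ} (X : V (suc n) → Set) : ℕ → Set where
    inSlice : ∀ {k} c (x : V n) (us : Vec (V n) k) → Independent us →
      (∀ t y → X (t ∷ y) ⇔ (t ≡ c × Σ (V k) λ as → y ≡ x +ᵥ lc as us)) → Slices X k
    crossing : ∀ {k} (x w : V n) (us : Vec (V n) k) → Independent us →
      (∀ t y → X (t ∷ y) ⇔ (Σ (V k) λ as → y ≡ (x +ᵥ t ·ᵥ w) +ᵥ lc as us)) → Slices X (suc k)

  slices : ∀ {n k} {X : V (suc n) → Set} → Flat k X → Slices X k
  slices {n} {X = X} (c ∷ x , vs , ind , iff) with headForm vs ind
  ... | allZero us ind′ span = inSlice c x us ind′ λ t y → mk⇔ (to t y) (from t y)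
    where
    to : ∀ t y → X (t ∷ y) → t ≡ c × Σ _ λ as → y ≡ x +ᵥ lc as us
    to t y Xty with Equivalence.to (iff (t ∷ y)) Xty
    ... | as , eq = go (lc as vs) refl eq
      where
      go : ∀ z → z ≡ lc as vs → t ∷ y ≡ (c ∷ x) +ᵥ z → t ≡ c × Σ _ λ as → y ≡ x +ᵥ lc as us
      go (s ∷ z) z≡ refl with Equivalence.to (span s z) (as , z≡)
      ... | refl , bs , refl = +-identityʳ c , bs , refl
    from : ∀ t y → t ≡ c × (Σ _ λ as → y ≡ x +ᵥ lc as us) → X (t ∷ y)
    from t y (refl , bs , refl) with Equivalence.from (span 0# (lc bs us)) (refl , bs , refl)
    ... | as , eq = Equivalence.from (iff _)
      (as , trans (cong₂ _∷_ (sym (+-identityʳ c)) refl) (cong ((c ∷ x) +ᵥ_) eq))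
  -- Moving the base point from height c to height 0 makes `t` itself the parameter.
  ... | pivot w us ind′ span = crossing (x -ᵥ c ·ᵥ w) w us ind′ λ t y → mk⇔ (to t y) (from t y)
    where
    rearrange : ∀ {n} c s (x w l : V n) → x +ᵥ (s ·ᵥ w +ᵥ l) ≡ ((x -ᵥ c ·ᵥ w) +ᵥ (c + s) ·ᵥ w) +ᵥ l
    rearrange c s [] [] [] = refl
    rearrange c s (x ∷ xs) (w ∷ ws) (l ∷ ls) = cong₂ _∷_
      (solve 5 (λ c s x w l → x :+ (s :* w :+ l) := ((x :+ :- (c :* w)) :+ (c :+ s) :* w) :+ l) refl c s x w l)
      (rearrange c s xs ws ls)
    to : ∀ t y → X (t ∷ y) → Σ _ λ as → y ≡ ((x -ᵥ c ·ᵥ w) +ᵥ t ·ᵥ w) +ᵥ lc as us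
    to t y Xty with Equivalence.to (iff (t ∷ y)) Xty
    ... | as , eq = go (lc as vs) refl eq
      where
      go : ∀ z → z ≡ lc as vs → t ∷ y ≡ (c ∷ x) +ᵥ z → Σ _ λ as → y ≡ ((x -ᵥ c ·ᵥ w) +ᵥ t ·ᵥ w) +ᵥ lc as us
      go (s ∷ z) z≡ refl with Equivalence.to (span s z) (as , z≡)
      ... | bs , refl = bs , rearrange c s x w (lc bs us)
    from : ∀ t y → (Σ _ λ as → y ≡ ((x -ᵥ c ·ᵥ w) +ᵥ t ·ᵥ w) +ᵥ lc as us) → X (t ∷ y)
    from t y (bs , refl) with Equivalence.from (span (t + - c) _) (bs , refl)
    ... | as , eq = Equivalence.from (iff _) (as , trans
      (cong₂ _∷_ t≡ (trans (cong (λ s → ((x -ᵥ c ·ᵥ w) +ᵥ s ·ᵥ w) +ᵥ lc bs us) t≡) (sym (rearrange c (t + - c) x w (lc bs us)))))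
      (cong ((c ∷ x) +ᵥ_) eq))
      where
      t≡ : t ≡ c + (t + - c)
      t≡ = solve 2 (λ t c → t := c :+ (t :+ :- c)) refl t c

-- The twist, and why it repairs no broken flat.

module Twist {q : ℕ} (F : FieldOn q) where
  open LinearAlgebra F public

  times : ℕ → Fin q
  times zero = 0#
  times (suc i) = times i + 1#

  times-+ : ∀ i j → times (i ℕ.+ j) ≡ times i + times j
  times-+ zero j = sym (+-identityˡ _)
  times-+ (suc i) j = trans (cong (_+ 1#) (times-+ i j))
    (solve 3 (λ a b c → (a :+ b) :+ c := (a :+ c) :+ b) refl (times i) (times j) 1#)

  -- Pigeonhole on the q + 1 multiples 0, ..., q of 1. The difference of two coinciding indices is
  -- positive, hence the form `suc d`.
  characteristic : ∃ λ d → times (suc d) ≡ 0#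
  characteristic with pigeonhole (ℕ.n<1+n q) (times ∘ toℕ)
  ... | i , j , i<j , eq with ℕ.m≤n⇒∃[o]m+o≡n i<j
  ... | d , 1+i+d≡j = d , sym (+-cancelˡ (times (toℕ i)) _ _ (begin
    times (toℕ i) + 0#              ≡⟨ +-identityʳ _ ⟩
    times (toℕ i)                   ≡⟨ eq ⟩
    times (toℕ j)                   ≡⟨ cong times (trans (sym 1+i+d≡j) (sym (ℕ.+-suc (toℕ i) d))) ⟩
    times (toℕ i ℕ.+ suc d)         ≡⟨ times-+ (toℕ i) (suc d) ⟩
    times (toℕ i) + times (suc d)   ∎))
    where open ≡-Reasoning

  -- Adding 1 has finite order, so from c + 1 another d steps lead back to c.
  +1-closed⇒-1-closed : (P : Fin q → Set) → (∀ c → P c → P (c + 1#)) → ∀ c → P (c + 1#) → P c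
  +1-closed⇒-1-closed P closed c Pc+1 with characteristic
  ... | d , eq = subst P c+1+d≡c (iterated d)
    where
    iterated : ∀ i → P ((c + 1#) + times i)
    iterated zero = subst P (sym (+-identityʳ _)) Pc+1
    iterated (suc i) = subst P (+-assoc (c + 1#) (times i) 1#) (closed _ (iterated i))
    c+1+d≡c : (c + 1#) + times d ≡ c
    c+1+d≡c = trans (solve 3 (λ c o t → (c :+ o) :+ t := c :+ (t :+ o)) refl c 1# (times d))
      (trans (cong (c +_) eq) (+-identityʳ c))

  Perm : ∀ {n} → (V n → V n) → Set
  Perm = IsPerm F

  Perm-inverse : ∀ {n} {f : V n → V n} (g : V n → V n) → (∀ x → g (f x) ≡ x) → (∀ y → f (g y) ≡ y) → Perm f
  Perm-inverse {f = f} g gf fg =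
    (λ {x} {y} eq → trans (sym (gf x)) (trans (cong g eq) (gf y))) ,
    λ y → g y , λ eq → trans (cong f eq) (fg y)

  Perm-∘ : ∀ {n} {f g : V n → V n} → Perm f → Perm g → Perm (g ∘ f)
  Perm-∘ = Composition.bijective _≡_ _≡_ _≡_

  isZero : ∀ {n} → V n → Fin q
  isZero y with y ≟ᵥ 0ᵥ
  ... | yes _ = 1#
  ... | no _ = 0#

  isZero-0 : ∀ {n} {y : V n} → y ≡ 0ᵥ → isZero y ≡ 1#
  isZero-0 {y = y} y≡0 with y ≟ᵥ 0ᵥ
  ... | yes _ = refl
  ... | no y≢0 = ⊥-elim (y≢0 y≡0)

  isZero-≢0 : ∀ {n} {y : V n} → y ≢ 0ᵥ → isZero y ≡ 0#
  isZero-≢0 {y = y} y≢0 with y ≟ᵥ 0ᵥ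
  ... | yes y≡0 = ⊥-elim (y≢0 y≡0)
  ... | no _ = refl

  -- On the axis y = 0 this is the shift t ↦ t + 1, elsewhere the identity: every slice loses one
  -- point and receives one.
  twist : ∀ {n} → V (suc n) → V (suc n)
  twist (t ∷ y) = t + isZero y ∷ y

  twist-perm : ∀ {n} → Perm (twist {n})
  twist-perm = Perm-inverse (λ { (t ∷ y) → t + - isZero y ∷ y })
    (λ { (t ∷ y) → cong (_∷ y) (solve 2 (λ t z → (t :+ z) :+ :- z := t) refl t (isZero y)) })
    (λ { (t ∷ y) → cong (_∷ y) (solve 2 (λ t z → (t :+ :- z) :+ z := t) refl t (isZero y)) })

  slicewise : ∀ {n} → (Fin q → V n → V n) → V (suc n) → V (suc n)
  slicewise φ (t ∷ x) = t ∷ φ t x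

  slicewise-perm : ∀ {n} {φ : Fin q → V n → V n} → (∀ t → Perm (φ t)) → Perm (slicewise φ)
  slicewise-perm {φ = φ} perm = inj , λ { (t ∷ y) → t ∷ proj₁ (proj₂ (perm t) y) ,
      λ { refl → cong (t ∷_) (proj₂ (proj₂ (perm t) y) refl) } }
    where
    inj : Injective _≡_ _≡_ (slicewise φ)
    inj {t ∷ x} {s ∷ y} eq with ∷-injective eq
    ... | refl , eq′ = cong (t ∷_) (proj₁ (perm t) eq′)

  Im : ∀ {n} → (V n → V n) → (V n → Set) → V n → Set
  Im = Image F

  -- The counting arguments need flats with at least three points, which excludes single points and
  -- the two-point lines over F_2.
  data Roomy : ℕ → Set where
    q≥3 : ∀ {k} {θ : Fin q} → θ ≢ 0# → θ ≢ 1# → Roomy (suc k)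
    k≥2 : ∀ {k} → Roomy (suc (suc k))

  1≢0 : 1# ≢ 0#
  1≢0 1≡0 = 0≢1 (sym 1≡0)

  threeVectors : ∀ {k} → Roomy k → Σ (V k) λ as → Σ (V k) λ bs → Σ (V k) λ cs → as ≢ bs × as ≢ cs × bs ≢ cs
  threeVectors (q≥3 {θ = θ} θ≢0 θ≢1) = 0# ∷ 0ᵥ , 1# ∷ 0ᵥ , θ ∷ 0ᵥ ,
    0≢1 ∘ ∷-injectiveˡ , θ≢0 ∘ sym ∘ ∷-injectiveˡ , θ≢1 ∘ sym ∘ ∷-injectiveˡ
  threeVectors k≥2 = 0# ∷ 0# ∷ 0ᵥ , 0# ∷ 1# ∷ 0ᵥ , 1# ∷ 0# ∷ 0ᵥ ,
    0≢1 ∘ ∷-injectiveˡ ∘ ∷-injectiveʳ , 0≢1 ∘ ∷-injectiveˡ , 0≢1 ∘ ∷-injectiveˡ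

  twoAvoiding : ∀ {k} → Roomy k → (as : V k) → Σ (V k) λ bs → Σ (V k) λ cs → as ≢ bs × as ≢ cs × bs ≢ cs
  twoAvoiding roomy as with threeVectors roomy
  ... | u , v , w , u≢v , u≢w , v≢w with as ≟ᵥ u
  ... | yes refl = v , w , u≢v , u≢w , v≢w
  ... | no as≢u with as ≟ᵥ v
  ... | yes refl = u , w , as≢u , v≢w , u≢w
  ... | no as≢v = u , v , as≢u , as≢v , u≢v

  module _ {n : ℕ} (φ : Fin q → V n → V n) (perm : ∀ t → Perm (φ t)) where

    φ-injective : ∀ t → Injective _≡_ _≡_ (φ t)
    φ-injective t = proj₁ (perm t)

    twisted : V (suc n) → V (suc n)
    twisted = twist ∘ slicewise φ

    twisted-perm : Perm twisted
    twisted-perm = Perm-∘ (slicewise-perm perm) twist-perm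

    private
      -- The only point of slice t that `twisted` lifts to slice t + 1.
      root : Fin q → V n
      root t = proj₁ (proj₂ (perm t) 0ᵥ)

      φ-root : ∀ t → φ t (root t) ≡ 0ᵥ
      φ-root t = proj₂ (proj₂ (perm t) 0ᵥ) refl

      root-unique : ∀ {t x} → φ t x ≡ 0ᵥ → x ≡ root t
      root-unique {t} eq = φ-injective t (trans eq (sym (φ-root t)))

      twisted-root : ∀ {t x} → φ t x ≡ 0ᵥ → twisted (t ∷ x) ≡ t + 1# ∷ 0ᵥ
      twisted-root eq = cong₂ _∷_ (cong (_ +_) (isZero-0 eq)) eq

      twisted-nonroot : ∀ {t x} → φ t x ≢ 0ᵥ → twisted (t ∷ x) ≡ t ∷ φ t x
      twisted-nonroot ≢0 = cong₂ _∷_ (trans (cong (_ +_) (isZero-≢0 ≢0)) (+-identityʳ _)) refl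

      +1≢ : ∀ {c} → c + 1# ≢ c
      +1≢ {c} eq = 0≢1 (sym (+-cancelˡ c 1# 0# (trans eq (sym (+-identityʳ c)))))

      -- The twist only shifts points along the axis y = 0. If the heights whose root lies in X are
      -- closed under both shifts, the part of the image on the axis is mapped onto itself.
      Im-twisted⇔ : ∀ {X : V (suc n) → Set} →
        (∀ c → X (c ∷ root c) → X ((c + 1#) ∷ root (c + 1#))) →
        (∀ c → X ((c + 1#) ∷ root (c + 1#)) → X (c ∷ root c)) →
        ∀ y → Im twisted X y ⇔ Im (slicewise φ) X y
      Im-twisted⇔ {X} up down y = mk⇔ to from
        where
        to : Im twisted X y → Im (slicewise φ) X y
        to (t ∷ x , Xtx , refl) with φ t x ≟ᵥ 0ᵥ
        ... | no ≢0 = t ∷ x , Xtx , cong (_∷ φ t x) (sym (+-identityʳ t))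
        ... | yes ≡0 = t + 1# ∷ root (t + 1#) , up t (subst (λ z → X (t ∷ z)) (root-unique ≡0) Xtx) ,
          cong₂ _∷_ refl (trans (φ-root (t + 1#)) (sym ≡0))
        from : Im (slicewise φ) X y → Im twisted X y
        from (t ∷ x , Xtx , refl) with φ t x ≟ᵥ 0ᵥ
        ... | no ≢0 = t ∷ x , Xtx , twisted-nonroot ≢0
        ... | yes ≡0 = s ∷ root s , down s (subst (λ t → X (t ∷ root t)) t≡s+1 (subst (λ z → X (t ∷ z)) (root-unique ≡0) Xtx)) ,
          trans (twisted-root (φ-root s)) (cong₂ _∷_ (sym t≡s+1) (sym ≡0))
          where
          s = t + - 1#
          t≡s+1 : t ≡ s + 1#
          t≡s+1 = solve 2 (λ t o → t := (t :+ :- o) :+ o) refl t 1#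

    -- If X lies in the slice t = c and meets the root, then its image meets the
    -- slice c + 1 in exactly one point, although it contains two points of slice c.
    root∉inSlice : ∀ {k c x} {us : Vec (V n) k} {X : V (suc n) → Set} → Roomy k → Independent us →
      (∀ t y → X (t ∷ y) ⇔ (t ≡ c × Σ (V k) λ as → y ≡ x +ᵥ lc as us)) →
      Flat k (Im twisted X) → ∀ {y} → X (c ∷ y) → φ c y ≢ 0ᵥ
    root∉inSlice {k} {c} {x} {us} {X} roomy ind iff flat {y} Xcy φy≡0
      with Equivalence.to (iff c y) Xcy
    ... | _ , as , refl with twoAvoiding roomy as
    ... | bs , cs , as≢bs , as≢cs , bs≢cs = bs≢cs (pt-injective (φ-injective c r₁≡r₂))
      where
      pt : V k → V n
      pt ds = x +ᵥ lc ds us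
      pt-injective : Injective _≡_ _≡_ pt
      pt-injective eq = lc-injective {vs = us} ind (+ᵥ-cancelˡ x eq)
      X-pt : ∀ ds → X (c ∷ pt ds)
      X-pt ds = Equivalence.from (iff c _) (refl , ds , refl)
      nonroot : ∀ ds → as ≢ ds → φ c (pt ds) ≢ 0ᵥ
      nonroot ds as≢ds eq = as≢ds (pt-injective (φ-injective c (trans φy≡0 (sym eq))))
      r₁ = φ c (pt bs)
      r₂ = φ c (pt cs)
      in₁ : Im twisted X (c ∷ r₁)
      in₁ = c ∷ pt bs , X-pt bs , twisted-nonroot (nonroot bs as≢bs)
      in₂ : Im twisted X (c ∷ r₂)
      in₂ = c ∷ pt cs , X-pt cs , twisted-nonroot (nonroot cs as≢cs)
      in₀ : Im twisted X (c + 1# ∷ 0ᵥ)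
      in₀ = c ∷ pt as , X-pt as , twisted-root φy≡0
      only : ∀ z → Im twisted X z → head z ≡ c + 1# → tail z ≡ 0ᵥ
      only _ (t ∷ y′ , Xty , refl) eq with φ t y′ ≟ᵥ 0ᵥ
      ... | yes ≡0 = ≡0
      ... | no _ with Equivalence.to (iff t y′) Xty
      ... | refl , _ = ⊥-elim (+1≢ (sym (trans (sym (+-identityʳ t)) eq)))
      r₁≡r₂ : r₁ ≡ r₂
      -- The affine combination `in₀` + `in₁` - `in₂` has head c + 1, so it is the single image
      -- point there; its tail is r₁ - r₂, which is therefore 0.
      r₁≡r₂ = -ᵥ≡0⇒≡ r₁ r₂ (trans (sym (+ᵥ-identityˡ _))
        (only _ (Flat-translate flat in₀ in₁ in₂) (solve 2 (λ c o → (c :+ o) :+ (c :+ :- c) := c :+ o) refl c 1#)))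

    Slanted : ∀ {k} → (V (suc n) → Set) → V n → V n → Vec (V n) k → Set
    Slanted {k} X x w us = ∀ t y → X (t ∷ y) ⇔ (Σ (V k) λ as → y ≡ (x +ᵥ t ·ᵥ w) +ᵥ lc as us)

    private
      module Crossing {k : ℕ} {X : V (suc n) → Set} (roomy : Roomy (suc k)) (flatX : Flat (suc k) X) (x w : V n)
        (us : Vec (V n) k) (ind : Independent us) (iff : Slanted X x w us) (flat : Flat (suc k) (Im twisted X)) where

        pt : Fin q → V k → V n
        pt t as = (x +ᵥ t ·ᵥ w) +ᵥ lc as us
        X-pt : ∀ t as → X (t ∷ pt t as)
        X-pt t as = Equivalence.from (iff t _) (as , refl)
        pt-injective : ∀ t → Injective _≡_ _≡_ (pt t)
        pt-injective t eq = lc-injective {vs = us} ind (+ᵥ-cancelˡ _ eq)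

        -- A point at height e - θ ends at height e - θ or e - θ + 1, and neither is e. In the case
        -- `k≥2` slice e + 1 contains two points of X, of which the twist moves at most one.
        leaves : Roomy (suc k) → ∀ e → ∃ λ z → Im twisted X z × head z ≢ e
        leaves (q≥3 {θ = θ} θ≢0 θ≢1) e = _ , (t ∷ pt t 0ᵥ , X-pt t 0ᵥ , refl) , head≢
          where
          t = e + - θ
          head≢ : head (twisted (t ∷ pt t 0ᵥ)) ≢ e
          head≢ eq with φ t (pt t 0ᵥ) ≟ᵥ 0ᵥ
          ... | yes _ = θ≢1 (begin
            θ                       ≡⟨ solve 3 (λ e θ o → θ := e :+ :- ((e :+ :- θ) :+ o) :+ o) refl e θ 1# ⟩
            e + - (t + 1#) + 1#     ≡⟨ cong (λ s → e + - s + 1#) eq ⟩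
            e + - e + 1#            ≡⟨ cong (_+ 1#) (-‿inverseʳ e) ⟩
            0# + 1#                 ≡⟨ +-identityˡ 1# ⟩
            1#                      ∎)
            where open ≡-Reasoning
          ... | no _ = θ≢0 (begin
            θ                       ≡⟨ solve 3 (λ e θ o → θ := e :+ :- ((e :+ :- θ) :+ o) :+ o) refl e θ 0# ⟩
            e + - (t + 0#) + 0#     ≡⟨ cong (λ s → e + - s + 0#) eq ⟩
            e + - e + 0#            ≡⟨ cong (_+ 0#) (-‿inverseʳ e) ⟩
            0# + 0#                 ≡⟨ +-identityˡ 0# ⟩
            0#                      ∎)
            where open ≡-Reasoning
        leaves k≥2 e with φ t (pt t (0# ∷ 0ᵥ)) ≟ᵥ 0ᵥ
          where t = e + 1#
        ... | no ≢0 = _ , (e + 1# ∷ pt (e + 1#) (0# ∷ 0ᵥ) , X-pt _ (0# ∷ 0ᵥ) , twisted-nonroot ≢0) , +1≢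
        ... | yes ≡0 = _ , (e + 1# ∷ pt (e + 1#) (1# ∷ 0ᵥ) , X-pt _ (1# ∷ 0ᵥ) , twisted-nonroot ≢0) , +1≢
          where
          ≢0 : φ (e + 1#) (pt (e + 1#) (1# ∷ 0ᵥ)) ≢ 0ᵥ
          ≢0 eq = 0≢1 (∷-injectiveˡ (pt-injective _ (φ-injective _ (trans ≡0 (sym eq)))))

        -- Otherwise slice c + 1 of the image would have q ^ k + 1 points.
        up : ∀ c → X (c ∷ root c) → X ((c + 1#) ∷ root (c + 1#))
        up c Xc with Flat-dec flatX ((c + 1#) ∷ root (c + 1#))
        ... | yes Xc+1 = Xc+1
        ... | no ∉X with slices flat
        ... | inSlice e y vs ind′ iff′ with leaves roomy e
        ... | (s ∷ z) , in′ , s≢e = ⊥-elim (s≢e (proj₁ (Equivalence.to (iff′ s z) in′)))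
        up c Xc | no ∉X | crossing y v vs ind′ iff′ = ⊥-elim (Maybe-Vec-not-injective coord coord-injective)
          where
          -- `nothing` stands for the point that the twist brings in from slice c. No point leaves
          -- slice c + 1, because its root is not in X.
          pts : Maybe (V k) → V n
          pts nothing = 0ᵥ
          pts (just as) = φ (c + 1#) (pt (c + 1#) as)
          nonroot : ∀ as → φ (c + 1#) (pt (c + 1#) as) ≢ 0ᵥ
          nonroot as eq = ∉X (subst (λ z → X ((c + 1#) ∷ z)) (root-unique eq) (X-pt (c + 1#) as))
          pts-in : ∀ m → Im twisted X (c + 1# ∷ pts m)
          pts-in nothing = c ∷ root c , Xc , twisted-root (φ-root c)
          pts-in (just as) = c + 1# ∷ pt (c + 1#) as , X-pt _ as , twisted-nonroot (nonroot as)
          pts-injective : Injective _≡_ _≡_ pts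
          pts-injective {nothing} {nothing} eq = refl
          pts-injective {nothing} {just as} eq = ⊥-elim (nonroot as (sym eq))
          pts-injective {just as} {nothing} eq = ⊥-elim (nonroot as eq)
          pts-injective {just as} {just bs} eq = cong just (pt-injective _ (φ-injective _ eq))
          coord : Maybe (V k) → V k
          coord m = proj₁ (Equivalence.to (iff′ _ _) (pts-in m))
          coord-injective : Injective _≡_ _≡_ coord
          coord-injective {m} {m′} eq = pts-injective (trans (proj₂ (Equivalence.to (iff′ _ _) (pts-in m)))
            (trans (cong (λ as → (y +ᵥ (c + 1#) ·ᵥ v) +ᵥ lc as vs) eq)
                   (sym (proj₂ (Equivalence.to (iff′ _ _) (pts-in m′))))))

        untwist-crossing : Flat (suc k) (Im (slicewise φ) X)
        untwist-crossing = Flat-cong (Im-twisted⇔ up (+1-closed⇒-1-closed (λ c → X (c ∷ root c)) up)) flat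

    -- The interface of the twist. The first conclusion hands the flat over to the maps φ; the
    -- second keeps flats inside one slice away from the root, so in particular X is not a whole
    -- slice.
    untwist : ∀ {k X} → Roomy k → Flat k X → Flat k (Im twisted X) →
      Flat k (Im (slicewise φ) X) × (∀ {c} → (∀ {t y} → X (t ∷ y) → t ≡ c) → ∀ {x} → X (c ∷ x) → φ c x ≢ 0ᵥ)
    untwist {X = X} roomy flatX flat with slices flatX
    ... | crossing x w us ind iff = Crossing.untwist-crossing roomy flatX x w us ind iff flat ,
      λ inside → ⊥-elim (0≢1 (trans (inside (X-pt 0#)) (sym (inside (X-pt 1#)))))
      where
      X-pt : ∀ t → X (t ∷ ((x +ᵥ t ·ᵥ w) +ᵥ lc 0ᵥ us))
      X-pt t = Equivalence.from (iff t _) (0ᵥ , refl)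
    ... | inSlice c x us ind iff = Flat-cong (Im-twisted⇔ (λ c → ⊥-elim ∘ ∉X) (λ c → ⊥-elim ∘ ∉X)) flat ,
      λ {c′} inside {y} Xcy → subst (λ t → X (t ∷ y) → φ t y ≢ 0ᵥ) (sym (proj₁ (Equivalence.to (iff c′ y) Xcy))) (root∉inSlice roomy ind iff flat) Xcy
      where
      ∉X : ∀ {t} → ¬ X (t ∷ root t)
      ∉X {t} Xt with Equivalence.to (iff t (root t)) Xt
      ... | refl , _ = root∉inSlice roomy ind iff flat Xt (φ-root t)

-- Flats under maps that preserve the slices.

module SlicewiseImage {q : ℕ} (F : FieldOn q) where
  open Twist F public

  module _ {n : ℕ} {φ : Fin q → V n → V n} {X : V (suc n) → Set} where

    Im-slicewise : ∀ t z → Im (slicewise φ) X (t ∷ z) ⇔ Im (φ t) (λ y → X (t ∷ y)) z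
    Im-slicewise t z = mk⇔ (λ { (_ ∷ x , Xtx , refl) → x , Xtx , refl }) (λ { (x , Xtx , refl) → t ∷ x , Xtx , refl })

    inSlice-image : ∀ {k c} {x : V n} {us : Vec (V n) k} →
      (∀ t y → X (t ∷ y) ⇔ (t ≡ c × Σ (V k) λ as → y ≡ x +ᵥ lc as us)) →
      Flat k (Im (slicewise φ) X) → Flat k (Im (φ c) (λ y → X (c ∷ y)))
    inSlice-image {k} {c} {x} {us} iff flat with slices flat
    ... | inSlice e y vs ind iff′ = Flat-cong (λ z → mk⇔
        (λ p → Equivalence.to (Im-slicewise c z) (Equivalence.from (iff′ c z) (c≡e , p)))
        (λ p → proj₂ (Equivalence.to (iff′ c z) (Equivalence.from (Im-slicewise c z) p))))
        (affineSpan-Flat y vs ind)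
      where
      c≡e : c ≡ e
      c≡e = proj₁ (Equivalence.to (iff′ c _) (_ , Equivalence.from (iff c (x +ᵥ lc 0ᵥ us)) (refl , 0ᵥ , refl) , refl))
    ... | crossing y w vs ind iff′ = ⊥-elim (0≢1 (trans (only 0#) (sym (only 1#))))
      where
      only : ∀ t → t ≡ c
      only t with Equivalence.from (iff′ t _) (0ᵥ , refl)
      ... | s ∷ x′ , Xsx , eq = trans (sym (∷-injectiveˡ eq)) (proj₁ (Equivalence.to (iff s x′) Xsx))

    -- Heights are preserved, so the image has points at heights 0 and 1 and is again of the
    -- crossing type; its slices are then parallel flats of dimension k.
    crossing-image : ∀ {k} {x w : V n} {us : Vec (V n) k} →
      (∀ t y → X (t ∷ y) ⇔ (Σ (V k) λ as → y ≡ (x +ᵥ t ·ᵥ w) +ᵥ lc as us)) →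
      Flat (suc k) (Im (slicewise φ) X) →
      Σ (V n) λ y → Σ (V n) λ v → Σ (Vec (V n) k) λ vs → Independent vs ×
        (∀ t z → Im (φ t) (λ y → X (t ∷ y)) z ⇔ (Σ (V k) λ as → z ≡ (y +ᵥ t ·ᵥ v) +ᵥ lc as vs))
    crossing-image {k} {x} {w} {us} iff flat with slices flat
    ... | crossing y v vs ind iff′ = y , v , vs , ind , λ t z → mk⇔
        (λ p → Equivalence.to (iff′ t z) (Equivalence.from (Im-slicewise t z) p))
        (λ p → Equivalence.to (Im-slicewise t z) (Equivalence.from (iff′ t z) p))
    ... | inSlice e y vs ind iff′ = ⊥-elim (0≢1 (trans (only 0#) (sym (only 1#))))
      where
      only : ∀ t → t ≡ e
      only t = proj₁ (Equivalence.to (iff′ t _) (_ , Equivalence.from (iff t ((x +ᵥ t ·ᵥ w) +ᵥ lc 0ᵥ us)) (0ᵥ , refl) , refl))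

  Flat-untranslate : ∀ {n k} {f : V n → V n} {X : V n → Set} w → Flat k (Im (λ x → f x +ᵥ w) X) → Flat k (Im f X)
  Flat-untranslate {n} {k} {f} {X} w (x , vs , ind , iff) = Flat-cong (λ y → mk⇔ (to y) (from y)) (affineSpan-Flat (x -ᵥ w) vs ind)
    where
    rearrange : ∀ {n} (x w l : V n) → (x -ᵥ w) +ᵥ l ≡ (x +ᵥ l) -ᵥ w
    rearrange [] [] [] = refl
    rearrange (x ∷ xs) (w ∷ ws) (l ∷ ls) = cong₂ _∷_
      (solve 3 (λ x w l → (x :+ :- w) :+ l := (x :+ l) :+ :- w) refl x w l) (rearrange xs ws ls)
    to : ∀ y → (Σ (V k) λ as → y ≡ (x -ᵥ w) +ᵥ lc as vs) → Im f X y
    to y (as , refl) with Equivalence.from (iff (x +ᵥ lc as vs)) (as , refl)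
    ... | z , Xz , eq = z , Xz , trans (sym (+ᵥ-cancelʳ-ᵥ (f z) w)) (trans (cong (_-ᵥ w) eq) (sym (rearrange x w (lc as vs))))
    from : ∀ y → Im f X y → Σ (V k) λ as → y ≡ (x -ᵥ w) +ᵥ lc as vs
    from y (z , Xz , refl) with Equivalence.to (iff (f z +ᵥ w)) (z , Xz , refl)
    ... | as , eq = as , trans (sym (+ᵥ-cancelʳ-ᵥ (f z) w)) (trans (cong (_-ᵥ w) eq) (sym (rearrange x w (lc as vs))))

-- The induction on n for q ≥ 3.

module AtLeastThree {q : ℕ} (F : FieldOn q) (3≤q : 3 ≤ q) where
  open SlicewiseImage F

  -- α is the size of the spike at c = 0 that enters the next `Bent` condition. The conditions on it
  -- match the possible zeros of y + c z: `α≢0` settles none or all, `1+α≢0` a single zero at c = 0,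
  -- `nonvanishing` a single zero elsewhere. Besides 1, θ is a second nonzero argument for
  -- interpolation.
  record Scalars : Set where
    field
      α θ    : Fin q
      α≢0    : α ≢ 0#
      1+α≢0  : 1# + α ≢ 0#
      θ≢0    : θ ≢ 0#
      θ≢1    : θ ≢ 1#
      -- At θ c₀ the affine function with value α at 0 and 1 at c₀ does not vanish.
      nonvanishing : α + θ * (1# + - α) ≢ 0#

  -- If every nonzero element were 1, testing for 0 would inject `Fin q` into `Fin 2`.
  thirdElement : ∃ λ θ → θ ≢ 0# × θ ≢ 1#
  thirdElement with any? (λ θ → ¬? (θ ≟ 0#) ×-dec ¬? (θ ≟ 1#))
  ... | yes θ = θ
  ... | no none = ⊥-elim (ℕ.<⇒≱ 3≤q (injective⇒≤ {f = f} f-injective))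
    where
    f : Fin q → Fin 2
    f i with i ≟ 0#
    ... | yes _ = zero
    ... | no _ = suc zero
    f-injective : Injective _≡_ _≡_ f
    f-injective {i} {j} eq with i ≟ 0# | j ≟ 0#
    ... | yes refl | yes refl = refl
    ... | no i≢0 | no j≢0 = trans (is1 i i≢0) (sym (is1 j j≢0))
      where
      is1 : ∀ i → i ≢ 0# → i ≡ 1#
      is1 i i≢0 = decidable-stable (i ≟ 1#) λ i≢1 → none (i , i≢0 , i≢1)

  -- For α = 1 the value in `nonvanishing` is 1, but 1 + α ≢ 0 fails in characteristic 2. There α =
  -- θ makes the value 2 θ - θ² = θ².
  scalars : Scalars
  scalars with 1# + 1# ≟ 0#
  ... | no 2≢0 = record
    { α = 1#
    ; θ = - 1#
    ; α≢0 = 1≢0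
    ; 1+α≢0 = 2≢0
    ; θ≢0 = λ eq → 1≢0 (trans (solve 1 (λ o → o := :- (:- o) :+ o :+ :- o) refl 1#) (trans (cong (λ z → - z + 1# + - 1#) eq)
                     (trans (solve 2 (λ z o → :- z :+ o :+ :- o := :- z) refl 0# 1#) -0≡0)))
    ; θ≢1 = λ eq → 2≢0 (trans (cong (1# +_) (sym eq)) (-‿inverseʳ 1#))
    ; nonvanishing = λ eq → 1≢0 (trans (solve 1 (λ o → o := o :+ (:- o) :* (o :+ :- o)) refl 1#) eq)
    }
    where
    -0≡0 : - 0# ≡ 0#
    -0≡0 = trans (sym (+-identityˡ _)) (-‿inverseʳ 0#)
  ... | yes 2≡0 with thirdElement
  ... | θ , θ≢0 , θ≢1 = record
    { α = θ
    ; θ = θ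
    ; α≢0 = θ≢0
    ; 1+α≢0 = λ eq → θ≢1 (sym (+-cancelˡ 1# 1# θ (trans 2≡0 (sym eq))))
    ; θ≢0 = θ≢0
    ; θ≢1 = θ≢1
    ; nonvanishing = λ eq → θ≢0 (*-cancel-0 θ≢0 (begin
        θ * θ                                ≡⟨ +-identityʳ (θ * θ) ⟨
        θ * θ + 0#                           ≡⟨ cong (θ * θ +_) eq ⟨
        θ * θ + (θ + θ * (1# + - θ))         ≡⟨ solve 2 (λ t o → t :* t :+ (t :+ t :* (o :+ :- t)) := t :+ t :* o) refl θ 1# ⟩
        θ + θ * 1#                           ≡⟨ cong (_+ θ * 1#) (*-identityʳ θ) ⟨
        θ * 1# + θ * 1#                      ≡⟨ distribˡ θ 1# 1# ⟨
        θ * (1# + 1#)                        ≡⟨ cong (θ *_) 2≡0 ⟩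
        θ * 0#                               ≡⟨ zeroʳ θ ⟩
        0#                                   ∎))
    }
    where open ≡-Reasoning

  open Scalars scalars

  -- Subtracting the two hypotheses gives (θ - 1)(b - d) = 0, so the slopes agree. A spike at 0
  -- leaves the values at 1 and θ alone, so it is detected by this extrapolation.
  interpolate : ∀ a b c d → a + 1# * b ≡ c + 1# * d → a + θ * b ≡ c + θ * d → a + 0# * b ≡ c + 0# * d
  interpolate a b c d eq₁ eqθ = cong₂ _+_ a≡c (trans (zeroˡ b) (sym (zeroˡ d)))
    where
    open ≡-Reasoning
    b-d≡0 : b + - d ≡ 0#
    b-d≡0 = *-cancel-0 (λ eq → θ≢1 (+-cancelʳ (- 1#) θ 1# (trans eq (sym (-‿inverseʳ 1#))))) (begin
      (θ + - 1#) * (b + - d)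
        ≡⟨ solve 6 (λ a b c d θ o → (θ :+ :- o) :* (b :+ :- d) :=
             ((a :+ θ :* b) :+ :- (c :+ θ :* d)) :+ :- ((a :+ o :* b) :+ :- (c :+ o :* d))) refl a b c d θ 1# ⟩
      ((a + θ * b) + - (c + θ * d)) + - ((a + 1# * b) + - (c + 1# * d))
        ≡⟨ cong₂ (λ u v → (u + - (c + θ * d)) + - (v + - (c + 1# * d))) eqθ eq₁ ⟩
      ((c + θ * d) + - (c + θ * d)) + - ((c + 1# * d) + - (c + 1# * d))
        ≡⟨ cong₂ (λ u v → u + - v) (-‿inverseʳ _) (-‿inverseʳ _) ⟩
      0# + - 0#
        ≡⟨ -‿inverseʳ 0# ⟩
      0# ∎)
    b≡d : b ≡ d
    b≡d = +-cancelʳ (- d) b d (trans b-d≡0 (sym (-‿inverseʳ d)))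
    a≡c : a ≡ c
    a≡c = +-cancelʳ (1# * b) a c (trans eq₁ (cong (λ z → c + 1# * z) (sym b≡d)))

  interpolate-constant : ∀ i a b → i ≡ a + 1# * b → i ≡ a + θ * b → i ≡ a + 0# * b
  interpolate-constant i a b eq₁ eqθ =
    trans (sym (i+c0 0#)) (interpolate i 0# a b (trans (i+c0 1#) eq₁) (trans (i+c0 θ) eqθ))
    where
    i+c0 : ∀ c → i + c * 0# ≡ i
    i+c0 c = trans (cong (i +_) (zeroʳ c)) (+-identityʳ i)

  ·ᵥ-cancel-0 : ∀ {n s} {v : V n} → s ≢ 0# → s ·ᵥ v ≡ 0ᵥ → v ≡ 0ᵥ
  ·ᵥ-cancel-0 {v = []} s≢0 eq = refl
  ·ᵥ-cancel-0 {v = a ∷ v} s≢0 eq = cong₂ _∷_ (*-cancel-0 s≢0 (∷-injectiveˡ eq)) (·ᵥ-cancel-0 s≢0 (∷-injectiveʳ eq))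

  spike : ∀ {n} → V n → Fin q → V n
  spike w c with c ≟ 0#
  ... | yes _ = w
  ... | no _ = 0ᵥ

  spike-0 : ∀ {n} (w : V n) → spike w 0# ≡ w
  spike-0 w with 0# ≟ 0#
  ... | yes _ = refl
  ... | no 0≢0 = ⊥-elim (0≢0 refl)

  spike-≢0 : ∀ {n} (w : V n) {c} → c ≢ 0# → spike w c ≡ 0ᵥ
  spike-≢0 w {c} c≢0 with c ≟ 0#
  ... | yes c≡0 = ⊥-elim (c≢0 c≡0)
  ... | no _ = refl

  -- The parameter c is the height: `Bent` says that no line crossing the slices survives g together
  -- with the offset at height 0. The direction `v` may be 0, as the line may be vertical.
  Bent : ∀ {n} → (V n → V n) → V n → Set
  Bent g w = ∀ x v y z → ¬ (∀ c → g (x +ᵥ c ·ᵥ v) +ᵥ spike w c ≡ y +ᵥ c ·ᵥ z)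

  record Scrambling (n : ℕ) : Set₁ where
    field
      g      : V n → V n
      perm   : Perm g
      affinityZero : ∀ k → 1 ≤ k → k < n → AffinityZero F k g
      offset : V n
      bent   : Bent g offset

  -- No k satisfies 1 ≤ k < 1, and the identity is bent by a spike of size 1: two affine functions
  -- that agree at 1 and θ agree at 0.
  scrambling₁ : Scrambling 1
  scrambling₁ = record
    { g = λ x → x
    ; perm = Perm-inverse (λ x → x) (λ _ → refl) (λ _ → refl)
    ; affinityZero = λ { (suc k) 1≤k (s≤s ()) }
    ; offset = 1# ∷ []
    ; bent = λ { (x ∷ []) (v ∷ []) (y ∷ []) (z ∷ []) eq → 1≢0 (+-cancelˡ (x + 0# * v) 1# 0# (begin
        (x + 0# * v) + 1#    ≡⟨ ∷-injectiveˡ (trans (cong (((x + 0# * v) ∷ []) +ᵥ_) (sym (spike-0 (1# ∷ [])))) (eq 0#)) ⟩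
        y + 0# * z           ≡⟨ interpolate x v y z (off (eq 1#) 1≢0) (off (eq θ) θ≢0) ⟨
        x + 0# * v           ≡⟨ +-identityʳ _ ⟨
        (x + 0# * v) + 0#    ∎)) }
    }
    where
    open ≡-Reasoning
    off : ∀ {a b c} → (a ∷ []) +ᵥ spike (1# ∷ []) c ≡ b ∷ [] → c ≢ 0# → a ≡ b
    off {a} {c = c} eq c≢0 = ∷-injectiveˡ (trans (sym (trans (cong ((a ∷ []) +ᵥ_) (spike-≢0 (1# ∷ []) c≢0)) (+ᵥ-identityʳ _))) eq)

  module Step {n : ℕ} (S : Scrambling n) where
    open Scrambling S

    φ : Fin q → V n → V n
    φ t x = g x +ᵥ spike offset t

    φ-perm : ∀ t → Perm (φ t)
    φ-perm t = Perm-∘ perm (Perm-inverse (_-ᵥ spike offset t) (λ x → +ᵥ-cancelʳ-ᵥ x _) (λ x → -ᵥ+ᵥ-cancel x _))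

    h : V (suc n) → V (suc n)
    h = twisted φ φ-perm

    h-affinityZero : ∀ k → 1 ≤ k → k < suc n → AffinityZero F k h
    h-affinityZero (suc k) _ k<1+n X flatX flat with untwist φ φ-perm (q≥3 θ≢0 θ≢1) flatX flat
    ... | flat′ , root∉ with slices flatX
    ... | inSlice c x us ind iff with suc k ℕ.≟ n
    -- In dimension n the flat is the whole slice, which contains its root.
    ... | yes refl = root∉ (λ Xty → proj₁ (Equivalence.to (iff _ _) Xty))
        (Equivalence.from (iff c z) (refl , proj₁ z∈ , trans (sym (+-ᵥ-cancel x z)) (cong (x +ᵥ_) (proj₂ z∈))))
        (proj₂ (proj₂ (φ-perm c) 0ᵥ) refl)
      where
      z = proj₁ (proj₂ (φ-perm c) 0ᵥ)
      z∈ : Span us (z -ᵥ x)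
      z∈ = spans-all us ind (z -ᵥ x)
    ... | no k≢n = affinityZero (suc k) (s≤s z≤n) (ℕ.≤∧≢⇒< (ℕ.≤-pred k<1+n) k≢n) (λ y → X (c ∷ y))
      (Flat-cong (λ y → mk⇔ (λ p → Equivalence.from (iff c y) (refl , p)) (λ Xcy → proj₂ (Equivalence.to (iff c y) Xcy)))
        (affineSpan-Flat x us ind))
      (Flat-untranslate (spike offset c) (inSlice-image iff flat′))
    h-affinityZero (suc k) _ k<1+n X flatX flat | flat′ , root∉ | crossing x w us ind iff
      with crossing-image iff flat′
    -- Each slice of the image is a single point, so the image points are y + c v, against `bent`.
    h-affinityZero (suc zero) _ k<1+n X flatX flat | flat′ , root∉ | crossing x w [] ind iff | y , v , [] , ind′ , iff′ =
      bent x w y v λ c → trans (on-line c (Equivalence.to (iff′ c _) (_ , Equivalence.from (iff c _) ([] , sym (+ᵥ-identityʳ _)) , refl))) refl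
      where
      on-line : ∀ c {z} → (Σ (V 0) λ as → z ≡ (y +ᵥ c ·ᵥ v) +ᵥ lc as []) → z ≡ y +ᵥ c ·ᵥ v
      on-line c ([] , eq) = trans eq (+ᵥ-identityʳ _)
    -- The slices now have positive dimension, and the one at height 0 contradicts the hypothesis on
    -- g.
    h-affinityZero (suc (suc k)) _ k<1+n X flatX flat | flat′ , root∉ | crossing x w us ind iff | y , v , vs , ind′ , iff′ =
      affinityZero (suc k) (s≤s z≤n) (ℕ.≤-pred k<1+n) (λ y → X (0# ∷ y))
        (Flat-cong (λ z → mk⇔ (Equivalence.from (iff 0# z)) (Equivalence.to (iff 0# z)))
          (affineSpan-Flat (x +ᵥ 0# ·ᵥ w) us ind))
        (Flat-untranslate (spike offset 0#) (Flat-cong (λ z → mk⇔ (Equivalence.from (iff′ 0# z)) (Equivalence.to (iff′ 0# z)))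
          (affineSpan-Flat (y +ᵥ 0# ·ᵥ v) vs ind′)))

    spikeˢ : Fin q → Fin q
    spikeˢ c = head (spike (α ∷ []) c)

    spikeˢ-0 : spikeˢ 0# ≡ α
    spikeˢ-0 = cong head (spike-0 (α ∷ []))

    spikeˢ-≢0 : ∀ {c} → c ≢ 0# → spikeˢ c ≡ 0#
    spikeˢ-≢0 c≢0 = cong head (spike-≢0 (α ∷ []) c≢0)

    spike-∷ : ∀ c → spike (α ∷ 0ᵥ {n}) c ≡ spikeˢ c ∷ 0ᵥ
    spike-∷ c with c ≟ 0#
    ... | yes _ = refl
    ... | no _ = refl

    -- The affine function has the value i at 1 and θ, hence at 0, where the spike adds α ≢ 0.
    constant-indicator-absurd : ∀ (y z : V n) a b → (∀ c → isZero (y +ᵥ c ·ᵥ z) + spikeˢ c ≡ a + c * b) →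
      ∀ i → ¬ (∀ c → isZero (y +ᵥ c ·ᵥ z) ≡ i)
    constant-indicator-absurd y z a b eq i const = α≢0 (+-cancelˡ i α 0# (begin
      i + α                                 ≡⟨ cong₂ _+_ (const 0#) spikeˢ-0 ⟨
      isZero (y +ᵥ 0# ·ᵥ z) + spikeˢ 0#     ≡⟨ eq 0# ⟩
      a + 0# * b                            ≡⟨ interpolate-constant i a b (at 1≢0) (at θ≢0) ⟨
      i                                     ≡⟨ +-identityʳ i ⟨
      i + 0#                                ∎))
      where
      open ≡-Reasoning
      at : ∀ {c} → c ≢ 0# → i ≡ a + c * b
      at {c} c≢0 = trans (sym (trans (cong₂ _+_ (const c) (spikeˢ-≢0 c≢0)) (+-identityʳ i))) (eq c)

    nonzero-elsewhere : ∀ {y z : V n} {c₀ c} → z ≢ 0ᵥ → y +ᵥ c₀ ·ᵥ z ≡ 0ᵥ → c ≢ c₀ → y +ᵥ c ·ᵥ z ≢ 0ᵥ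
    nonzero-elsewhere {y} {z} {c₀} {c} z≢0 eq₀ c≢c₀ eq = z≢0 (·ᵥ-cancel-0
      (λ c-c₀≡0 → c≢c₀ (+-cancelʳ (- c₀) c c₀ (trans c-c₀≡0 (sym (-‿inverseʳ c₀)))))
      (trans (rearrange c c₀ z) (trans (cong (_-ᵥ c₀ ·ᵥ z) (+ᵥ-cancelˡ y (trans eq (sym eq₀)))) (-ᵥ-inverse (c₀ ·ᵥ z)))))
      where
      rearrange : ∀ {n} c d (z : V n) → (c + - d) ·ᵥ z ≡ c ·ᵥ z -ᵥ d ·ᵥ z
      rearrange c d [] = refl
      rearrange c d (z ∷ zs) = cong₂ _∷_ (solve 3 (λ c d z → (c :+ :- d) :* z := c :* z :+ :- (d :* z)) refl c d z) (rearrange c d zs)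

    -- The zeros c of y + c z are all of F, none, or a single c₀.
    indicator+spike-not-affine : ∀ (y z : V n) a b → ¬ (∀ c → isZero (y +ᵥ c ·ᵥ z) + spikeˢ c ≡ a + c * b)
    indicator+spike-not-affine y z a b eq with z ≟ᵥ 0ᵥ
    ... | yes refl = constant-indicator-absurd y z a b eq _ λ c → cong isZero (trans (cong (y +ᵥ_) (·ᵥ-0ᵥ c)) (+ᵥ-identityʳ y))
    ... | no z≢0 with any? (λ c → (y +ᵥ c ·ᵥ z) ≟ᵥ 0ᵥ)
    ... | no none = constant-indicator-absurd y z a b eq 0# λ c → isZero-≢0 λ ≡0 → none (c , ≡0)
    ... | yes (c₀ , zero-at-c₀) with c₀ ≟ 0#
    -- The values at 1 and θ are 0, so the value 1 + α at 0 would be 0 as well.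
    ... | yes refl = 1+α≢0 (trans (sym (cong₂ _+_ (isZero-0 zero-at-c₀) spikeˢ-0)) (trans (eq 0#)
            (sym (interpolate-constant 0# a b (at 1≢0) (at θ≢0)))))
      where
      at : ∀ {c} → c ≢ 0# → 0# ≡ a + c * b
      at {c} c≢0 = trans (sym (trans (cong₂ _+_ (isZero-≢0 (nonzero-elsewhere z≢0 zero-at-c₀ c≢0)) (spikeˢ-≢0 c≢0)) (+-identityʳ 0#))) (eq c)
    -- θ c₀ differs from 0 and from c₀, so indicator and spike both vanish there.
    ... | no c₀≢0 = nonvanishing (begin
        α + θ * (1# + - α)            ≡⟨ cong₂ (λ u v → u + θ * (v + - u)) α≡a 1≡ ⟩
        a + θ * ((a + c₀ * b) + - a)  ≡⟨ solve 4 (λ a θ c b → a :+ θ :* ((a :+ c :* b) :+ :- a) := a :+ (θ :* c) :* b) refl a θ c₀ b ⟩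
        a + (θ * c₀) * b              ≡⟨ eq (θ * c₀) ⟨
        isZero (y +ᵥ (θ * c₀) ·ᵥ z) + spikeˢ (θ * c₀)
          ≡⟨ cong₂ _+_ (isZero-≢0 (nonzero-elsewhere z≢0 zero-at-c₀ θc₀≢c₀)) (spikeˢ-≢0 θc₀≢0) ⟩
        0# + 0#                       ≡⟨ +-identityʳ 0# ⟩
        0#                            ∎)
      where
      open ≡-Reasoning
      θc₀≢0 : θ * c₀ ≢ 0#
      θc₀≢0 = c₀≢0 ∘ *-cancel-0 θ≢0
      θc₀≢c₀ : θ * c₀ ≢ c₀
      θc₀≢c₀ eq′ = c₀≢0 (*-cancel-0 {θ + - 1#} (λ eq″ → θ≢1 (+-cancelʳ (- 1#) θ 1# (trans eq″ (sym (-‿inverseʳ 1#))))) (begin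
        (θ + - 1#) * c₀          ≡⟨ solve 3 (λ θ o c → (θ :+ :- o) :* c := θ :* c :+ :- (o :* c)) refl θ 1# c₀ ⟩
        θ * c₀ + - (1# * c₀)     ≡⟨ cong₂ (λ u v → u + - v) eq′ (*-identityˡ c₀) ⟩
        c₀ + - c₀                ≡⟨ -‿inverseʳ c₀ ⟩
        0#                       ∎))
      α≡a : α ≡ a
      α≡a = begin
        α                ≡⟨ +-identityˡ α ⟨
        0# + α           ≡⟨ cong₂ _+_ (isZero-≢0 (nonzero-elsewhere z≢0 zero-at-c₀ (c₀≢0 ∘ sym))) spikeˢ-0 ⟨
        isZero (y +ᵥ 0# ·ᵥ z) + spikeˢ 0# ≡⟨ eq 0# ⟩
        a + 0# * b       ≡⟨ cong (a +_) (zeroˡ b) ⟩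
        a + 0#           ≡⟨ +-identityʳ a ⟩
        a                ∎
      1≡ : 1# ≡ a + c₀ * b
      1≡ = begin
        1#               ≡⟨ +-identityʳ 1# ⟨
        1# + 0#          ≡⟨ cong₂ _+_ (isZero-0 zero-at-c₀) (spikeˢ-≢0 c₀≢0) ⟨
        isZero (y +ᵥ c₀ ·ᵥ z) + spikeˢ c₀ ≡⟨ eq c₀ ⟩
        a + c₀ * b       ∎

    open ≡-Reasoning
    -- The new offset has tail 0, so the tails alone say that `r c` is y + c z. The twist adds its
    -- indicator to the head, and the head equation then makes indicator plus spike affine in c.
    h-bent : Bent h (α ∷ 0ᵥ)
    h-bent (t ∷ x) (s ∷ v) (y₁ ∷ y) (z₁ ∷ z) eq = indicator+spike-not-affine y z (y₁ + - t) (z₁ + - s) λ c → begin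
      isZero (y +ᵥ c ·ᵥ z) + spikeˢ c
        ≡⟨ cong (λ r → isZero r + spikeˢ c) (eq₂ c) ⟨
      isZero (r c) + spikeˢ c
        ≡⟨ solve 5 (λ i p t c s → i :+ p := (((t :+ c :* s) :+ i) :+ p) :+ :- (t :+ c :* s)) refl (isZero (r c)) (spikeˢ c) t c s ⟩
      (((t + c * s) + isZero (r c)) + spikeˢ c) + - (t + c * s)
        ≡⟨ cong (_+ - (t + c * s)) (eq₁ c) ⟩
      (y₁ + c * z₁) + - (t + c * s)
        ≡⟨ solve 5 (λ y z t c s → (y :+ c :* z) :+ :- (t :+ c :* s) := (y :+ :- t) :+ c :* (z :+ :- s)) refl y₁ z₁ t c s ⟩
      (y₁ + - t) + c * (z₁ + - s) ∎
      where
      r : Fin q → V n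
      r c = φ (t + c * s) (x +ᵥ c ·ᵥ v)
      eqs : ∀ c → (((t + c * s) + isZero (r c)) + spikeˢ c) ∷ (r c +ᵥ 0ᵥ) ≡ (y₁ + c * z₁) ∷ (y +ᵥ c ·ᵥ z)
      eqs c = trans (cong (h ((t ∷ x) +ᵥ c ·ᵥ (s ∷ v)) +ᵥ_) (sym (spike-∷ c))) (eq c)
      eq₁ : ∀ c → ((t + c * s) + isZero (r c)) + spikeˢ c ≡ y₁ + c * z₁
      eq₁ c = ∷-injectiveˡ (eqs c)
      eq₂ : ∀ c → r c ≡ y +ᵥ c ·ᵥ z
      eq₂ c = trans (sym (+ᵥ-identityʳ (r c))) (∷-injectiveʳ (eqs c))

    next : Scrambling (suc n)
    next = record { g = h ; perm = twisted-perm φ φ-perm ; affinityZero = h-affinityZero ; offset = α ∷ 0ᵥ ; bent = h-bent }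

  scrambling : ∀ n → Scrambling (suc n)
  scrambling zero = scrambling₁
  scrambling (suc n) = Step.next (scrambling n)

-- Commutative rings of characteristic two and Frobenius.

module CharacteristicTwo (R : CommutativeRing 0ℓ 0ℓ)
  (1+1≈0 : CommutativeRing._≈_ R (CommutativeRing._+_ R (CommutativeRing.1# R) (CommutativeRing.1# R)) (CommutativeRing.0# R)) where
  open CommutativeRing R hiding (refl; trans; sym)
  private module CR = CommutativeRing R
  open Relation.Binary.Reasoning.Setoid setoid

  x+x≈0 : ∀ x → x + x ≈ 0#
  x+x≈0 x = begin
    x + x              ≈⟨ +-cong (*-identityʳ x) (*-identityʳ x) ⟨
    x * 1# + x * 1#    ≈⟨ distribˡ x 1# 1# ⟨
    x * (1# + 1#)      ≈⟨ *-congˡ 1+1≈0 ⟩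
    x * 0#             ≈⟨ zeroʳ x ⟩
    0#                 ∎

  -x≈x : ∀ x → - x ≈ x
  -x≈x x = begin
    - x             ≈⟨ +-identityˡ (- x) ⟨
    0# + - x        ≈⟨ +-congʳ (x+x≈0 x) ⟨
    (x + x) + - x   ≈⟨ +-assoc x x (- x) ⟩
    x + (x + - x)   ≈⟨ +-congˡ (-‿inverseʳ x) ⟩
    x + 0#          ≈⟨ +-identityʳ x ⟩
    x               ∎

  x+y≈0⇒x≈y : ∀ {x y} → x + y ≈ 0# → x ≈ y
  x+y≈0⇒x≈y {x} {y} eq = begin
    x             ≈⟨ +-identityʳ x ⟨
    x + 0#        ≈⟨ +-congˡ (x+x≈0 y) ⟨
    x + (y + y)   ≈⟨ +-assoc x y y ⟨
    (x + y) + y   ≈⟨ +-congʳ eq ⟩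
    0# + y        ≈⟨ +-identityˡ y ⟩
    y             ∎

  -- Coefficients modulo 2, so that the solver itself cancels x + x.
  F₂ : RawRing 0ℓ 0ℓ
  F₂ = record { Carrier = Bool ; _≈_ = _≡_ ; _+_ = _xor_ ; _*_ = _∧_ ; -_ = λ x → x ; 0# = false ; 1# = true }

  ⟦_⟧₂ : Bool → Carrier
  ⟦ true ⟧₂ = 1#
  ⟦ false ⟧₂ = 0#

  F₂-morphism : F₂ -Raw-AlmostCommutative⟶ fromCommutativeRing R
  F₂-morphism = record
    { ⟦_⟧ = ⟦_⟧₂
    ; +-homo = λ { true true → CR.sym 1+1≈0 ; true false → CR.sym (+-identityʳ 1#) ; false y → CR.sym (+-identityˡ ⟦ y ⟧₂) }
    ; *-homo = λ { true y → CR.sym (*-identityˡ ⟦ y ⟧₂) ; false y → CR.sym (zeroˡ ⟦ y ⟧₂) }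
    ; -‿homo = λ x → CR.sym (-x≈x ⟦ x ⟧₂)
    ; 0-homo = CR.refl
    ; 1-homo = CR.refl
    }

  F₂≟ : (x y : Bool) → Maybe (⟦ x ⟧₂ ≈ ⟦ y ⟧₂)
  F₂≟ true true = just CR.refl
  F₂≟ false false = just CR.refl
  F₂≟ _ _ = nothing

  open Algebra.Solver.Ring F₂ (fromCommutativeRing R) F₂-morphism F₂≟ public
    using (solve; _:=_; _:+_; _:*_)

  sq : Carrier → Carrier
  sq x = x * x

  sq-cong : ∀ {x y} → x ≈ y → sq x ≈ sq y
  sq-cong x≈y = *-cong x≈y x≈y

  sq-+* : ∀ c t w → sq (c + t * w) ≈ sq c + sq t * sq w
  sq-+* = solve 3 (λ c t w → (c :+ t :* w) :* (c :+ t :* w) := c :* c :+ (t :* t) :* (w :* w)) CR.refl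

  -- The power x^(2^i), as iterated squaring.
  frob : ℕ → Carrier → Carrier
  frob i x = fold x sq i

  frob-cong : ∀ i {x y} → x ≈ y → frob i x ≈ frob i y
  frob-cong zero x≈y = x≈y
  frob-cong (suc i) x≈y = sq-cong (frob-cong i x≈y)

  frob-+ : ∀ i x y → frob i (x + y) ≈ frob i x + frob i y
  frob-+ zero x y = CR.refl
  frob-+ (suc i) x y = CR.trans (sq-cong (frob-+ i x y))
    (solve 2 (λ x y → (x :+ y) :* (x :+ y) := x :* x :+ y :* y) CR.refl (frob i x) (frob i y))

  frob-frob : ∀ i j x → frob i (frob j x) ≈ frob (i ℕ.+ j) x
  frob-frob zero j x = CR.refl
  frob-frob (suc i) j x = sq-cong (frob-frob i j x)

  -- mersenne i x is x to the power 2 ^ i ∸ 1.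
  mersenne : ℕ → Carrier → Carrier
  mersenne zero x = 1#
  mersenne (suc i) x = x * sq (mersenne i x)

  *-mersenne : ∀ i x → x * mersenne i x ≈ frob i x
  *-mersenne zero x = *-identityʳ x
  *-mersenne (suc i) x = CR.trans
    (solve 2 (λ x w → x :* (x :* (w :* w)) := (x :* w) :* (x :* w)) CR.refl x (mersenne i x))
    (sq-cong (*-mersenne i x))

  abstract
    -- Von Neumann regularity, with r = x^(2^i - 2); 1 ≤ i keeps the exponent nonnegative. Then x r
    -- is idempotent, and x is invertible on its range.
    frob-fixed⇒regular : ∀ {i} x → 1 ≤ i → frob i x ≈ x → ∃ λ r → x * (x * r) ≈ x
    frob-fixed⇒regular {suc i} x _ fixed = sq (mersenne i x) , CR.trans (*-mersenne (suc i) x) fixed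

  pow : Carrier → ℕ → Carrier
  pow x zero = 1#
  pow x (suc i) = x * pow x i

  pow-+ : ∀ x i j → pow x (i ℕ.+ j) ≈ pow x i * pow x j
  pow-+ x zero j = CR.sym (*-identityˡ _)
  pow-+ x (suc i) j = CR.trans (*-congˡ (pow-+ x i j)) (CR.sym (*-assoc x (pow x i) (pow x j)))

  frob≈pow : ∀ i x → frob i x ≈ pow x (2 ^ i)
  frob≈pow zero x = CR.sym (*-identityʳ x)
  frob≈pow (suc i) x = CR.trans (*-cong (frob≈pow i x) (frob≈pow i x))
    (CR.trans (CR.sym (pow-+ x (2 ^ i) (2 ^ i))) (CR.reflexive (cong (λ e → pow x (2 ^ i ℕ.+ e)) (sym (ℕ.+-identityʳ (2 ^ i))))))

-- Roots of monic polynomials over an integral domain.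

module RootCounting (R : CommutativeRing 0ℓ 0ℓ)
  (1≉0 : ¬ CommutativeRing._≈_ R (CommutativeRing.1# R) (CommutativeRing.0# R))
  (integral : ∀ {x y} → CommutativeRing._≈_ R (CommutativeRing._*_ R x y) (CommutativeRing.0# R) →
    CommutativeRing._≈_ R x (CommutativeRing.0# R) ⊎ CommutativeRing._≈_ R y (CommutativeRing.0# R)) where
  open CommutativeRing R hiding (refl; trans; sym; zero)
  private module CR = CommutativeRing R
  open IntegerSolver R
  open Relation.Binary.Reasoning.Setoid setoid

  -- Horner form with the leading 1 left implicit, so that the length of the vector is exactly the
  -- degree.
  monic : ∀ {d} → Vec Carrier d → Carrier → Carrier
  monic [] t = 1#
  monic (c ∷ cs) t = c + t * monic cs t

  private
    addScaled : ∀ {d} → Carrier → Vec Carrier (suc d) → Vec Carrier d → Vec Carrier (suc d)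
    -- The implicit leading 1 of the shorter polynomial meets the last listed coefficient of the
    -- longer one.
    addScaled r (c ∷ []) [] = c + r ∷ []
    addScaled r (c ∷ cs@(_ ∷ _)) (e ∷ es) = c + r * e ∷ addScaled r cs es

    addScaled-eval : ∀ {d} r t (cs : Vec Carrier (suc d)) es → monic (addScaled r cs es) t ≈ monic cs t + r * monic es t
    addScaled-eval r t (c ∷ []) [] = begin
      (c + r) + t * 1#         ≈⟨ solve 3 (λ c r t → (c :+ r) :+ t := (c :+ t) :+ r) CR.refl c r (t * 1#) ⟩
      (c + t * 1#) + r         ≈⟨ +-congˡ (*-identityʳ r) ⟨
      (c + t * 1#) + r * 1#    ∎
    addScaled-eval r t (c ∷ cs@(_ ∷ _)) (e ∷ es) = CR.trans (+-congˡ (*-congˡ (addScaled-eval r t cs es)))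
      (solve 6 (λ c r e t u v → (c :+ r :* e) :+ t :* (u :+ r :* v) := (c :+ t :* u) :+ r :* (e :+ t :* v))
        CR.refl c r e t (monic cs t) (monic es t))

    -- Synthetic division by T - r: if P - P(r) = (T - r) Q, then c + T P has the quotient P + r Q.
    quotient : ∀ {d} → Carrier → Vec Carrier (suc d) → Vec Carrier d
    quotient r (c ∷ []) = []
    quotient r (c ∷ cs@(_ ∷ _)) = addScaled r cs (quotient r cs)

    quotient-eval : ∀ {d} r t (cs : Vec Carrier (suc d)) →
      monic cs t + - monic cs r ≈ (t + - r) * monic (quotient r cs) t
    quotient-eval r t (c ∷ []) =
      solve 4 (λ c t r o → (c :+ t :* o) :+ :- (c :+ r :* o) := (t :+ :- r) :* o) CR.refl c t r 1#
    quotient-eval r t (c ∷ cs@(_ ∷ _)) = begin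
      (c + t * u) + - (c + r * v)
        ≈⟨ solve 5 (λ c t r u v → (c :+ t :* u) :+ :- (c :+ r :* v) := (t :+ :- r) :* u :+ r :* (u :+ :- v)) CR.refl c t r u v ⟩
      (t + - r) * u + r * (u + - v)
        ≈⟨ +-congˡ (*-congˡ (quotient-eval r t cs)) ⟩
      (t + - r) * u + r * ((t + - r) * w)
        ≈⟨ solve 4 (λ d u r w → d :* u :+ r :* (d :* w) := d :* (u :+ r :* w)) CR.refl (t + - r) u r w ⟩
      (t + - r) * (u + r * w)
        ≈⟨ *-congˡ (addScaled-eval r t cs (quotient r cs)) ⟨
      (t + - r) * monic (addScaled r cs (quotient r cs)) t ∎
      where
      u = monic cs t
      v = monic cs r
      w = monic (quotient r cs) t

  -- Each root splits off a linear factor, and integrality passes the other roots to the quotient,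
  -- until the constant 1 would vanish.
  too-many-roots : ∀ {d} (cs : Vec Carrier d) (xs : Fin (suc d) → Carrier) → (∀ {i j} → xs i ≈ xs j → i ≡ j) →
    ¬ (∀ i → monic cs (xs i) ≈ 0#)
  too-many-roots [] xs inj root = 1≉0 (root zero)
  too-many-roots cs@(_ ∷ _) xs inj root = too-many-roots (quotient r cs) (λ i → xs (suc i)) (λ eq → suc-injective (inj eq)) root′
    where
    r = xs zero
    root′ : ∀ i → monic (quotient r cs) (xs (suc i)) ≈ 0#
    root′ i with integral (CR.trans (CR.sym (quotient-eval r (xs (suc i)) cs))
                   (CR.trans (+-cong (root (suc i)) (-‿cong (root zero))) (-‿inverseʳ 0#)))
    ... | inj₂ eq = eq
    ... | inj₁ eq with inj {suc i} {zero} (begin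
          xs (suc i)              ≈⟨ solve 2 (λ t r → t := (t :+ :- r) :+ r) CR.refl (xs (suc i)) r ⟩
          (xs (suc i) + - r) + r  ≈⟨ +-congʳ eq ⟩
          0# + r                  ≈⟨ +-identityˡ r ⟩
          r                       ∎)
    ... | ()

-- Scalars and vectors over F_2.

module Binary (F : FieldOn 2) where
  open LinearAlgebra F public

  -- The field structure on `Fin 2` is abstract, and either element may be its zero; this replaces
  -- matching on the elements.
  bit : ∀ a → a ≡ 0# ⊎ a ≡ 1#
  bit a = cases 0# 1# a 0≢1
    where
    cases : ∀ (o i a : Fin 2) → o ≢ i → a ≡ o ⊎ a ≡ i
    cases zero zero a o≢i = ⊥-elim (o≢i refl)
    cases (suc zero) (suc zero) a o≢i = ⊥-elim (o≢i refl)
    cases zero (suc zero) zero o≢i = inj₁ refl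
    cases zero (suc zero) (suc zero) o≢i = inj₂ refl
    cases (suc zero) zero zero o≢i = inj₂ refl
    cases (suc zero) zero (suc zero) o≢i = inj₁ refl

  1+1≡0 : 1# + 1# ≡ 0#
  1+1≡0 with bit (1# + 1#)
  ... | inj₁ eq = eq
  ... | inj₂ eq = ⊥-elim (0≢1 (sym (+-cancelˡ 1# 1# 0# (trans eq (sym (+-identityʳ 1#))))))

  open CharacteristicTwo ring 1+1≡0 public using () renaming (x+x≈0 to a+a≡0)

  a*a≡a : ∀ a → a * a ≡ a
  a*a≡a a with bit a
  ... | inj₁ refl = zeroˡ 0#
  ... | inj₂ refl = *-identityˡ 1#

  v+v≡0 : ∀ {n} (v : V n) → v +ᵥ v ≡ 0ᵥ
  v+v≡0 [] = refl
  v+v≡0 (a ∷ v) = cong₂ _∷_ (a+a≡0 a) (v+v≡0 v)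

  v+w≡0⇒v≡w : ∀ {n} (v w : V n) → v +ᵥ w ≡ 0ᵥ → v ≡ w
  v+w≡0⇒v≡w v w eq = +ᵥ-cancelʳ w (trans eq (sym (v+v≡0 w)))

-- Polynomials in the shift operator, acting on binary sequences.

module ShiftAction (F : FieldOn 2) where
  open Binary F public

  Seq : Set
  Seq = ℕ → Fin 2

  Poly : Set
  Poly = List (Fin 2)

  infix 4 _≐_
  _≐_ : Seq → Seq → Set
  a ≐ b = ∀ n → a n ≡ b n

  -- The coefficient list of p acts as p(E), where E is the shift of sequences.
  act : Poly → Seq → Seq
  act [] a n = 0#
  act (c ∷ p) a n = c * a n + act p (a ∘ suc) n

  act-cong : ∀ p {a b} → a ≐ b → act p a ≐ act p b
  act-cong [] eq n = refl
  act-cong (c ∷ p) eq n = cong₂ _+_ (cong (c *_) (eq n)) (act-cong p (eq ∘ suc) n)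

  act-shift : ∀ p a j n → act p a (n ℕ.+ j) ≡ act p (λ i → a (i ℕ.+ j)) n
  act-shift [] a j n = refl
  act-shift (c ∷ p) a j n = cong (c * a (n ℕ.+ j) +_) (act-shift p (a ∘ suc) j n)

  act-suc : ∀ p a n → act p (a ∘ suc) n ≡ act p a (suc n)
  act-suc [] a n = refl
  act-suc (c ∷ p) a n = cong (c * a (suc n) +_) (act-suc p (a ∘ suc) n)

  act-0 : ∀ p {a} → (∀ n → a n ≡ 0#) → ∀ n → act p a n ≡ 0#
  act-0 [] a≡0 n = refl
  act-0 (c ∷ p) a≡0 n = trans (cong₂ _+_ (trans (cong (c *_) (a≡0 n)) (zeroʳ c)) (act-0 p (a≡0 ∘ suc) n)) (+-identityʳ 0#)

  act-linear : ∀ p c a b n → act p (λ i → c * a i + b i) n ≡ c * act p a n + act p b n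
  act-linear [] c a b n = sym (trans (+-identityʳ _) (zeroʳ c))
  act-linear (d ∷ p) c a b n = trans (cong (d * (c * a n + b n) +_) (act-linear p c (a ∘ suc) (b ∘ suc) n))
    (solve 6 (λ d c a b x y → d :* (c :* a :+ b) :+ (c :* x :+ y) := c :* (d :* a :+ x) :+ (d :* b :+ y)) refl
      d c (a n) (b n) (act p (a ∘ suc) n) (act p (b ∘ suc) n))

  -- Polynomials in one operator commute: r(E) is linear and commutes with the shift E.
  act-comm : ∀ p r a n → act p (act r a) n ≡ act r (act p a) n
  act-comm [] r a n = sym (act-0 r (λ _ → refl) n)
  act-comm (c ∷ p) r a n = begin
    c * act r a n + act p (act r a ∘ suc) n    ≡⟨ cong (c * act r a n +_) (act-cong p (λ i → sym (act-suc r a i)) n) ⟩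
    c * act r a n + act p (act r (a ∘ suc)) n  ≡⟨ cong (c * act r a n +_) (act-comm p r (a ∘ suc) n) ⟩
    c * act r a n + act r (act p (a ∘ suc)) n  ≡⟨ act-linear r c a (act p (a ∘ suc)) n ⟨
    act r (act (c ∷ p) a) n                    ∎
    where open ≡-Reasoning

  infixl 6 _+ₚ_
  infixl 7 _*ₚ_

  abstract
    _+ₚ_ : Poly → Poly → Poly
    [] +ₚ r = r
    p@(_ ∷ _) +ₚ [] = p
    (c ∷ p) +ₚ (d ∷ r) = c + d ∷ p +ₚ r

    act-+ : ∀ p r a n → act (p +ₚ r) a n ≡ act p a n + act r a n
    act-+ [] r a n = sym (+-identityˡ _)
    act-+ (c ∷ p) [] a n = sym (+-identityʳ _)
    act-+ (c ∷ p) (d ∷ r) a n = trans (cong ((c + d) * a n +_) (act-+ p r (a ∘ suc) n))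
      (solve 5 (λ c d a x y → (c :+ d) :* a :+ (x :+ y) := (c :* a :+ x) :+ (d :* a :+ y)) refl
        c d (a n) (act p (a ∘ suc) n) (act r (a ∘ suc) n))

    scale : Fin 2 → Poly → Poly
    scale c = List.map (c *_)

    act-scale : ∀ c p a n → act (scale c p) a n ≡ c * act p a n
    act-scale c [] a n = sym (zeroʳ c)
    act-scale c (d ∷ p) a n = trans (cong (c * d * a n +_) (act-scale c p (a ∘ suc) n))
      (solve 4 (λ c d a x → c :* d :* a :+ c :* x := c :* (d :* a :+ x)) refl c d (a n) (act p (a ∘ suc) n))

    _*ₚ_ : Poly → Poly → Poly
    [] *ₚ r = []
    (c ∷ p) *ₚ r = scale c r +ₚ (0# ∷ p *ₚ r)

    act-* : ∀ p r a n → act (p *ₚ r) a n ≡ act p (act r a) n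
    act-* [] r a n = refl
    act-* (c ∷ p) r a n = begin
      act (scale c r +ₚ (0# ∷ p *ₚ r)) a n
        ≡⟨ act-+ (scale c r) _ a n ⟩
      act (scale c r) a n + (0# * a n + act (p *ₚ r) (a ∘ suc) n)
        ≡⟨ cong₂ _+_ (act-scale c r a n) (cong₂ _+_ (zeroˡ (a n)) (act-* p r (a ∘ suc) n)) ⟩
      c * act r a n + (0# + act p (act r (a ∘ suc)) n)
        ≡⟨ cong (c * act r a n +_) (trans (+-identityˡ _) (act-cong p (act-suc r a) n)) ⟩
      c * act r a n + act p (act r a ∘ suc) n ∎
      where open ≡-Reasoning

  1ₚ X : Poly
  1ₚ = 1# ∷ []
  X = 0# ∷ 1# ∷ []

  act-1 : ∀ a n → act 1ₚ a n ≡ a n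
  act-1 a n = trans (+-identityʳ _) (*-identityˡ (a n))

  act-X : ∀ a n → act X a n ≡ a (suc n)
  act-X a n = trans (cong₂ _+_ (zeroˡ (a n)) (act-1 (a ∘ suc) n)) (+-identityˡ _)

  -- Polynomials modulo the annihilator of the sequence b.
  module Modulo (b : Seq) where

    infix 4 _≈_
    record _≈_ (p r : Poly) : Set where
      constructor agree
      field at : act p b ≐ act r b
    open _≈_ public

    ≈-trans : ∀ {p r s} → p ≈ r → r ≈ s → p ≈ s
    ≈-trans (agree e) (agree f) = agree λ n → trans (e n) (f n)

    *ₚ-comm : ∀ p r → p *ₚ r ≈ r *ₚ p
    *ₚ-comm p r = agree λ n → trans (act-* p r b n) (trans (act-comm p r b n) (sym (act-* r p b n)))

    *ₚ-congˡ : ∀ p {r s} → r ≈ s → p *ₚ r ≈ p *ₚ s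
    *ₚ-congˡ p {r} {s} (agree e) = agree λ n → trans (act-* p r b n) (trans (act-cong p e n) (sym (act-* p s b n)))

    *ₚ-cong : ∀ {p p′ r r′} → p ≈ p′ → r ≈ r′ → p *ₚ r ≈ p′ *ₚ r′
    *ₚ-cong {p} {p′} {r} {r′} e f = ≈-trans (*ₚ-congˡ p f) (≈-trans (*ₚ-comm p r′) (≈-trans (*ₚ-congˡ r′ e) (*ₚ-comm r′ p′)))

    *ₚ-distribˡ : ∀ p r s → p *ₚ (r +ₚ s) ≈ p *ₚ r +ₚ p *ₚ s
    *ₚ-distribˡ p r s = agree λ n → begin
      act (p *ₚ (r +ₚ s)) b n                       ≡⟨ act-* p (r +ₚ s) b n ⟩
      act p (act (r +ₚ s) b) n                      ≡⟨ act-cong p (λ i → trans (act-+ r s b i) (cong (_+ act s b i) (sym (*-identityˡ _)))) n ⟩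
      act p (λ i → 1# * act r b i + act s b i) n    ≡⟨ act-linear p 1# (act r b) (act s b) n ⟩
      1# * act p (act r b) n + act p (act s b) n    ≡⟨ cong (_+ act p (act s b) n) (*-identityˡ _) ⟩
      act p (act r b) n + act p (act s b) n         ≡⟨ cong₂ _+_ (act-* p r b n) (act-* p s b n) ⟨
      act (p *ₚ r) b n + act (p *ₚ s) b n           ≡⟨ act-+ (p *ₚ r) (p *ₚ s) b n ⟨
      act (p *ₚ r +ₚ p *ₚ s) b n                    ∎
      where open ≡-Reasoning

    +ₚ-comm : ∀ p r → p +ₚ r ≈ r +ₚ p
    +ₚ-comm p r = agree λ n → trans (act-+ p r b n) (trans (+-comm _ _) (sym (act-+ r p b n)))

    +ₚ-cong : ∀ {p p′ r r′} → p ≈ p′ → r ≈ r′ → p +ₚ r ≈ p′ +ₚ r′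
    +ₚ-cong {p} {p′} {r} {r′} (agree e) (agree f) = agree λ n →
      trans (act-+ p r b n) (trans (cong₂ _+_ (e n) (f n)) (sym (act-+ p′ r′ b n)))

    p+p≈0 : ∀ p → p +ₚ p ≈ []
    p+p≈0 p = agree λ n → trans (act-+ p p b n) (a+a≡0 _)

    polynomialRing : CommutativeRing 0ℓ 0ℓ
    polynomialRing = record
      { Carrier = Poly ; _≈_ = _≈_ ; _+_ = _+ₚ_ ; _*_ = _*ₚ_ ; -_ = id ; 0# = [] ; 1# = 1ₚ
      ; isCommutativeRing = record
        { isRing = record
          { +-isAbelianGroup = record
            { isGroup = record
              { isMonoid = record
                { isSemigroup = record
                  { isMagma = record
                    { isEquivalence = record
                      { refl = agree λ n → refl
                      ; sym = λ (agree e) → agree λ n → sym (e n)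
                      ; trans = ≈-trans }
                    ; ∙-cong = +ₚ-cong }
                  ; assoc = λ p r s → agree λ n → trans (act-+ (p +ₚ r) s b n) (trans (cong (_+ act s b n) (act-+ p r b n))
                      (trans (+-assoc _ _ _) (sym (trans (act-+ p (r +ₚ s) b n) (cong (act p b n +_) (act-+ r s b n)))))) }
                ; identity = (λ p → agree λ n → trans (act-+ [] p b n) (+-identityˡ _)) ,
                             (λ p → agree λ n → trans (act-+ p [] b n) (+-identityʳ _)) }
              ; inverse = p+p≈0 , p+p≈0
              ; ⁻¹-cong = id }
            ; comm = +ₚ-comm }
          ; *-cong = *ₚ-cong
          ; *-assoc = λ p r s → agree λ n → trans (act-* (p *ₚ r) s b n) (trans (act-* p r (act s b) n)
              (sym (trans (act-* p (r *ₚ s) b n) (act-cong p (act-* r s b) n))))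
          ; *-identity = (λ p → agree λ n → trans (act-* 1ₚ p b n) (act-1 (act p b) n)) ,
                         (λ p → agree λ n → trans (act-* p 1ₚ b n) (act-cong p (act-1 b) n))
          ; distrib = *ₚ-distribˡ , λ p r s → ≈-trans (*ₚ-comm (r +ₚ s) p) (≈-trans (*ₚ-distribˡ p r s)
              (+ₚ-cong (*ₚ-comm p r) (*ₚ-comm p s))) }
        ; *-comm = *ₚ-comm } }

    open CharacteristicTwo polynomialRing (p+p≈0 1ₚ) public
      using (sq; sq-cong; sq-+*; frob; frob-cong; frob-+; frob-frob; frob-fixed⇒regular; pow; frob≈pow; x+y≈0⇒x≈y)

    -- Turns the periodicity of a sequence into the equation X^(2^m) = X.
    act-frob-X : ∀ i a n → act (frob i X) a n ≡ a (n ℕ.+ 2 ^ i)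
    act-frob-X zero a n = trans (act-X a n) (cong a (ℕ.+-comm 1 n))
    act-frob-X (suc i) a n = begin
      act (frob i X *ₚ frob i X) a n            ≡⟨ act-* (frob i X) (frob i X) a n ⟩
      act (frob i X) (act (frob i X) a) n       ≡⟨ act-frob-X i (act (frob i X) a) n ⟩
      act (frob i X) a (n ℕ.+ 2 ^ i)            ≡⟨ act-frob-X i a (n ℕ.+ 2 ^ i) ⟩
      a ((n ℕ.+ 2 ^ i) ℕ.+ 2 ^ i)               ≡⟨ cong a (trans (ℕ.+-assoc n (2 ^ i) (2 ^ i)) (cong (λ e → n ℕ.+ (2 ^ i ℕ.+ e)) (sym (ℕ.+-identityʳ (2 ^ i))))) ⟩
      a (n ℕ.+ 2 ^ suc i)                       ∎
      where open ≡-Reasoning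

    private module K = CommutativeRing polynomialRing

    eval : ∀ {k} → Vec (Fin 2) k → Poly → Poly
    eval [] t = []
    eval (c ∷ v) t = (c ∷ []) +ₚ t *ₚ eval v t

    eval-cong : ∀ {k} (v : Vec (Fin 2) k) {s t} → s ≈ t → eval v s ≈ eval v t
    eval-cong [] s≈t = K.refl
    eval-cong (c ∷ v) s≈t = K.+-congˡ (K.*-cong s≈t (eval-cong v s≈t))

    eval-X : ∀ {k} (v : Vec (Fin 2) k) → eval v X ≈ toList v
    eval-X [] = K.refl
    eval-X (c ∷ v) = agree λ n → begin
      act ((c ∷ []) +ₚ X *ₚ eval v X) b n          ≡⟨ act-+ (c ∷ []) (X *ₚ eval v X) b n ⟩
      (c * b n + 0#) + act (X *ₚ eval v X) b n     ≡⟨ cong₂ _+_ (+-identityʳ _) (trans (act-* X (eval v X) b n) (act-X (act (eval v X) b) n)) ⟩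
      c * b n + act (eval v X) b (suc n)           ≡⟨ cong (c * b n +_) (trans (at (eval-X v) (suc n)) (sym (act-suc (toList v) b n))) ⟩
      c * b n + act (toList v) (b ∘ suc) n         ∎
      where open ≡-Reasoning

    sq-constant : ∀ c → sq (c ∷ []) ≈ c ∷ []
    sq-constant c = agree λ n → trans (act-* (c ∷ []) (c ∷ []) b n)
      (cong (_+ 0#) (trans (cong (c *_) (+-identityʳ (c * b n))) (trans (sym (*-assoc c c (b n))) (cong (_* b n) (a*a≡a c)))))

    -- Squaring is additive and fixes the coefficients 0 and 1. Hence a polynomial over F_2 that
    -- vanishes at t vanishes at all conjugates of t.
    frob-eval : ∀ i {k} (v : Vec (Fin 2) k) t → frob i (eval v t) ≈ eval v (frob i t)
    frob-eval zero v t = K.refl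
    frob-eval (suc i) v t = K.trans (sq-cong (frob-eval i v t)) (sq-eval v (frob i t))
      where
      sq-eval : ∀ {k} (v : Vec (Fin 2) k) t → sq (eval v t) ≈ eval v (sq t)
      sq-eval [] t = K.zeroˡ []
      sq-eval (c ∷ v) t = K.trans (sq-+* (c ∷ []) t (eval v t))
        (K.+-cong (sq-constant c) (*ₚ-congˡ (sq t) (sq-eval v t)))

-- A periodic sequence that generates a simple module.

module SimpleModule (F : FieldOn 2) (m : ℕ) (1≤m : 1 ≤ m) where
  open ShiftAction F public

  abstract
    -- N + 1 is the period 2^m - 1.
    period : ∃ λ N → 2 ^ m ≡ suc (suc N)
    period with 2 ^ m | ℕ.^-monoʳ-≤ 2 1≤m
    ... | suc (suc N) | _ = N , refl
    ... | suc zero | s≤s ()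

  -- Encodes X^(2^m) = X rather than X^(2^m - 1) = 1: the period holds from index 1 on, and the
  -- value at 0 is free.
  Periodic : Seq → Set
  Periodic a = ∀ n → a (n ℕ.+ 2 ^ m) ≡ a (suc n)

  act-periodic : ∀ p {a} → Periodic a → Periodic (act p a)
  act-periodic p {a} per n = trans (act-shift p a (2 ^ m) n) (trans (act-cong p per n) (act-suc p a n))

  -- The index 2^m + i reduces to i + 1, which is smaller because 2^m ≥ 2. Equality and vanishing
  -- thereby become decidable.
  agree-on-period : ∀ {a b} → Periodic a → Periodic b → (∀ {n} → n < 2 ^ m → a n ≡ b n) → a ≐ b
  agree-on-period {a} {b} pa pb eq = <-rec (λ n → a n ≡ b n) step
    where
    step : ∀ n → (∀ {i} → i < n → a i ≡ b i) → a n ≡ b n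
    step n rec with n ℕ.<? 2 ^ m
    ... | yes n<N = eq n<N
    ... | no n≮N with ℕ.m≤n⇒∃[o]m+o≡n (ℕ.≮⇒≥ n≮N)
    ... | i , refl = trans (cong a (ℕ.+-comm (2 ^ m) i)) (trans (pa i) (trans (rec 1+i<) (sym (trans (cong b (ℕ.+-comm (2 ^ m) i)) (pb i)))))
      where
      1+i< : suc i < 2 ^ m ℕ.+ i
      1+i< = subst (λ N → suc i < N ℕ.+ i) (sym (proj₂ period)) (s≤s (s≤s (ℕ.m≤n+m i _)))

  ≐-dec : ∀ {a b} → Periodic a → Periodic b → Dec (a ≐ b)
  ≐-dec {a} {b} pa pb = map′ (agree-on-period pa pb) (λ eq {n} _ → eq n) (ℕ.allUpTo? (λ n → a n ≟ b n) (2 ^ m))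

  Nonzero : Seq → Set
  Nonzero a = ∃ λ n → a n ≢ 0#

  Zero : Seq → Set
  Zero a = ∀ n → a n ≡ 0#

  zero-dec : ∀ {a} → Periodic a → Zero a ⊎ Nonzero a
  zero-dec {a} pa with ℕ.anyUpTo? (λ n → ¬? (a n ≟ 0#)) (2 ^ m)
  ... | yes (n , _ , ≢0) = inj₂ (n , ≢0)
  ... | no none = inj₁ (agree-on-period pa (λ _ → refl) λ {n} n<N →
    decidable-stable (a n ≟ 0#) λ ≢0 → none (n , n<N , ≢0))

  Invertible : Poly → Seq → Set
  Invertible p b = ∃ λ r → act p (act r b) ≐ b

  -- For nonzero b, the module generated by b is simple once every polynomial is settled.
  Settled : Poly → Seq → Set
  Settled p b = Zero (act p b) ⊎ Invertible p b

  record Below (b : Seq) : Set where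
    field
      seq       : Seq
      multiplier : Poly
      seq≐      : seq ≐ act multiplier b
      periodic  : Periodic seq
      nonzero   : Nonzero seq
  open Below

  Invertible-act : ∀ {p b b′} u → b′ ≐ act u b → Invertible p b → Invertible p b′
  Invertible-act {p} {b} {b′} u eq (r , inv) = r , λ n → begin
    act p (act r b′) n           ≡⟨ act-cong p (act-cong r eq) n ⟩
    act p (act r (act u b)) n    ≡⟨ act-cong p (act-comm r u b) n ⟩
    act p (act u (act r b)) n    ≡⟨ act-comm p u (act r b) n ⟩
    act u (act p (act r b)) n    ≡⟨ act-cong u inv n ⟩
    act u b n                    ≡⟨ eq n ⟨
    b′ n                         ∎
    where open ≡-Reasoning

  Zero-act : ∀ {p b b′} u → b′ ≐ act u b → Zero (act p b) → Zero (act p b′)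
  Zero-act {p} {b} u eq z n = trans (act-cong p eq n) (trans (act-comm p u b n) (act-0 u z n))

  -- `u` commutes with everything, so both alternatives survive further cuts; hence polynomials can
  -- be settled one at a time.
  Settled-act : ∀ {p b b′} u → b′ ≐ act u b → Settled p b → Settled p b′
  Settled-act {p} u eq (inj₁ z) = inj₁ (Zero-act {p} u eq z)
  Settled-act {p} u eq (inj₂ i) = inj₂ (Invertible-act {p} u eq i)

  module PeriodicModulo (b : Seq) (per : Periodic b) where
    open Modulo b public
    private module K = CommutativeRing polynomialRing

    X-fixed : frob m X ≈ X
    X-fixed = agree λ n → trans (act-frob-X m b n) (trans (per n) (sym (act-X b n)))

    eval-fromList : ∀ p → eval (Vec.fromList p) X ≈ p
    eval-fromList p = subst (eval (Vec.fromList p) X ≈_) (toList∘fromList p) (eval-X (Vec.fromList p))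

    -- Each p is a polynomial in X over F_2, so `frob m` passes to X, which it fixes.
    frob-fixed : ∀ p → frob m p ≈ p
    frob-fixed p = K.trans (frob-cong m (K.sym (eval-fromList p)))
      (K.trans (frob-eval m (Vec.fromList p) X) (K.trans (eval-cong (Vec.fromList p) X-fixed) (eval-fromList p)))

    regular-≈ : ∀ p → ∃ λ r → p *ₚ (p *ₚ r) ≈ p
    regular-≈ p = frob-fixed⇒regular p 1≤m (frob-fixed p)

    act-regular : ∀ p r → p *ₚ (p *ₚ r) ≈ p → act p (act p (act r b)) ≐ act p b
    act-regular p r e n = begin
      act p (act p (act r b)) n     ≡⟨ act-cong p (act-* p r b) n ⟨
      act p (act (p *ₚ r) b) n      ≡⟨ act-* p (p *ₚ r) b n ⟨
      act (p *ₚ (p *ₚ r)) b n       ≡⟨ at e n ⟩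
      act p b n                     ∎
      where open ≡-Reasoning

    abstract
      regular : ∀ p → ∃ λ r → act p (act p (act r b)) ≐ act p b
      regular p = proj₁ (regular-≈ p) , act-regular p _ (proj₂ (regular-≈ p))

    ≈-dec : ∀ p r → Dec (p ≈ r)
    ≈-dec p r = map′ agree at (≐-dec (act-periodic p per) (act-periodic r per))

  Below-trans : ∀ {b} (B : Below b) → Below (seq B) → Below b
  Below-trans {b} B C = record
    { seq = seq C
    ; multiplier = multiplier C *ₚ multiplier B
    ; seq≐ = λ n → trans (seq≐ C n) (trans (act-cong (multiplier C) (seq≐ B) n) (sym (act-* (multiplier C) (multiplier B) b n)))
    ; periodic = periodic C
    ; nonzero = nonzero C }

  -- Cut b down by the idempotent p r, on whose range p is invertible.
  abstract
    invert : ∀ p {b} → Periodic b → Nonzero (act p b) → Σ (Below b) λ B → Invertible p (seq B)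
    invert p {b} per (i , ≢0) with PeriodicModulo.regular b per p
    ... | r , reg = record
        { seq = act p (act r b)
        ; multiplier = p *ₚ r
        ; seq≐ = λ n → sym (act-* p r b n)
        ; periodic = act-periodic p (act-periodic r per)
        ; nonzero = nz }
      , r , λ n → begin
        act p (act r (act p (act r b))) n    ≡⟨ act-cong p (act-comm r p (act r b)) n ⟩
        act p (act p (act r (act r b))) n    ≡⟨ act-cong p (act-comm p r (act r b)) n ⟩
        act p (act r (act p (act r b))) n    ≡⟨ act-comm p r (act p (act r b)) n ⟩
        act r (act p (act p (act r b))) n    ≡⟨ act-cong r reg n ⟩
        act r (act p b) n                    ≡⟨ act-comm r p b n ⟩
        act p (act r b) n                    ∎
      where
      open ≡-Reasoning
      nz : Nonzero (act p (act r b))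
      nz with zero-dec (act-periodic p (act-periodic r per))
      ... | inj₂ nz = nz
      ... | inj₁ z = ⊥-elim (≢0 (trans (sym (reg i)) (act-0 p z i)))

  abstract
    settle : ∀ p {b} → Periodic b → Nonzero b → Σ (Below b) λ B → Settled p (seq B)
    settle p {b} per nz with zero-dec (act-periodic p per)
    ... | inj₂ pb≢0 with invert p per pb≢0
    ... | B , inv = B , inj₂ inv
    settle p {b} per nz | inj₁ z = record
      { seq = b ; multiplier = 1ₚ ; seq≐ = λ n → sym (act-1 b n) ; periodic = per ; nonzero = nz } , inj₁ z

  abstract
    settleAll : ∀ k (poly : Vec (Fin 2) k → Poly) {b} → Periodic b → Nonzero b →
      Σ (Below b) λ B → ∀ v → Settled (poly v) (seq B)
    settleAll zero poly per nz with settle (poly []) per nz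
    ... | B , s = B , λ { [] → s }
    settleAll (suc k) poly per nz with settleAll k (poly ∘ (0# ∷_)) per nz
    ... | B , s₀ with settleAll k (poly ∘ (1# ∷_)) (periodic B) (nonzero B)
    ... | C , s₁ = Below-trans B C , settled
      where
      settled : ∀ v → Settled (poly v) (seq C)
      settled (c ∷ v) with bit c
      ... | inj₁ refl = Settled-act {poly (0# ∷ v)} (multiplier C) (seq≐ C) (s₀ v)
      ... | inj₂ refl = s₁ v

  -- Every polynomial acts on periodic sequences like one of degree below 2 ^ m, since X ^ (2 ^ m) acts like X.
  splitLast : ∀ {k} → Vec (Fin 2) (suc k) → Vec (Fin 2) k × Fin 2
  splitLast (c ∷ []) = [] , c
  splitLast (c ∷ v@(_ ∷ _)) = c ∷ proj₁ (splitLast v) , proj₂ (splitLast v)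

  act-splitLast : ∀ {k} (v : Vec (Fin 2) (suc k)) a n →
    act (toList v) a n ≡ act (toList (proj₁ (splitLast v))) a n + proj₂ (splitLast v) * a (n ℕ.+ k)
  act-splitLast (c ∷ []) a n = trans (+-comm _ _) (cong (λ i → 0# + c * a i) (sym (ℕ.+-identityʳ n)))
  act-splitLast {suc k} (c ∷ v@(_ ∷ _)) a n = trans (cong (c * a n +_) (act-splitLast v (a ∘ suc) n))
    (trans (sym (+-assoc _ _ _)) (cong (λ i → (c * a n + act (toList (proj₁ (splitLast v))) (a ∘ suc) n) + proj₂ (splitLast v) * a i) (sym (ℕ.+-suc n k))))

  abstract
    reduceLength : ∀ {N} → 2 ^ m ≡ suc (suc N) → ∀ p {b} → Periodic b → ∃ λ (v : Vec (Fin 2) (suc (suc N))) → act p b ≐ act (toList v) b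
    reduceLength {N} eq [] {b} per = replicate _ 0# , λ n → sym (zeros (suc (suc N)) b n)
      where
      zeros : ∀ k a n → act (toList (replicate k 0#)) a n ≡ 0#
      zeros zero a n = refl
      zeros (suc k) a n = trans (cong₂ _+_ (zeroˡ (a n)) (zeros k (a ∘ suc) n)) (+-identityʳ 0#)
    reduceLength {N} eq (c ∷ p) {b} per with reduceLength eq p per
    ... | v , pb with splitLast v | act-splitLast v (b ∘ suc)
    -- Multiplication by X moves the last coefficient `l` to X^(2^m), which acts like X, so it joins
    -- `e`.
    ... | e ∷ u , l | split = c ∷ (e + l) ∷ u , λ n → begin
      c * b n + act p (b ∘ suc) n
        ≡⟨ cong (c * b n +_) (trans (act-suc p b n) (trans (pb (suc n)) (sym (act-suc (toList v) b n)))) ⟩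
      c * b n + act (toList v) (b ∘ suc) n
        ≡⟨ cong (c * b n +_) (split n) ⟩
      c * b n + ((e * b (suc n) + act (toList u) (λ i → b (2 ℕ.+ i)) n) + l * b (suc (n ℕ.+ suc N)))
        ≡⟨ cong (λ x → c * b n + ((e * b (suc n) + act (toList u) (λ i → b (2 ℕ.+ i)) n) + l * x)) (wrap n) ⟩
      c * b n + ((e * b (suc n) + act (toList u) (λ i → b (2 ℕ.+ i)) n) + l * b (suc n))
        ≡⟨ cong (c * b n +_) (solve 4 (λ e x s l → (e :* x :+ s) :+ l :* x := (e :+ l) :* x :+ s) refl e (b (suc n)) (act (toList u) (λ i → b (2 ℕ.+ i)) n) l) ⟩
      c * b n + ((e + l) * b (suc n) + act (toList u) (λ i → b (2 ℕ.+ i)) n) ∎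
      where
      open ≡-Reasoning
      wrap : ∀ n → b (suc (n ℕ.+ suc N)) ≡ b (suc n)
      wrap n = trans (cong b (trans (sym (ℕ.+-suc n (suc N))) (cong (n ℕ.+_) (sym eq)))) (per n)

  abstract
    -- Only the finitely many polynomials with 2^m coefficients have to be settled, because they
    -- represent every action.
    settleEverything : ∀ {b} → Periodic b → Nonzero b → Σ (Below b) λ B → ∀ p → Settled p (seq B)
    settleEverything per nz with settleAll (suc (suc (proj₁ period))) toList per nz
    ... | B , s = B , λ p → transfer p (reduceLength (proj₂ period) p (periodic B))
      where
      transfer : ∀ p → (∃ λ (v : Vec (Fin 2) (suc (suc (proj₁ period)))) → act p (seq B) ≐ act (toList v) (seq B)) → Settled p (seq B)
      transfer p (v , eq) with s v
      ... | inj₁ z = inj₁ λ n → trans (eq n) (z n)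
      ... | inj₂ (r , inv) = inj₂ (r , λ n → begin
        act p (act r (seq B)) n              ≡⟨ act-comm p r (seq B) n ⟩
        act r (act p (seq B)) n              ≡⟨ act-cong r eq n ⟩
        act r (act (toList v) (seq B)) n     ≡⟨ act-comm r (toList v) (seq B) n ⟩
        act (toList v) (act r (seq B)) n     ≡⟨ inv n ⟩
        seq B n                              ∎)
        where open ≡-Reasoning

  indicator : ℕ → Fin 2
  indicator zero = 1#
  indicator (suc _) = 0#

  -- The impulse of period 2 ^ m ∸ 1.
  impulse : Seq
  impulse n = indicator (n % suc (proj₁ period))

  impulse-periodic : Periodic impulse
  impulse-periodic n = trans (cong impulse (trans (cong (n ℕ.+_) (proj₂ period)) (ℕ.+-suc n _)))
    (cong indicator ([m+n]%n≡m%n (suc n) (suc (proj₁ period))))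

  shiftPoly : ℕ → Poly
  shiftPoly zero = 1ₚ
  shiftPoly (suc j) = 0# ∷ shiftPoly j

  act-shiftPoly : ∀ j a n → act (shiftPoly j) a n ≡ a (n ℕ.+ j)
  act-shiftPoly zero a n = trans (act-1 a n) (cong a (sym (ℕ.+-identityʳ n)))
  act-shiftPoly (suc j) a n = trans (cong₂ _+_ (zeroˡ (a n)) (act-shiftPoly j (a ∘ suc) n))
    (trans (+-identityˡ _) (cong a (sym (ℕ.+-suc n j))))

  frobDifference : ℕ → Poly
  frobDifference d = shiftPoly (2 ^ d) +ₚ X

  act-frobDifference : ∀ d a n → act (frobDifference d) a n ≡ a (n ℕ.+ 2 ^ d) + a (suc n)
  act-frobDifference d a n = trans (act-+ (shiftPoly (2 ^ d)) X a n) (cong₂ _+_ (act-shiftPoly (2 ^ d) a n) (act-X a n))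

  -- The product of X^(2^d) - X for 1 ≤ d ≤ i. Once it is invertible for i = m - 1, X cannot lie in
  -- a subfield with 2^d elements, d < m.
  separator : ℕ → Poly
  separator zero = 1ₚ
  separator (suc i) = frobDifference (suc i) *ₚ separator i

  separator-kills : ∀ i d {a} → 1 ≤ d → d ≤ i → Zero (act (frobDifference d) a) → Zero (act (separator i) a)
  separator-kills zero .zero () z≤n z
  separator-kills (suc i) d {a} 1≤d d≤1+i z n with d ℕ.≟ suc i
  ... | yes refl = trans (act-* (frobDifference d) (separator i) a n)
    (trans (act-comm (frobDifference d) (separator i) a n) (act-0 (separator i) z n))
  ... | no d≢ = trans (act-* (frobDifference (suc i)) (separator i) a n)
    (act-0 (frobDifference (suc i)) (separator-kills i d 1≤d (ℕ.≤-pred (ℕ.≤∧≢⇒< d≤1+i d≢)) z) n)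

  -- Reads off a degree: a polynomial of degree e, with e < 2^m - 1, acting on the impulse has its
  -- first 1 at 2^m - 1 - e. Index 0 is left out, because the impulse is 1 there too.
  LeadingAt : Seq → ℕ → Set
  LeadingAt a h = a h ≡ 1# × (∀ {j} → 1 ≤ j → j < h → a j ≡ 0#)

  LeadingAt-cong : ∀ {a b h} → a ≐ b → LeadingAt a h → LeadingAt b h
  LeadingAt-cong eq (a≡1 , a≡0) = trans (sym (eq _)) a≡1 , λ {j} 1≤j j<h → trans (sym (eq j)) (a≡0 1≤j j<h)

  -- X^(2^d) moves the leading index down by 2^d, while X reads a zero, because h + 1 < h + 2^d for
  -- d ≥ 1.
  frobDifference-leading : ∀ {a h} d → 1 ≤ d → 1 ≤ h → LeadingAt a (h ℕ.+ 2 ^ d) → LeadingAt (act (frobDifference d) a) h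
  frobDifference-leading {a} {h} d 1≤d 1≤h (a≡1 , a≡0) =
    trans (act-frobDifference d a h) (trans (cong₂ _+_ a≡1 (a≡0 (s≤s z≤n) 1+h<)) (+-identityʳ 1#)) ,
    λ {j} 1≤j j<h → trans (act-frobDifference d a j)
      (trans (cong₂ _+_ (a≡0 (ℕ.≤-trans 1≤j (ℕ.m≤m+n j _)) (ℕ.+-monoˡ-< (2 ^ d) j<h))
                        (a≡0 (s≤s z≤n) (ℕ.<-trans (s≤s j<h) 1+h<))) (+-identityʳ 0#))
    where
    1+h< : suc h < h ℕ.+ 2 ^ d
    1+h< = subst (_≤ h ℕ.+ 2 ^ d) (ℕ.+-comm h 2) (ℕ.+-monoʳ-≤ h (ℕ.^-monoʳ-≤ 2 1≤d))

  -- The degree of the separator is 2 + 4 + ... + 2 ^ i = 2 ^ (1 + i) ∸ 2.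
  separator-leading : ∀ i → suc i ≤ m → ∃ λ h → 1 ≤ h × h ℕ.+ 2 ^ suc i ≡ suc (2 ^ m) × LeadingAt (act (separator i) impulse) h
  separator-leading zero _ = suc N , s≤s z≤n , h+2≡ ,
    trans (act-1 impulse (suc N)) at-N , λ {j} 1≤j j<h → trans (act-1 impulse j) (below 1≤j j<h)
    where
    N = proj₁ period
    h+2≡ : suc N ℕ.+ 2 ≡ suc (2 ^ m)
    h+2≡ = trans (ℕ.+-comm (suc N) 2) (cong suc (sym (proj₂ period)))
    at-N : impulse (suc N) ≡ 1#
    at-N = cong indicator (n%n≡0 (suc N))
    below : ∀ {j} → 1 ≤ j → j < suc N → impulse j ≡ 0#
    below {suc j} _ j<N = cong indicator (m<n⇒m%n≡m j<N)
  separator-leading (suc i) 2+i≤m with separator-leading i (ℕ.<⇒≤ 2+i≤m)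
  ... | h , 1≤h , h+≡ , leading = h′ , 1≤h′ , h′+≡ ,
      LeadingAt-cong (λ n → sym (act-* (frobDifference (suc i)) (separator i) impulse n)) (frobDifference-leading (suc i) (s≤s z≤n) 1≤h′ (subst (LeadingAt _) (sym h′+D≡h) leading))
    where
    D = 2 ^ suc i
    -- There is room for one more factor, since h + D = 2^m + 1 and 2 D ≤ 2^m.
    1+D≤h : suc D ≤ h
    1+D≤h = ℕ.+-cancelʳ-≤ D (suc D) h (subst (suc D ℕ.+ D ≤_) (sym h+≡)
      (s≤s (subst (_≤ 2 ^ m) (cong (D ℕ.+_) (ℕ.+-identityʳ D)) (ℕ.^-monoʳ-≤ 2 2+i≤m))))
    h′ = h ℕ.∸ D
    h′+D≡h : h′ ℕ.+ D ≡ h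
    h′+D≡h = ℕ.m∸n+n≡m (ℕ.<⇒≤ 1+D≤h)
    1≤h′ : 1 ≤ h′
    1≤h′ = ℕ.m<n⇒0<n∸m 1+D≤h
    h′+≡ : h′ ℕ.+ 2 ^ suc (suc i) ≡ suc (2 ^ m)
    h′+≡ = trans (cong (λ e → h′ ℕ.+ (D ℕ.+ e)) (ℕ.+-identityʳ D)) (trans (sym (ℕ.+-assoc h′ D D)) (trans (cong (ℕ._+ D) h′+D≡h) h+≡))

  record SimpleSequence : Set where
    field
      base      : Seq
      base-periodic : Periodic base
      base-nonzero  : Nonzero base
      settled   : ∀ p → Settled p base
      separated : ∀ d → 1 ≤ d → d < m → ¬ Zero (act (frobDifference d) base)

  abstract
    -- For i = m - 1 the leading index is 1, so the separator does not kill the impulse. It is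
    -- inverted first, and its invertibility is inherited by all later cuts.
    simpleSequence : SimpleSequence
    simpleSequence with separator-leading (ℕ.pred m) (ℕ.≤-reflexive (ℕ.suc-pred m {{ℕ.>-nonZero 1≤m}}))
    ... | h , _ , _ , (eq , _) with invert (separator (ℕ.pred m)) impulse-periodic (h , λ ≡0 → 0≢1 (trans (sym ≡0) eq))
    ... | B , inv with settleEverything (periodic B) (nonzero B)
    ... | C , settledC = record
      { base = seq C
      ; base-periodic = periodic C
      ; base-nonzero = nonzero C
      ; settled = settledC
      ; separated = λ d 1≤d d<m z → Zero⇒¬Invertible {separator (ℕ.pred m)} (nonzero C)
          (separator-kills (ℕ.pred m) d 1≤d (ℕ.≤-pred (subst (suc d ≤_) (sym (ℕ.suc-pred m {{ℕ.>-nonZero 1≤m}})) d<m)) z)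
          (Invertible-act {separator (ℕ.pred m)} (multiplier C) (seq≐ C) inv)
      }
      where
      Zero⇒¬Invertible : ∀ {p b} → Nonzero b → Zero (act p b) → ¬ Invertible p b
      Zero⇒¬Invertible {p} {b} (n , b≢0) z (r , inv) = b≢0 (trans (sym (inv n)) (trans (act-comm p r b n) (act-0 r z n)))

-- The field with 2^m elements, on the additive group of F_2^m.

record BinaryField (F : FieldOn 2) (m : ℕ) : Set₁ where
  infixl 7 _·_
  field
    _·_               : Pt F m → Pt F m → Pt F m
    one               : Pt F m
    isCommutativeRing : IsCommutativeRing _≡_ (_⊕_ F) _·_ id (𝟎 F m) one
    one≢0             : one ≢ 𝟎 F m
    inverse           : ∀ v → v ≢ 𝟎 F m → ∃ λ w → v · w ≡ one
    frobenius-fixed   : ∀ v → fold v (λ u → u · u) m ≡ v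
    generator         : Pt F m
    generator≢0       : 2 ≤ m → generator ≢ 𝟎 F m
    generated         : (P : Pt F m → Set) → P (𝟎 F m) → (∀ {u v} → P u → P v → P (_⊕_ F u v)) →
      (∀ {v} → P v → P (generator · v)) → ∀ {w} → w ≢ 𝟎 F m → P w → ∀ v → P v

module GaloisField (F : FieldOn 2) (m : ℕ) (1≤m : 1 ≤ m) where
  open SimpleModule F m 1≤m
  open SimpleSequence simpleSequence renaming (base to b)
  open PeriodicModulo b base-periodic
  private module K = CommutativeRing polynomialRing

  1≉0 : ¬ 1ₚ ≈ []
  1≉0 (agree e) = proj₂ base-nonzero (trans (sym (act-1 b _)) (e (proj₁ base-nonzero)))

  unit : ∀ p → p ≈ [] ⊎ ∃ λ r → p *ₚ r ≈ 1ₚ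
  unit p with settled p
  ... | inj₁ z = inj₁ (agree z)
  ... | inj₂ (r , inv) = inj₂ (r , agree λ n → trans (act-* p r b n) (trans (inv n) (sym (act-1 b n))))

  integral : ∀ {p r} → p *ₚ r ≈ [] → p ≈ [] ⊎ r ≈ []
  integral {p} {r} pr≈0 with unit p
  ... | inj₁ p≈0 = inj₁ p≈0
  ... | inj₂ (s , ps≈1) = inj₂ (begin
    r               ≈⟨ K.*-identityˡ r ⟨
    1ₚ *ₚ r         ≈⟨ *ₚ-cong ps≈1 (K.refl {r}) ⟨
    p *ₚ s *ₚ r     ≈⟨ *ₚ-cong (*ₚ-comm p s) (K.refl {r}) ⟩
    s *ₚ p *ₚ r     ≈⟨ K.*-assoc s p r ⟩
    s *ₚ (p *ₚ r)   ≈⟨ *ₚ-congˡ s pr≈0 ⟩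
    s *ₚ []         ≈⟨ K.zeroʳ s ⟩
    []              ∎)
    where open Relation.Binary.Reasoning.Setoid K.setoid

  open RootCounting polynomialRing 1≉0 integral

  frob-0 : ∀ i → frob i [] ≈ []
  frob-0 zero = K.refl
  frob-0 (suc i) = K.trans (sq-cong (frob-0 i)) (K.zeroˡ [])

  frob-kernel : ∀ i {p} → frob i p ≈ [] → p ≈ []
  frob-kernel zero eq = eq
  frob-kernel (suc i) {p} eq with integral {frob i p} {frob i p} eq
  ... | inj₁ eq′ = frob-kernel i eq′
  ... | inj₂ eq′ = frob-kernel i eq′

  -- Frobenius is additive and injective, so a coincidence cancels down to X = X^(2^(j - i)), which
  -- `separated` excludes.
  conjugates-distinct : ∀ {i j} → i < j → j < m → ¬ frob i X ≈ frob j X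
  conjugates-distinct {i} {j} i<j j<m eq with ℕ.m≤n⇒∃[o]m+o≡n i<j
  ... | e , refl = separated (suc e) (s≤s z≤n) (ℕ.≤-<-trans (ℕ.≤-trans (s≤s (ℕ.m≤n+m e i)) ℕ.≤-refl) j<m) λ n →
      trans (act-frobDifference (suc e) b n) (trans (cong₂ _+_ (trans (sym (act-frob-X (suc e) b n)) (trans (sym (at X≈ n)) (act-X b n))) refl) (a+a≡0 _))
    where
    open Relation.Binary.Reasoning.Setoid K.setoid
    X≈ : X ≈ frob (suc e) X
    X≈ = x+y≈0⇒x≈y (frob-kernel i (begin
      frob i (X +ₚ frob (suc e) X)              ≈⟨ frob-+ i X (frob (suc e) X) ⟩
      frob i X +ₚ frob i (frob (suc e) X)       ≈⟨ +ₚ-cong eq (frob-frob i (suc e) X) ⟩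
      frob (suc i ℕ.+ e) X +ₚ frob (i ℕ.+ suc e) X  ≈⟨ +ₚ-cong (K.reflexive (cong (λ k → frob k X) (sym (ℕ.+-suc i e)))) (K.refl {frob (i ℕ.+ suc e) X}) ⟩
      frob (i ℕ.+ suc e) X +ₚ frob (i ℕ.+ suc e) X  ≈⟨ p+p≈0 (frob (i ℕ.+ suc e) X) ⟩
      []                                        ∎))

  -- If X killed b, then so would X² - X, against `separated` at d = 1 < m.
  X≉0 : 2 ≤ m → ¬ X ≈ []
  X≉0 2≤m (agree e) = separated 1 (s≤s z≤n) 2≤m λ n → trans (act-frobDifference 1 b n)
    (trans (cong₂ _+_ (trans (cong b (ℕ.+-comm n 2)) (b≡0 (suc n))) (b≡0 n)) (+-identityʳ 0#))
    where
    b≡0 : ∀ n → b (suc n) ≡ 0#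
    b≡0 n = trans (sym (act-X b n)) (e n)

  constants : ∀ {k} → Vec (Fin 2) k → Vec Poly k
  constants = Vec.map (_∷ [])

  eval-zeros : ∀ k t → eval (replicate k 0#) t ≈ []
  eval-zeros zero t = K.refl
  eval-zeros (suc k) t = K.trans (+ₚ-cong (agree λ n → trans (+-identityʳ _) (zeroˡ (b n))) (K.trans (*ₚ-congˡ t (eval-zeros k t)) (K.zeroʳ t))) (K.+-identityˡ [])

  -- Drops vanishing high coefficients; over F_2 the highest remaining one is automatically 1.
  monicForm : ∀ {k} (v : Vec (Fin 2) k) → v ≡ replicate k 0# ⊎
    ∃ λ d → d < k × Σ (Vec (Fin 2) d) λ cs → ∀ t → eval v t ≈ monic (constants cs) t
  monicForm [] = inj₁ refl
  monicForm {suc k} (c ∷ v) with monicForm v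
  ... | inj₂ (d , d<k , cs , eq) = inj₂ (suc d , s≤s d<k , c ∷ cs , λ t → +ₚ-cong (K.refl {c ∷ []}) (*ₚ-congˡ t (eq t)))
  ... | inj₁ refl with bit c
  ... | inj₁ refl = inj₁ refl
  ... | inj₂ refl = inj₂ (0 , s≤s z≤n , [] , λ t →
    K.trans (+ₚ-cong (K.refl {1ₚ}) (K.trans (*ₚ-congˡ t (eval-zeros k t)) (K.zeroʳ t))) (K.+-identityʳ 1ₚ))

  -- A nonzero polynomial of degree below m cannot vanish at the m conjugates of X.
  toList-kernel : ∀ (v : Vec (Fin 2) m) → toList v ≈ [] → v ≡ replicate m 0#
  toList-kernel v v≈0 with monicForm v
  ... | inj₁ v≡0 = v≡0
  ... | inj₂ (d , d<m , cs , eq) = ⊥-elim (too-many-roots (constants cs) (λ i → frob (toℕ i) X) distinct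
      λ i → K.trans (K.sym (eq (frob (toℕ i) X))) (K.trans (K.sym (frob-eval (toℕ i) v X))
        (K.trans (frob-cong (toℕ i) (K.trans (eval-X v) v≈0)) (frob-0 (toℕ i)))))
    where
    distinct : ∀ {i j : Fin (suc d)} → frob (toℕ i) X ≈ frob (toℕ j) X → i ≡ j
    distinct {i} {j} eq with ℕ.<-cmp (toℕ i) (toℕ j)
    ... | tri< i<j _ _ = ⊥-elim (conjugates-distinct i<j (ℕ.≤-trans (toℕ<n j) d<m) eq)
    ... | tri≈ _ i≡j _ = toℕ-injective i≡j
    ... | tri> _ _ j<i = ⊥-elim (conjugates-distinct j<i (ℕ.≤-trans (toℕ<n i) d<m) (K.sym eq))

  toList-+ : ∀ {k} (u v : Vec (Fin 2) k) → toList (u +ᵥ v) ≈ toList u +ₚ toList v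
  toList-+ u v = agree λ n → trans (act-toList-+ u v b n) (sym (act-+ (toList u) (toList v) b n))
    where
    act-toList-+ : ∀ {k} (u v : Vec (Fin 2) k) a n → act (toList (u +ᵥ v)) a n ≡ act (toList u) a n + act (toList v) a n
    act-toList-+ [] [] a n = sym (+-identityʳ 0#)
    act-toList-+ (c ∷ u) (d ∷ v) a n = trans (cong ((c + d) * a n +_) (act-toList-+ u v (a ∘ suc) n))
      (solve 5 (λ c d a x y → (c :+ d) :* a :+ (x :+ y) := (c :* a :+ x) :+ (d :* a :+ y)) refl
        c d (a n) (act (toList u) (a ∘ suc) n) (act (toList v) (a ∘ suc) n))

  toList-injective : ∀ (u v : Vec (Fin 2) m) → toList u ≈ toList v → u ≡ v
  toList-injective u v eq = v+w≡0⇒v≡w u v (toList-kernel (u +ᵥ v)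
    (K.trans (toList-+ u v) (K.trans (+ₚ-cong eq (K.refl {toList v})) (p+p≈0 (toList v)))))

  -- Otherwise T ^ (2 ^ m) + T would have 2 ^ m + 1 roots.
  toList-surjective : ∀ p → ∃ λ (v : Vec (Fin 2) m) → toList v ≈ p
  toList-surjective p with anyVec? m (λ v → ≈-dec (toList v) p)
  ... | yes found = found
  ... | no none = ⊥-elim (too-many-roots coefficients xs xs-distinct λ i → K.trans (value (xs i))
      (K.trans (+ₚ-cong (K.refl {xs i}) (frob-fixed (xs i))) (p+p≈0 (xs i))))
    where
    N = proj₁ period
    coefficients : Vec Poly (suc (suc N))
    -- T plus the implicit leading term T^(N + 2) = T^(2^m).
    coefficients = [] ∷ 1ₚ ∷ replicate N []
    monic-zeros : ∀ k t → monic (replicate k []) t ≈ pow t k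
    monic-zeros zero t = K.refl
    monic-zeros (suc k) t = K.trans (K.+-identityˡ _) (*ₚ-congˡ t (monic-zeros k t))
    value : ∀ t → monic coefficients t ≈ t +ₚ frob m t
    value t = begin
      [] +ₚ t *ₚ (1ₚ +ₚ t *ₚ monic (replicate N []) t)   ≈⟨ K.+-identityˡ _ ⟩
      t *ₚ (1ₚ +ₚ t *ₚ monic (replicate N []) t)   ≈⟨ *ₚ-distribˡ t 1ₚ _ ⟩
      t *ₚ 1ₚ +ₚ t *ₚ (t *ₚ monic (replicate N []) t)
        ≈⟨ +ₚ-cong (K.*-identityʳ t) (*ₚ-congˡ t (*ₚ-congˡ t (monic-zeros N t))) ⟩
      t +ₚ pow t (suc (suc N))
        ≈⟨ +ₚ-cong (K.refl {t}) (K.trans (K.reflexive (cong (pow t) (sym (proj₂ period)))) (K.sym (frob≈pow m t))) ⟩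
      t +ₚ frob m t ∎
      where open Relation.Binary.Reasoning.Setoid K.setoid
    xs : Fin (suc (suc (suc N))) → Poly
    xs zero = p
    xs (suc i) = toList (decode m (subst Fin (sym (proj₂ period)) i))
    xs-distinct : ∀ {i j} → xs i ≈ xs j → i ≡ j
    xs-distinct {zero} {zero} eq = refl
    xs-distinct {zero} {suc j} eq = ⊥-elim (none (_ , K.sym eq))
    xs-distinct {suc i} {zero} eq = ⊥-elim (none (_ , eq))
    xs-distinct {suc i} {suc j} eq = cong suc (subst-injective (sym (proj₂ period)) (decode-injective m (toList-injective _ _ eq)))
      where
      subst-injective : ∀ {k l} (e : k ≡ l) {i j : Fin k} → subst Fin e i ≡ subst Fin e j → i ≡ j
      subst-injective refl eq = eq

  abstract
    fromPoly : Poly → V m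
    fromPoly p = proj₁ (toList-surjective p)

    toList-fromPoly : ∀ p → toList (fromPoly p) ≈ p
    toList-fromPoly p = proj₂ (toList-surjective p)

  toList-cong : ∀ {u v : V m} → u ≡ v → toList u ≈ toList v
  toList-cong refl = K.refl

  fromPoly-toList : ∀ (v : V m) {p} → p ≈ toList v → fromPoly p ≡ v
  fromPoly-toList v eq = toList-injective _ v (K.trans (toList-fromPoly _) eq)

  toList-0 : toList (0ᵥ {m}) ≈ []
  toList-0 = K.trans (K.sym (eval-X 0ᵥ)) (eval-zeros m X)

  infixl 7 _·_
  _·_ : V m → V m → V m
  u · v = fromPoly (toList u *ₚ toList v)

  toList-· : ∀ u v → toList (u · v) ≈ toList u *ₚ toList v
  toList-· u v = toList-fromPoly (toList u *ₚ toList v)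

  one : V m
  one = fromPoly 1ₚ

  ·-comm : ∀ u v → u · v ≡ v · u
  ·-comm u v = fromPoly-toList (v · u) (K.trans (*ₚ-comm (toList u) (toList v)) (K.sym (toList-· v u)))

  ·-assoc : ∀ u v w → (u · v) · w ≡ u · (v · w)
  ·-assoc u v w = fromPoly-toList (u · (v · w)) (begin
    toList (u · v) *ₚ toList w             ≈⟨ *ₚ-cong (toList-· u v) (K.refl {toList w}) ⟩
    toList u *ₚ toList v *ₚ toList w       ≈⟨ K.*-assoc (toList u) (toList v) (toList w) ⟩
    toList u *ₚ (toList v *ₚ toList w)     ≈⟨ *ₚ-congˡ (toList u) (toList-· v w) ⟨
    toList u *ₚ toList (v · w)             ≈⟨ toList-· u (v · w) ⟨
    toList (u · (v · w))                   ∎)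
    where open Relation.Binary.Reasoning.Setoid K.setoid

  ·-identityˡ : ∀ v → one · v ≡ v
  ·-identityˡ v = fromPoly-toList v (K.trans (*ₚ-cong (toList-fromPoly 1ₚ) (K.refl {toList v})) (K.*-identityˡ (toList v)))

  ·-distribˡ : ∀ u v w → u · (v +ᵥ w) ≡ u · v +ᵥ u · w
  ·-distribˡ u v w = fromPoly-toList (u · v +ᵥ u · w) (begin
    toList u *ₚ toList (v +ᵥ w)                     ≈⟨ *ₚ-congˡ (toList u) (toList-+ v w) ⟩
    toList u *ₚ (toList v +ₚ toList w)              ≈⟨ *ₚ-distribˡ (toList u) (toList v) (toList w) ⟩
    toList u *ₚ toList v +ₚ toList u *ₚ toList w    ≈⟨ +ₚ-cong (toList-· u v) (toList-· u w) ⟨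
    toList (u · v) +ₚ toList (u · w)                ≈⟨ toList-+ (u · v) (u · w) ⟨
    toList (u · v +ᵥ u · w)                         ∎)
    where open Relation.Binary.Reasoning.Setoid K.setoid

  ·-isCommutativeRing : IsCommutativeRing _≡_ _+ᵥ_ _·_ id (0ᵥ {m}) one
  ·-isCommutativeRing = record
    { isRing = record
      { +-isAbelianGroup = record
        { isGroup = record
          { isMonoid = record
            { isSemigroup = record
              { isMagma = record { isEquivalence = isEquivalence ; ∙-cong = cong₂ _+ᵥ_ }
              ; assoc = +ᵥ-assoc }
            ; identity = +ᵥ-identityˡ , +ᵥ-identityʳ }
          ; inverse = v+v≡0 , v+v≡0
          ; ⁻¹-cong = id }
        ; comm = +ᵥ-comm }
      ; *-cong = cong₂ _·_
      ; *-assoc = ·-assoc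
      ; *-identity = ·-identityˡ , λ v → trans (·-comm v one) (·-identityˡ v)
      ; distrib = ·-distribˡ , λ u v w → trans (·-comm (v +ᵥ w) u) (trans (·-distribˡ u v w) (cong₂ _+ᵥ_ (·-comm u v) (·-comm u w))) }
    ; *-comm = ·-comm }

  ·-inverse : ∀ v → v ≢ 0ᵥ → ∃ λ w → v · w ≡ one
  ·-inverse v v≢0 = inv (unit (toList v))
    where
    inv : (toList v ≈ [] ⊎ ∃ λ r → toList v *ₚ r ≈ 1ₚ) → ∃ λ w → v · w ≡ one
    inv (inj₁ v≈0) = ⊥-elim (v≢0 (toList-kernel v v≈0))
    inv (inj₂ (r , vr≈1)) = fromPoly r , fromPoly-toList one
      (K.trans (*ₚ-congˡ (toList v) (toList-fromPoly r)) (K.trans vr≈1 (K.sym (toList-fromPoly 1ₚ))))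

  toList-frobenius : ∀ i v → toList (fold v (λ u → u · u) i) ≈ frob i (toList v)
  toList-frobenius zero v = K.refl
  toList-frobenius (suc i) v = K.trans (toList-· _ _) (sq-cong (toList-frobenius i v))

  -- Every v equals (v w⁻¹) w, and v w⁻¹ is a polynomial in X; Horner's rule builds the product from
  -- the closure properties.
  generated : (P : V m → Set) → P 0ᵥ → (∀ {u v} → P u → P v → P (u +ᵥ v)) →
    (∀ {v} → P v → P (fromPoly X · v)) → ∀ {w} → w ≢ 0ᵥ → P w → ∀ v → P v
  generated P P0 P+ P· {w} w≢0 Pw v = subst P multiple (multiples (toList (v · w⁻¹)))
    where
    w⁻¹ = proj₁ (·-inverse w w≢0)
    multiple : fromPoly (toList (v · w⁻¹)) · w ≡ v
    multiple = begin
      fromPoly (toList (v · w⁻¹)) · w  ≡⟨ cong (_· w) (fromPoly-toList (v · w⁻¹) K.refl) ⟩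
      (v · w⁻¹) · w                    ≡⟨ ·-assoc v w⁻¹ w ⟩
      v · (w⁻¹ · w)                    ≡⟨ cong (v ·_) (trans (·-comm w⁻¹ w) (proj₂ (·-inverse w w≢0))) ⟩
      v · one                          ≡⟨ trans (·-comm v one) (·-identityˡ v) ⟩
      v                                ∎
      where open ≡-Reasoning
    multiples : ∀ p → P (fromPoly p · w)
    multiples [] = subst P (sym (toList-injective _ _ (K.trans (toList-· (fromPoly []) w)
      (K.trans (*ₚ-cong (toList-fromPoly []) (K.refl {toList w})) (K.trans (K.zeroˡ (toList w)) (K.sym toList-0)))))) P0
    multiples (c ∷ p) = subst P (sym split) (P+ (constant c) (P· (multiples p)))
      where
      open Relation.Binary.Reasoning.Setoid K.setoid
      constant : ∀ c → P (fromPoly (c ∷ []) · w)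
      constant c with bit c
      ... | inj₂ refl = subst P (sym (·-identityˡ w)) Pw
      ... | inj₁ refl = subst P (cong (_· w) (toList-injective _ _ (K.trans (toList-fromPoly [])
        (K.trans (agree λ n → sym (trans (+-identityʳ _) (zeroˡ (b n)))) (K.sym (toList-fromPoly (0# ∷ []))))))) (multiples [])
      c∷p≈ : c ∷ p ≈ (c ∷ []) +ₚ X *ₚ p
      c∷p≈ = K.trans (K.sym (eval-fromList (c ∷ p))) (+ₚ-cong (K.refl {c ∷ []}) (*ₚ-congˡ X (eval-fromList p)))
      split : fromPoly (c ∷ p) · w ≡ fromPoly (c ∷ []) · w +ᵥ fromPoly X · (fromPoly p · w)
      split = toList-injective _ _ (begin
        toList (fromPoly (c ∷ p) · w)
          ≈⟨ K.trans (toList-· (fromPoly (c ∷ p)) w) (*ₚ-cong (K.trans (toList-fromPoly (c ∷ p)) c∷p≈) (K.refl {toList w})) ⟩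
        ((c ∷ []) +ₚ X *ₚ p) *ₚ toList w
          ≈⟨ K.distribʳ (toList w) (c ∷ []) (X *ₚ p) ⟩
        (c ∷ []) *ₚ toList w +ₚ X *ₚ p *ₚ toList w
          ≈⟨ +ₚ-cong (*ₚ-cong (toList-fromPoly (c ∷ [])) (K.refl {toList w})) (K.sym (K.*-assoc X p (toList w))) ⟨
        toList (fromPoly (c ∷ [])) *ₚ toList w +ₚ X *ₚ (p *ₚ toList w)
          ≈⟨ +ₚ-cong (toList-· (fromPoly (c ∷ [])) w) (*ₚ-cong (toList-fromPoly X) (*ₚ-cong (toList-fromPoly p) (K.refl {toList w}))) ⟨
        toList (fromPoly (c ∷ []) · w) +ₚ toList (fromPoly X) *ₚ (toList (fromPoly p) *ₚ toList w)
          ≈⟨ +ₚ-cong (K.refl {toList (fromPoly (c ∷ []) · w)}) (*ₚ-congˡ (toList (fromPoly X)) (toList-· (fromPoly p) w)) ⟨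
        toList (fromPoly (c ∷ []) · w) +ₚ toList (fromPoly X) *ₚ toList (fromPoly p · w)
          ≈⟨ +ₚ-cong (K.refl {toList (fromPoly (c ∷ []) · w)}) (toList-· (fromPoly X) (fromPoly p · w)) ⟨
        toList (fromPoly (c ∷ []) · w) +ₚ toList (fromPoly X · (fromPoly p · w))
          ≈⟨ toList-+ (fromPoly (c ∷ []) · w) (fromPoly X · (fromPoly p · w)) ⟨
        toList (fromPoly (c ∷ []) · w +ᵥ fromPoly X · (fromPoly p · w)) ∎)

  abstract
    binaryField : BinaryField F m
    binaryField = record
      { _·_ = _·_
      ; one = one
      ; isCommutativeRing = ·-isCommutativeRing
      ; one≢0 = λ eq → 1≉0 (K.trans (K.sym (toList-fromPoly 1ₚ)) (K.trans (toList-cong eq) toList-0))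
      ; inverse = ·-inverse
      ; frobenius-fixed = λ v → toList-injective _ v (K.trans (toList-frobenius m v) (frob-fixed (toList v)))
      ; generator = fromPoly X
      ; generator≢0 = λ 2≤m eq → X≉0 2≤m (K.trans (K.sym (toList-fromPoly X)) (K.trans (toList-cong eq) toList-0))
      ; generated = generated
      }

-- Inversion in the field and the flats that it breaks.

module InverseMap (F : FieldOn 2) (m : ℕ) (BF : BinaryField F m) where
  open SlicewiseImage F hiding (inverse; ring; solve; _:=_; _:+_; _:*_; :-_)
  open Binary F using (bit; v+v≡0; v+w≡0⇒v≡w)
  open BinaryField BF public using (_·_; one; one≢0; inverse; frobenius-fixed; generator; generator≢0; generated)

  L : CommutativeRing 0ℓ 0ℓ
  L = record { isCommutativeRing = BinaryField.isCommutativeRing BF }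

  open CommutativeRing L using () renaming (*-assoc to ·-assoc; *-comm to ·-comm; *-identityˡ to ·-identityˡ;
    *-identityʳ to ·-identityʳ; distribˡ to ·-distribˡ; zeroˡ to ·-zeroˡ; zeroʳ to ·-zeroʳ)
  open CharacteristicTwo L (v+v≡0 one) using (solve; _:=_; _:+_; _:*_)
  open ≡-Reasoning

  ·-integral : ∀ {u v} → u · v ≡ 0ᵥ → u ≡ 0ᵥ ⊎ v ≡ 0ᵥ
  ·-integral {u} {v} uv≡0 with u ≟ᵥ 0ᵥ
  ... | yes u≡0 = inj₁ u≡0
  ... | no u≢0 with inverse u u≢0
  ... | w , uw≡1 = inj₂ (begin
    v              ≡⟨ ·-identityˡ v ⟨
    one · v        ≡⟨ cong (_· v) uw≡1 ⟨
    u · w · v      ≡⟨ solve 3 (λ u w v → u :* w :* v := w :* (u :* v)) refl u w v ⟩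
    w · (u · v)    ≡⟨ cong (w ·_) uv≡0 ⟩
    w · 0ᵥ         ≡⟨ ·-zeroʳ w ⟩
    0ᵥ             ∎)

  ·-nonzero : ∀ {u v} → u ≢ 0ᵥ → v ≢ 0ᵥ → u · v ≢ 0ᵥ
  ·-nonzero u≢0 v≢0 uv≡0 with ·-integral uv≡0
  ... | inj₁ u≡0 = u≢0 u≡0
  ... | inj₂ v≡0 = v≢0 v≡0

  inv : V m → V m
  inv v with v ≟ᵥ 0ᵥ
  ... | yes _ = 0ᵥ
  ... | no v≢0 = proj₁ (inverse v v≢0)

  inv-0 : inv 0ᵥ ≡ 0ᵥ
  inv-0 with 0ᵥ {m} ≟ᵥ 0ᵥ
  ... | yes _ = refl
  ... | no 0≢0 = ⊥-elim (0≢0 refl)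

  ·-inv : ∀ {v} → v ≢ 0ᵥ → v · inv v ≡ one
  ·-inv {v} v≢0 with v ≟ᵥ 0ᵥ
  ... | yes v≡0 = ⊥-elim (v≢0 v≡0)
  ... | no v≢0′ = proj₂ (inverse v v≢0′)

  inv-involutive : ∀ v → inv (inv v) ≡ v
  inv-involutive v with v ≟ᵥ 0ᵥ
  ... | yes refl = inv-0
  ... | no v≢0′ = begin
    inv w                  ≡⟨ ·-identityˡ (inv w) ⟨
    one · inv w            ≡⟨ cong (_· inv w) vw≡1 ⟨
    v · w · inv w          ≡⟨ ·-assoc v w (inv w) ⟩
    v · (w · inv w)        ≡⟨ cong (v ·_) (·-inv w≢0) ⟩
    v · one                ≡⟨ ·-identityʳ v ⟩
    v                      ∎
    where
    w = proj₁ (inverse v v≢0′)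
    vw≡1 : v · w ≡ one
    vw≡1 = proj₂ (inverse v v≢0′)
    w≢0 : w ≢ 0ᵥ
    w≢0 eq = one≢0 (trans (sym vw≡1) (trans (cong (v ·_) eq) (·-zeroʳ v)))

  inv-perm : Perm inv
  inv-perm = Perm-inverse inv inv-involutive inv-involutive

  scaledInv-perm : ∀ {d} → d ≢ 0ᵥ → Perm (λ v → d · inv v)
  scaledInv-perm {d} d≢0 = Perm-∘ inv-perm (Perm-inverse (inv d ·_) (cancel (trans (·-comm (inv d) d) (·-inv d≢0))) (cancel (·-inv d≢0)))
    where
    cancel : ∀ {a b} → a · b ≡ one → ∀ v → a · (b · v) ≡ v
    cancel {a} {b} ab≡1 v = trans (sym (·-assoc a b v)) (trans (cong (_· v) ab≡1) (·-identityˡ v))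

  enumeration : ∀ k → List (V k)
  enumeration zero = [] ∷ []
  enumeration (suc k) = List.map (0# ∷_) (enumeration k) ++ List.map (1# ∷_) (enumeration k)

  enumeration-complete : ∀ {k} (as : V k) → as ∈ enumeration k
  enumeration-complete [] = here refl
  enumeration-complete (a ∷ as) with bit a
  ... | inj₁ refl = ∈-++⁺ˡ (∈-map⁺ (0# ∷_) (enumeration-complete as))
  ... | inj₂ refl = ∈-++⁺ʳ _ (∈-map⁺ (1# ∷_) (enumeration-complete as))

  enumeration-unique : ∀ k → Unique (enumeration k)
  enumeration-unique zero = [] ∷ []
  enumeration-unique (suc k) = Unique.++⁺ (Unique.map⁺ ∷-injectiveʳ (enumeration-unique k))
    (Unique.map⁺ ∷-injectiveʳ (enumeration-unique k)) λ (p , r) → disjoint (∈-map⁻ (0# ∷_) p) (∈-map⁻ (1# ∷_) r)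
    where
    disjoint : ∀ {v} → (∃ λ as → as ∈ enumeration k × v ≡ 0# ∷ as) → ¬ (∃ λ as → as ∈ enumeration k × v ≡ 1# ∷ as)
    disjoint (_ , _ , refl) (_ , _ , eq) = 0≢1 (∷-injectiveˡ eq)

  total : List (V m) → V m
  total = foldr _+ᵥ_ 0ᵥ

  total-++ : ∀ us vs → total (us ++ vs) ≡ total us +ᵥ total vs
  total-++ [] vs = sym (+ᵥ-identityˡ _)
  total-++ (u ∷ us) vs = trans (cong (u +ᵥ_) (total-++ us vs)) (sym (+ᵥ-assoc u _ _))

  total-↭ : ∀ {us vs} → us ↭ vs → total us ≡ total vs
  total-↭ ↭.refl = refl
  total-↭ (prep u p) = cong (u +ᵥ_) (total-↭ p)
  total-↭ (swap {us} {vs} u v p) = trans (sym (+ᵥ-assoc u v (total us))) (trans (cong₂ _+ᵥ_ (+ᵥ-comm u v) (total-↭ p)) (+ᵥ-assoc v u (total vs)))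
  total-↭ (↭.trans p r) = trans (total-↭ p) (total-↭ r)

  ∑ : ∀ k → (V k → V m) → V m
  ∑ zero g = g []
  ∑ (suc k) g = ∑ k (g ∘ (0# ∷_)) +ᵥ ∑ k (g ∘ (1# ∷_))

  ∑-total : ∀ k g → ∑ k g ≡ total (List.map g (enumeration k))
  ∑-total zero g = sym (+ᵥ-identityʳ _)
  ∑-total (suc k) g = trans (cong₂ _+ᵥ_ (∑-total k (g ∘ (0# ∷_))) (∑-total k (g ∘ (1# ∷_)))) (sym (begin
    total (List.map g (List.map (0# ∷_) es ++ List.map (1# ∷_) es))
      ≡⟨ cong total (map-++ g (List.map (0# ∷_) es) (List.map (1# ∷_) es)) ⟩
    total (List.map g (List.map (0# ∷_) es) ++ List.map g (List.map (1# ∷_) es))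
      ≡⟨ total-++ (List.map g (List.map (0# ∷_) es)) _ ⟩
    total (List.map g (List.map (0# ∷_) es)) +ᵥ total (List.map g (List.map (1# ∷_) es))
      ≡⟨ cong₂ (λ us vs → total us +ᵥ total vs) (map-∘ es) (map-∘ es) ⟨
    total (List.map (g ∘ (0# ∷_)) es) +ᵥ total (List.map (g ∘ (1# ∷_)) es) ∎))
    where es = enumeration k

  -- Both lists of values are free of repetitions and have the same members, so they are
  -- permutations of each other. This compares two parametrisations of one flat.
  ∑-reindex : ∀ {k} {g h : V k → V m} → Injective _≡_ _≡_ g → Injective _≡_ _≡_ h →
    (∀ as → ∃ λ bs → h bs ≡ g as) → (∀ bs → ∃ λ as → g as ≡ h bs) → ∑ k g ≡ ∑ k h
  ∑-reindex {k} {g} {h} g-inj h-inj g⊆h h⊆g = trans (∑-total k g) (trans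
    (total-↭ (∼bag⇒↭ (unique∧set⇒bag (Unique.map⁺ g-inj (enumeration-unique k)) (Unique.map⁺ h-inj (enumeration-unique k))
      (mk⇔ (include g⊆h) (include h⊆g)))))
    (sym (∑-total k h)))
    where
    include : ∀ {g h : V k → V m} → (∀ as → ∃ λ bs → h bs ≡ g as) → ∀ {v} → v ∈ List.map g (enumeration k) → v ∈ List.map h (enumeration k)
    include {g} {h} ⊆ v∈ with ∈-map⁻ g v∈
    ... | as , _ , refl = subst (_∈ List.map h (enumeration k)) (proj₂ (⊆ as)) (∈-map⁺ h (enumeration-complete (proj₁ (⊆ as))))

  ∑-cong : ∀ k {g h : V k → V m} → (∀ as → g as ≡ h as) → ∑ k g ≡ ∑ k h
  ∑-cong zero eq = eq []
  ∑-cong (suc k) eq = cong₂ _+ᵥ_ (∑-cong k (eq ∘ (0# ∷_))) (∑-cong k (eq ∘ (1# ∷_)))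

  ∑-+ : ∀ k (g h : V k → V m) → ∑ k g +ᵥ ∑ k h ≡ ∑ k (λ as → g as +ᵥ h as)
  ∑-+ zero g h = refl
  ∑-+ (suc k) g h = trans
    (solve 4 (λ a b c d → (a :+ b) :+ (c :+ d) := (a :+ c) :+ (b :+ d)) refl (∑ k (g ∘ (0# ∷_))) _ (∑ k (h ∘ (0# ∷_))) _)
    (cong₂ _+ᵥ_ (∑-+ k (g ∘ (0# ∷_)) (h ∘ (0# ∷_))) (∑-+ k (g ∘ (1# ∷_)) (h ∘ (1# ∷_))))

  ∑-scale : ∀ k d (g : V k → V m) → ∑ k (λ as → d · g as) ≡ d · ∑ k g
  ∑-scale zero d g = refl
  ∑-scale (suc k) d g = trans (cong₂ _+ᵥ_ (∑-scale k d (g ∘ (0# ∷_))) (∑-scale k d (g ∘ (1# ∷_)))) (sym (·-distribˡ d _ _))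

  lc-0∷ : ∀ {k} (v : V m) as (vs : Vec (V m) k) → lc (0# ∷ as) (v ∷ vs) ≡ lc as vs
  lc-0∷ v as vs = trans (cong (_+ᵥ lc as vs) (·ᵥ-zero v)) (+ᵥ-identityˡ _)

  lc-1∷ : ∀ {k} (v : V m) as (vs : Vec (V m) k) → lc (1# ∷ as) (v ∷ vs) ≡ v +ᵥ lc as vs
  lc-1∷ v as vs = cong (_+ᵥ lc as vs) (·ᵥ-one v)

  -- Points are paired along the first direction `v`, and each pair sums to v. There are 2^(k + 1)
  -- pairs, an even number.
  ∑-flat : ∀ {k} x (vs : Vec (V m) (suc (suc k))) → ∑ (suc (suc k)) (λ as → x +ᵥ lc as vs) ≡ 0ᵥ
  ∑-flat {k} x (v ∷ vs) = trans (∑-+ (suc k) (λ as → x +ᵥ lc (0# ∷ as) (v ∷ vs)) (λ as → x +ᵥ lc (1# ∷ as) (v ∷ vs))) (trans (∑-cong (suc k) λ as → begin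
      (x +ᵥ lc (0# ∷ as) (v ∷ vs)) +ᵥ (x +ᵥ lc (1# ∷ as) (v ∷ vs))
        ≡⟨ cong₂ (λ s t → (x +ᵥ s) +ᵥ (x +ᵥ t)) (lc-0∷ v as vs) (lc-1∷ v as vs) ⟩
      (x +ᵥ lc as vs) +ᵥ (x +ᵥ (v +ᵥ lc as vs))
        ≡⟨ solve 3 (λ x s v → (x :+ s) :+ (x :+ (v :+ s)) := v) refl x (lc as vs) v ⟩
      v ∎)
    (v+v≡0 (∑ k (λ _ → v))))

  -- subspacePoly us x is the product of x + u over the span of us; it is additive in x.
  subspacePoly : ∀ {k} → Vec (V m) k → V m → V m
  subspacePoly [] x = x
  subspacePoly (v ∷ us) x = subspacePoly us x · subspacePoly us (x +ᵥ v)

  -- With P additive, P x · P (x + v) = (P x)² + P v · P x is additive again.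
  subspacePoly-+ : ∀ {k} (us : Vec (V m) k) x y → subspacePoly us (x +ᵥ y) ≡ subspacePoly us x +ᵥ subspacePoly us y
  subspacePoly-+ [] x y = refl
  subspacePoly-+ (v ∷ us) x y = begin
    P (x +ᵥ y) · P ((x +ᵥ y) +ᵥ v)
      ≡⟨ cong₂ _·_ (subspacePoly-+ us x y) (trans (subspacePoly-+ us (x +ᵥ y) v) (cong (_+ᵥ P v) (subspacePoly-+ us x y))) ⟩
    (P x +ᵥ P y) · ((P x +ᵥ P y) +ᵥ P v)
      ≡⟨ solve 3 (λ x y v → (x :+ y) :* ((x :+ y) :+ v) := x :* (x :+ v) :+ y :* (y :+ v)) refl (P x) (P y) (P v) ⟩
    P x · (P x +ᵥ P v) +ᵥ P y · (P y +ᵥ P v)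
      ≡⟨ cong₂ (λ s t → P x · s +ᵥ P y · t) (subspacePoly-+ us x v) (subspacePoly-+ us y v) ⟨
    P x · P (x +ᵥ v) +ᵥ P y · P (y +ᵥ v) ∎
    where P = subspacePoly us

  Span-+ : ∀ {k} {us : Vec (V m) k} {x y} → Span us x → Span us y → Span us (x +ᵥ y)
  Span-+ {us = us} (as , refl) (bs , refl) = as +ᵥ bs , sym (lc-+ as bs us)

  Span-0 : ∀ {k} {us : Vec (V m) k} → Span us 0ᵥ
  Span-0 {us = us} = 0ᵥ , sym (lc-0 us)

  Span-there : ∀ {k} {v} {us : Vec (V m) k} {x} → Span us x → Span (v ∷ us) x
  Span-there {v = v} {us} (as , refl) = 0# ∷ as , sym (lc-0∷ v as us)

  Span-here : ∀ {k} {v} {us : Vec (V m) k} → Span (v ∷ us) v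
  Span-here {v = v} {us} = 1# ∷ 0ᵥ , sym (trans (lc-1∷ v 0ᵥ us) (trans (cong (v +ᵥ_) (lc-0 us)) (+ᵥ-identityʳ v)))

  x+v+v : ∀ (x v : V m) → (x +ᵥ v) +ᵥ v ≡ x
  x+v+v x v = trans (+ᵥ-assoc x v v) (trans (cong (x +ᵥ_) (v+v≡0 v)) (+ᵥ-identityʳ x))

  subspacePoly-kernel : ∀ {k} (us : Vec (V m) k) x → subspacePoly us x ≡ 0ᵥ → Span us x
  subspacePoly-kernel [] x eq = [] , eq
  subspacePoly-kernel (v ∷ us) x eq with ·-integral eq
  ... | inj₁ eq₁ = Span-there (subspacePoly-kernel us x eq₁)
  ... | inj₂ eq₂ = subst (Span (v ∷ us)) (x+v+v x v) (Span-+ {us = v ∷ us} (Span-there (subspacePoly-kernel us (x +ᵥ v) eq₂)) (Span-here {us = us}))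

  -- The coefficient of x in the additive polynomial, which is also its derivative: passing from P
  -- to P² + P v · P multiplies it by P v.
  linearCoefficient : ∀ {k} → Vec (V m) k → V m
  linearCoefficient [] = one
  linearCoefficient (v ∷ us) = linearCoefficient us · subspacePoly us v

  linearCoefficient≢0 : ∀ {k} (us : Vec (V m) k) → Independent us → linearCoefficient us ≢ 0ᵥ
  linearCoefficient≢0 [] _ = one≢0
  linearCoefficient≢0 (v ∷ us) ind = ·-nonzero (linearCoefficient≢0 us (Independent-tail {v = v} ind))
    λ eq → Independent⇒∉Span ind (subspacePoly-kernel us v eq)

  -- The logarithmic derivative of an additive polynomial.
  ∑-inv : ∀ {k} (us : Vec (V m) k) x → ¬ Span us x →
    ∑ k (λ as → inv (x +ᵥ lc as us)) · subspacePoly us x ≡ linearCoefficient us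
  ∑-inv [] x x∉ = trans (cong (λ z → inv z · x) (+ᵥ-identityʳ x)) (trans (·-comm (inv x) x) (·-inv λ x≡0 → x∉ ([] , x≡0)))
  ∑-inv {suc k} (v ∷ us) x x∉ = begin
    (S₀ +ᵥ S₁) · (P x · P (x +ᵥ v))
      ≡⟨ cong (_· (P x · P (x +ᵥ v))) (cong₂ _+ᵥ_
           (∑-cong k λ as → cong (λ l → inv (x +ᵥ l)) (lc-0∷ v as us))
           (∑-cong k λ as → cong inv (trans (cong (x +ᵥ_) (lc-1∷ v as us)) (sym (+ᵥ-assoc x v (lc as us)))))) ⟩
    (T₀ +ᵥ T₁) · (P x · P (x +ᵥ v))
      ≡⟨ solve 4 (λ s t p r → (s :+ t) :* (p :* r) := (s :* p) :* r :+ (t :* r) :* p) refl T₀ T₁ (P x) (P (x +ᵥ v)) ⟩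
    (T₀ · P x) · P (x +ᵥ v) +ᵥ (T₁ · P (x +ᵥ v)) · P x
      ≡⟨ cong₂ (λ s t → s · P (x +ᵥ v) +ᵥ t · P x) (∑-inv us x (x∉ ∘ Span-there))
           (∑-inv us (x +ᵥ v) λ x+v∈ → x∉ (subst (Span (v ∷ us)) (x+v+v x v) (Span-+ {us = v ∷ us} (Span-there x+v∈) (Span-here {us = us})))) ⟩
    C · P (x +ᵥ v) +ᵥ C · P x
      ≡⟨ cong (λ s → C · s +ᵥ C · P x) (subspacePoly-+ us x v) ⟩
    C · (P x +ᵥ P v) +ᵥ C · P x
      ≡⟨ solve 3 (λ c x v → c :* (x :+ v) :+ c :* x := c :* v) refl C (P x) (P v) ⟩
    C · P v ∎
    where
    P = subspacePoly us
    C = linearCoefficient us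
    S₀ = ∑ k (λ as → inv (x +ᵥ lc (0# ∷ as) (v ∷ us)))
    S₁ = ∑ k (λ as → inv (x +ᵥ lc (1# ∷ as) (v ∷ us)))
    T₀ = ∑ k (λ as → inv (x +ᵥ lc as us))
    T₁ = ∑ k (λ as → inv ((x +ᵥ v) +ᵥ lc as us))

  ∑-image : ∀ {k} {f : V m → V m} x (us : Vec (V m) (suc (suc k))) → Independent us → Perm f →
    Flat (suc (suc k)) (Im f (λ y → Σ _ λ as → y ≡ x +ᵥ lc as us)) → ∑ (suc (suc k)) (λ as → f (x +ᵥ lc as us)) ≡ 0ᵥ
  ∑-image {k} {f} x us ind perm (y , vs , ind′ , iff) = trans
    (∑-reindex (λ eq → lc-injective {vs = us} ind (+ᵥ-cancelˡ x (proj₁ perm eq)))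
               (λ eq → lc-injective {vs = vs} ind′ (+ᵥ-cancelˡ y eq))
               (λ as → let (bs , eq) = Equivalence.to (iff (f (x +ᵥ lc as us))) (_ , (as , refl) , refl) in bs , sym eq)
               back)
    (∑-flat y vs)
    where
    back : ∀ bs → ∃ λ as → f (x +ᵥ lc as us) ≡ y +ᵥ lc bs vs
    back bs with Equivalence.from (iff (y +ᵥ lc bs vs)) (bs , refl)
    ... | _ , (as , refl) , eq = as , eq

  inv-breaks : ∀ {k d} {X : V m → Set} → d ≢ 0ᵥ → Flat (suc (suc k)) X → ¬ X 0ᵥ → ¬ Flat (suc (suc k)) (Im (λ v → d · inv v) X)
  inv-breaks {k} {d} {X} d≢0 (x , us , ind , iff) 0∉X flat = linearCoefficient≢0 us ind (begin
    linearCoefficient us                         ≡⟨ ∑-inv us x x∉ ⟨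
    ∑ _ (λ as → inv (x +ᵥ lc as us)) · subspacePoly us x  ≡⟨ cong (_· subspacePoly us x) ∑≡0 ⟩
    0ᵥ · subspacePoly us x                       ≡⟨ ·-zeroˡ _ ⟩
    0ᵥ                                           ∎)
    where
    x∉ : ¬ Span us x
    x∉ (as , x≡) = 0∉X (Equivalence.from (iff 0ᵥ) (as , sym (trans (cong (_+ᵥ lc as us) x≡) (v+v≡0 (lc as us)))))
    flat′ : Flat (suc (suc k)) (Im (λ v → d · inv v) (λ y → Σ _ λ as → y ≡ x +ᵥ lc as us))
    flat′ = Flat-cong (λ y → mk⇔ (λ (z , Xz , eq) → z , Equivalence.to (iff z) Xz , eq) (λ (z , p , eq) → z , Equivalence.from (iff z) p , eq)) flat
    ∑≡0 : ∑ (suc (suc k)) (λ as → inv (x +ᵥ lc as us)) ≡ 0ᵥ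
    ∑≡0 with ·-integral (trans (sym (∑-scale _ d (λ as → inv (x +ᵥ lc as us)))) (∑-image x us ind (scaledInv-perm d≢0) flat′))
    ... | inj₁ d≡0 = ⊥-elim (d≢0 d≡0)
    ... | inj₂ eq = eq

  through-0⇒Span : ∀ {k} {X : V m → Set} {x} {us : Vec (V m) k} → (∀ z → X z ⇔ (Σ (V k) λ as → z ≡ x +ᵥ lc as us)) →
    X 0ᵥ → ∀ z → X z ⇔ Span us z
  through-0⇒Span {k} {X} {x} {us} iff X0 z = mk⇔ to from
    where
    x∈ : Span us x
    x∈ with Equivalence.to (iff 0ᵥ) X0
    ... | as , 0≡ = as , v+w≡0⇒v≡w x (lc as us) (sym 0≡)
    to : X z → Span us z
    to Xz with Equivalence.to (iff z) Xz
    ... | as , refl = Span-+ {us = us} x∈ (as , refl)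
    from : Span us z → X z
    from z∈ with Span-+ {us = us} x∈ z∈
    ... | as , eq = Equivalence.from (iff z) (as , trans (sym (trans (sym (+ᵥ-assoc x x z)) (trans (cong (_+ᵥ z) (v+v≡0 x)) (+ᵥ-identityˡ z)))) (cong (x +ᵥ_) eq))

  -- ω² = ω + 1 gives ω⁴ = ω. For odd m the m-fold Frobenius, which fixes ω, then also sends it to
  -- ω², so ω = ω + 1.
  no-cube-root-of-unity : ∀ j → m ≡ 2 ℕ.* j ℕ.+ 1 → ∀ {ω} → ω · ω ≢ ω +ᵥ one
  no-cube-root-of-unity j m≡ {ω} ω²≡ = one≢0 (+ᵥ-cancelˡ ω (begin
    ω +ᵥ one                       ≡⟨ ω²≡ ⟨
    ω · ω                          ≡⟨ cong (λ z → z · z) (even j) ⟨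
    fold ω sq (suc (j ℕ.+ j))      ≡⟨ cong (fold ω sq) m≡′ ⟨
    fold ω sq m                    ≡⟨ frobenius-fixed ω ⟩
    ω                              ≡⟨ +ᵥ-identityʳ ω ⟨
    ω +ᵥ 0ᵥ                        ∎))
    where
    sq : V m → V m
    sq u = u · u
    m≡′ : m ≡ suc (j ℕ.+ j)
    m≡′ = trans m≡ (trans (ℕ.+-comm _ 1) (cong (λ i → suc (j ℕ.+ i)) (ℕ.+-identityʳ j)))
    fourth : (ω · ω) · (ω · ω) ≡ ω
    fourth = begin
      (ω · ω) · (ω · ω)              ≡⟨ cong₂ _·_ ω²≡ ω²≡ ⟩
      (ω +ᵥ one) · (ω +ᵥ one)        ≡⟨ solve 2 (λ w o → (w :+ o) :* (w :+ o) := w :* w :+ o :* o) refl ω one ⟩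
      ω · ω +ᵥ one · one             ≡⟨ cong₂ _+ᵥ_ ω²≡ (·-identityˡ one) ⟩
      (ω +ᵥ one) +ᵥ one              ≡⟨ x+v+v ω one ⟩
      ω                              ∎
    even : ∀ i → fold ω sq (i ℕ.+ i) ≡ ω
    even zero = refl
    even (suc i) = trans (cong (λ e → sq (fold ω sq e)) (ℕ.+-suc i i)) (trans (cong (λ z → sq (sq z)) (even i)) fourth)

  -- The inverses of 0, u, v, u + v would sum to 0. Clearing denominators gives u² + u v + v² = 0,
  -- so ω = u / v satisfies ω² = ω + 1.
  plane-through-0 : ∀ j → m ≡ 2 ℕ.* j ℕ.+ 1 → ∀ u v → Independent (u ∷ v ∷ []) →
    ¬ Flat 2 (Im inv (λ z → Σ (V 2) λ as → z ≡ 0ᵥ +ᵥ lc as (u ∷ v ∷ [])))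
  plane-through-0 j m≡ u v ind flat = no-cube-root-of-unity j m≡ {u · w} (v+w≡0⇒v≡w _ _ (begin
      (u · w) · (u · w) +ᵥ (u · w +ᵥ one)
        ≡⟨ cong (λ o → (u · w) · (u · w) +ᵥ (u · w +ᵥ o)) (trans (cong₂ _·_ vw≡1 vw≡1) (·-identityˡ one)) ⟨
      (u · w) · (u · w) +ᵥ (u · w +ᵥ (v · w) · (v · w))
        ≡⟨ cong (λ z → (u · w) · (u · w) +ᵥ (z +ᵥ (v · w) · (v · w))) (trans (cong (u · w ·_) vw≡1) (·-identityʳ (u · w))) ⟨
      (u · w) · (u · w) +ᵥ ((u · w) · (v · w) +ᵥ (v · w) · (v · w))
        ≡⟨ solve 3 (λ u v w → (u :* w) :* (u :* w) :+ ((u :* w) :* (v :* w) :+ (v :* w) :* (v :* w))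
             := (u :* (u :+ v) :+ (v :* (u :+ v) :+ u :* v)) :* (w :* w)) refl u v w ⟩
      (u · (u +ᵥ v) +ᵥ (v · (u +ᵥ v) +ᵥ u · v)) · (w · w)
        ≡⟨ cong (_· (w · w)) cleared ⟩
      0ᵥ · (w · w)
        ≡⟨ ·-zeroˡ (w · w) ⟩
      0ᵥ ∎))
    where
    us : Vec (V m) 2
    us = u ∷ v ∷ []
    w = inv v
    s = u +ᵥ v
    lc₀₀ : lc (0# ∷ 0# ∷ []) us ≡ 0ᵥ
    lc₀₀ = lc-0 us
    lc₀₁ : lc (0# ∷ 1# ∷ []) us ≡ v
    lc₀₁ = trans (lc-0∷ u (1# ∷ []) (v ∷ [])) (trans (lc-1∷ v [] []) (+ᵥ-identityʳ v))
    lc₁₀ : lc (1# ∷ 0# ∷ []) us ≡ u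
    lc₁₀ = trans (lc-1∷ u (0# ∷ []) (v ∷ [])) (trans (cong (u +ᵥ_) (lc-0∷ v [] [])) (+ᵥ-identityʳ u))
    lc₁₁ : lc (1# ∷ 1# ∷ []) us ≡ s
    lc₁₁ = trans (lc-1∷ u (1# ∷ []) (v ∷ [])) (cong (u +ᵥ_) (trans (lc-1∷ v [] []) (+ᵥ-identityʳ v)))
    nonzero : ∀ {a b z} → lc (a ∷ b ∷ []) us ≡ z → a ≢ 0# ⊎ b ≢ 0# → z ≢ 0ᵥ
    nonzero {a} {b} eq (inj₁ a≢0) z≡0 = a≢0 (∷-injectiveˡ (ind (a ∷ b ∷ []) (trans eq z≡0)))
    nonzero {a} {b} eq (inj₂ b≢0) z≡0 = b≢0 (∷-injectiveˡ (∷-injectiveʳ {x = a} {y = 0#} (ind (a ∷ b ∷ []) (trans eq z≡0))))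
    v≢0 : v ≢ 0ᵥ
    v≢0 = nonzero lc₀₁ (inj₂ 1≢0)
    u≢0 : u ≢ 0ᵥ
    u≢0 = nonzero lc₁₀ (inj₁ 1≢0)
    s≢0 : s ≢ 0ᵥ
    s≢0 = nonzero lc₁₁ (inj₁ 1≢0)
    vw≡1 : v · w ≡ one
    vw≡1 = ·-inv v≢0
    sum-of-inverses : (inv 0ᵥ +ᵥ w) +ᵥ (inv u +ᵥ inv s) ≡ 0ᵥ
    sum-of-inverses = trans
      (sym (cong₂ _+ᵥ_ (cong₂ _+ᵥ_ (term lc₀₀) (term lc₀₁)) (cong₂ _+ᵥ_ (term lc₁₀) (term lc₁₁))))
      (∑-image 0ᵥ us ind inv-perm flat)
      where
      term : ∀ {l z} → l ≡ z → inv (0ᵥ +ᵥ l) ≡ inv z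
      term {l} eq = cong inv (trans (+ᵥ-identityˡ l) eq)
    cleared : u · s +ᵥ (v · s +ᵥ u · v) ≡ 0ᵥ
    cleared = begin
      u · s +ᵥ (v · s +ᵥ u · v)
        ≡⟨ cong₂ _+ᵥ_ (insert vw≡1 (u · s)) (cong₂ _+ᵥ_ (insert (·-inv u≢0) (v · s)) (insert (·-inv s≢0) (u · v))) ⟩
      (u · s) · (v · w) +ᵥ ((v · s) · (u · inv u) +ᵥ (u · v) · (s · inv s))
        ≡⟨ solve 6 (λ u v s w a c → (u :* s) :* (v :* w) :+ ((v :* s) :* (u :* a) :+ (u :* v) :* (s :* c))
             := (u :* v :* s) :* (w :+ (a :+ c))) refl u v s w (inv u) (inv s) ⟩
      (u · v · s) · (w +ᵥ (inv u +ᵥ inv s))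
        ≡⟨ cong (λ z → (u · v · s) · (z +ᵥ (inv u +ᵥ inv s))) (trans (cong (_+ᵥ w) inv-0) (+ᵥ-identityˡ w)) ⟨
      (u · v · s) · ((inv 0ᵥ +ᵥ w) +ᵥ (inv u +ᵥ inv s))
        ≡⟨ cong (u · v · s ·_) sum-of-inverses ⟩
      (u · v · s) · 0ᵥ
        ≡⟨ ·-zeroʳ _ ⟩
      0ᵥ ∎
      where
      insert : ∀ {o} → o ≡ one → ∀ z → z ≡ z · o
      insert refl z = sym (·-identityʳ z)

  inv-affinityZero₂ : ∀ j → m ≡ 2 ℕ.* j ℕ.+ 1 → AffinityZero F 2 inv
  inv-affinityZero₂ j m≡ X flatX@(x , u ∷ v ∷ [] , ind , iff) flat = inv-breaks one≢0 flatX
    (λ 0∈X → plane-through-0 j m≡ u v ind (Im-cong (X⇔ 0∈X)))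
    (Flat-cong (λ z → mk⇔ (λ (y , Xy , eq) → y , Xy , trans (·-identityˡ (inv y)) eq)
                          (λ (y , Xy , eq) → y , Xy , trans (sym (·-identityˡ (inv y))) eq)) flat)
    where
    X⇔ : X 0ᵥ → ∀ z → X z ⇔ (Σ (V 2) λ as → z ≡ 0ᵥ +ᵥ lc as (u ∷ v ∷ []))
    X⇔ 0∈X z = mk⇔ (λ Xz → let (as , eq) = Equivalence.to (through-0⇒Span {x = x} {us = u ∷ v ∷ []} iff 0∈X z) Xz in as , trans eq (sym (+ᵥ-identityˡ (lc as (u ∷ v ∷ [])))))
                   (λ (as , eq) → Equivalence.from (through-0⇒Span {x = x} {us = u ∷ v ∷ []} iff 0∈X z) (as , trans eq (+ᵥ-identityˡ (lc as (u ∷ v ∷ [])))))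
    Im-cong : ∀ {Y} → (∀ z → X z ⇔ Y z) → Flat 2 (Im inv Y)
    Im-cong X⇔Y = Flat-cong (λ z → mk⇔ (λ (y , Xy , eq) → y , Equivalence.to (X⇔Y y) Xy , eq)
                                       (λ (y , p , eq) → y , Equivalence.from (X⇔Y y) p , eq)) flat

  module _ (φ : Fin 2 → V m → V m) (φ-perm : ∀ t → Perm (φ t)) (φ-0 : ∀ t → φ t 0ᵥ ≡ 0ᵥ)
    (φ-1 : ∀ v → φ 1# v ≡ generator · φ 0# v)
    (breaks : ∀ t {k} {X : V m → Set} → Flat (suc (suc k)) X → ¬ X 0ᵥ → ¬ Flat (suc (suc k)) (Im (φ t) X)) where

    -- Crossing flats of dimension at least 3 have slices of dimension at least 2, to which `breaks`
    -- applies. Thus both slices contain 0 and are the same subspace U, and so are their parallel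
    -- images.
    twisted-affinityZero : ∀ k → 3 ≤ k → k < suc m → AffinityZero F k (twisted φ φ-perm)
    twisted-affinityZero (suc zero) (s≤s ())
    twisted-affinityZero (suc (suc zero)) (s≤s (s≤s ()))
    twisted-affinityZero (suc (suc (suc k))) _ k<1+m X flatX flat with untwist φ φ-perm k≥2 flatX flat
    ... | flat′ , root∉ with slices flatX
    -- φ t fixes 0, so the root of each slice is 0, and the flat avoids it.
    ... | inSlice t x us ind iff = breaks t
      (Flat-cong (λ y → mk⇔ (λ p → Equivalence.from (iff t y) (refl , p)) (λ Xty → proj₂ (Equivalence.to (iff t y) Xty)))
        (affineSpan-Flat x us ind))
      (λ X0 → root∉ (λ Xty → proj₁ (Equivalence.to (iff _ _) Xty)) X0 (φ-0 t))
      (inSlice-image iff flat′)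
    ... | crossing x w us ind iff with crossing-image iff flat′
    -- If d is the dimension of X, the image subspace of dimension d - 1 would be all of F_2^m,
    -- whereas d ≤ m.
    ... | y , v , vs , ind′ , iff′ = ℕ.<⇒≱ k<1+m (s≤s (Vec-injective⇒≤ 2≤q coords coords-injective))
      where
      X0 : ∀ t → X (t ∷ 0ᵥ)
      X0 t = decidable-stable (Flat-dec flatX (t ∷ 0ᵥ)) λ 0∉ → breaks t
        (Flat-cong (λ z → mk⇔ (Equivalence.from (iff t z)) (Equivalence.to (iff t z))) (affineSpan-Flat (x +ᵥ t ·ᵥ w) us ind))
        0∉
        (Flat-cong (λ z → mk⇔ (Equivalence.from (iff′ t z)) (Equivalence.to (iff′ t z))) (affineSpan-Flat (y +ᵥ t ·ᵥ v) vs ind′))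
      slice⇔ : ∀ t z → X (t ∷ z) ⇔ Span us z
      slice⇔ t = through-0⇒Span (iff t) (X0 t)
      image⇔ : ∀ t z → Im (φ t) (λ y → X (t ∷ y)) z ⇔ Span vs z
      image⇔ t = through-0⇒Span (iff′ t) (0ᵥ , X0 t , φ-0 t)
      -- U and its image are the same at both heights, and φ at 1 is the generator times φ at 0.
      generator-closed : ∀ {z} → Span vs z → Span vs (generator · z)
      generator-closed z∈ = step (Equivalence.from (image⇔ 0# _) z∈)
        where
        step : ∀ {z} → Im (φ 0#) (λ y → X (0# ∷ y)) z → Span vs (generator · z)
        step (a , Xa , refl) = Equivalence.to (image⇔ 1# (generator · φ 0# a))
          (a , Equivalence.from (slice⇔ 1# a) (Equivalence.to (slice⇔ 0# a) Xa) , φ-1 a)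
      everything : ∀ z → Span vs z
      everything = all vs ind′ generator-closed
        where
        all : ∀ {l} (vs : Vec (V m) (suc l)) → Independent vs → (∀ {z} → Span vs z → Span vs (generator · z)) → ∀ z → Span vs z
        all (v ∷ vs) ind closed = generated (Span (v ∷ vs)) (Span-0 {us = v ∷ vs}) (Span-+ {us = v ∷ vs}) closed
          (λ v≡0 → Independent⇒∉Span ind (subst (Span vs) (sym v≡0) (Span-0 {us = vs}))) (Span-here {us = vs})
      coords : V m → V (suc (suc k))
      coords z = proj₁ (everything z)
      coords-injective : Injective _≡_ _≡_ coords
      coords-injective {z} {z′} eq = trans (proj₂ (everything z)) (trans (cong (λ as → lc as vs) eq) (sym (proj₂ (everything z′))))

  module _ (2≤m : 2 ≤ m) where

    multiplier : Fin 2 → V m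
    multiplier t with t ≟ 0#
    ... | yes _ = one
    ... | no _ = generator

    multiplier-0 : multiplier 0# ≡ one
    multiplier-0 with 0# ≟ 0#
    ... | yes _ = refl
    ... | no 0≢0 = ⊥-elim (0≢0 refl)

    multiplier-1 : multiplier 1# ≡ generator
    multiplier-1 with 1# ≟ 0#
    ... | yes 1≡0 = ⊥-elim (1≢0 1≡0)
    ... | no _ = refl

    multiplier≢0 : ∀ t → multiplier t ≢ 0ᵥ
    multiplier≢0 t with t ≟ 0#
    ... | yes _ = one≢0
    ... | no _ = generator≢0 2≤m

    scaledInv : Fin 2 → V m → V m
    scaledInv t v = multiplier t · inv v

    scaledInversion : Σ (V (suc m) → V (suc m)) λ f → Perm f × (∀ k → 3 ≤ k → k < suc m → AffinityZero F k f)
    scaledInversion = twisted scaledInv perm , twisted-perm scaledInv perm ,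
      twisted-affinityZero scaledInv perm
        (λ t → trans (cong (multiplier t ·_) inv-0) (·-zeroʳ (multiplier t)))
        (λ v → cong₂ _·_ multiplier-1 (sym (trans (cong (_· inv v) multiplier-0) (·-identityˡ (inv v)))))
        (λ t → inv-breaks (multiplier≢0 t))
      where
      perm : ∀ t → Perm (scaledInv t)
      perm t = scaledInv-perm (multiplier≢0 t)

-- Assembly of the five statements.

scrambled : ∀ {q} (F : FieldOn q) → 3 ≤ q → ∀ n → 1 ≤ n →
  Σ (Pt F n → Pt F n) λ f → IsPerm F f × (∀ k → 1 ≤ k → k < n → AffinityZero F k f)
scrambled F 3≤q (suc n) _ = g , perm , affinityZero
  where open AtLeastThree.Scrambling (AtLeastThree.scrambling F 3≤q n)

binary-planes : (F : FieldOn 2) → ∀ n → 1 ≤ n → (∃ λ j → n ≡ 2 ℕ.* j ℕ.+ 1) →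
  Σ (Pt F n → Pt F n) λ f → IsPerm F f × AffinityZero F 2 f
binary-planes F n 1≤n (j , n≡) = inv , inv-perm , inv-affinityZero₂ j n≡
  where open InverseMap F n (GaloisField.binaryField F n 1≤n)

binary-flats : (F : FieldOn 2) → ∀ n → 3 ≤ n →
  Σ (Pt F n → Pt F n) λ f → IsPerm F f × (∀ k → 3 ≤ k → k < n → AffinityZero F k f)
binary-flats F (suc m) (s≤s 2≤m) = InverseMap.scaledInversion F m (GaloisField.binaryField F m (ℕ.<⇒≤ 2≤m)) 2≤m

open import Data.Nat using (_*_; _+_)

theorem2p1 : ((F : FieldOn 2) → (n : ℕ) → 3 ≤ n → Σ ℕ (λ m → n ≡ 2 * m + 1) →
    Σ (Pt F n → Pt F n) λ f → IsPerm F f × AffinityZero F 2 f)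
    ×
    ((F : FieldOn 2) → (n : ℕ) → 4 ≤ n →
    Σ (Pt F n → Pt F n) λ f → IsPerm F f × ((k : ℕ) → 3 ≤ k → k < n → AffinityZero F k f))
    ×
    ((q : ℕ) → IsPrimePower q → 4 ≤ q → (F : FieldOn q) → (n : ℕ) → 2 ≤ n →
    Σ (Pt F n → Pt F n) λ f → IsPerm F f × ((k : ℕ) → 1 ≤ k → k < n → AffinityZero F k f))
    ×
    ((F : FieldOn 3) → (n : ℕ) → 3 ≤ n →
    Σ (Pt F n → Pt F n) λ f → IsPerm F f × ((k : ℕ) → 2 ≤ k → k < n → AffinityZero F k f))
    ×
    ((F : FieldOn 3) → (n : ℕ) → 2 ≤ n →
    Σ (Pt F n → Pt F n) λ f → IsPerm F f × AffinityZero F 1 f)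
theorem2p1 =
  (λ F n 3≤n → binary-planes F n (ℕ.≤-trans (s≤s z≤n) 3≤n)) ,
  (λ F n 4≤n → binary-flats F n (ℕ.<⇒≤ 4≤n)) ,
  (λ q _ 4≤q F n 2≤n → scrambled F (ℕ.<⇒≤ 4≤q) n (ℕ.<⇒≤ 2≤n)) ,
  -- For q = 3 the same permutation breaks proper flats of every positive dimension, so it serves
  -- this clause and the next.
  (λ F n 3≤n → let f , perm , zero-affinity = scrambled F ℕ.≤-refl n (ℕ.≤-trans (s≤s z≤n) 3≤n)
               in f , perm , λ k 2≤k → zero-affinity k (ℕ.<⇒≤ 2≤k)) ,
  (λ F n 2≤n → let f , perm , zero-affinity = scrambled F ℕ.≤-refl n (ℕ.<⇒≤ 2≤n)
               in f , perm , zero-affinity 1 ℕ.≤-refl 2≤n)
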